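{- Let $q$ be an odd prime power, $d\ge 3$, $E\subset \mathbb F_q^d$ nonempty, $\lambda\in \mathbb{F}_q\setminus \{0, 1,-1\}$, and $0<N<q$ a real number. (a) If $d\ge 3$ is odd, then $$|\mathcal{T}_1(X_\pi, E,N)| \le \frac{Nq^{d-1}}{(q-N)|E|} + \frac{Nq^{\frac{d-1}{2}}}{q-N}.$$ (b) If $d\ge 4$ is even and $\eta\left( (-1)^{\frac{d}{2}} (\lambda^2-1) \right)=-1$, then $$|\mathcal{T}_1(X_\pi, E,N)| \le \frac{Nq^{d-1}}{(q-N)|E|} + \frac{Nq^{\frac{d-2}{2}}}{q-N}.$$ (c) If $d\ge 4$ is even and $\eta\left( (-1)^{\frac{d}{2}} (\lambda^2-1) \right)=1$, then $$|\mathcal{T}_1(X_\pi, E,N)|\le \frac{Nq^{d-1}}{(q-N)|E|} + \frac{N \left(q^{\frac{d}{2}} -q^{\frac{d-2}{2}}\right)}{q-N}.$$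
   Context: $\mathbb F_q$ is the finite field with $q$ elements. $\eta$ is the quadratic character of $\mathbb F_q$: $\eta(t)=1$ if $t$ is a nonzero square, $\eta(0)=0$, $\eta(t)=-1$ otherwise. For $\mathbf x\in\mathbb F_q^d$, $\|\mathbf x\|=x_1^2+\cdots+x_d^2$, and $\mathbf x\cdot\mathbf y=\sum_i x_iy_i$. $S^{d-1}=\{\mathbf x\in\mathbb F_q^d:\|\mathbf x\|=1\}$, $\pi=\{\mathbf x\in\mathbb F_q^d: x_d=\lambda\}$. $X_\pi$ is the set of lines through the origin (one-dimensional linear subspaces of $\mathbb F_q^d$) that contain a nonzero element of $\pi\cap S^{d-1}$. For a linear subspace $V$, $V^\perp=\{\mathbf x\in\mathbb F_q^d:\mathbf x\cdot\mathbf y=0\ \forall \mathbf y\in V\}$, and $\pi_V(E)=\{\mathbf x+V^\perp:\mathbf x\in\mathbb F_q^d,\ (\mathbf x+V^\perp)\cap E\neq\emptyset\}$, a set of cosets. $\mathcal T_1(X_\pi,E,N)=\{V\in X_\pi: |\pi_V(E)|\le N\}$. -}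

module Defs where

open import Algebra.Bundles using (CommutativeRing; Semiring)
open import Algebra.Structures using (IsCommutativeRing)
import Algebra.Definitions.RawSemiring as RawSemiringDefs
open import Data.Empty using (⊥)
open import Data.Fin.Base using (Fin)
open import Data.Fin.Properties using (any?; inj⇒≟)
open import Data.Integer.Base as ℤ using (ℤ; 0ℤ; 1ℤ; -1ℤ)
open import Data.List.Base as List using (List; []; _∷_; length; filter; allFin; cartesianProductWith)
open import Data.List.Membership.Propositional using () renaming (_∈_ to _∈ˡ_)
open import Data.List.Membership.Propositional.Properties
  using (∈-allFin; ∈-map⁺; ∈-cartesianProductWith⁺; ∈-filter⁺)
open import Data.List.Relation.Unary.All using (All)
open import Data.List.Relation.Unary.Any using (here)
import Data.List.Relation.Unary.Unique.Setoid as UniqueSetoid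
open import Data.Nat.Base as ℕ using (ℕ; zero; suc)
open import Data.Nat.Primality using (Prime)
import Data.Nat.Properties as ℕₚ
open import Data.Product.Base using (∃; ∃₂; _×_; _,_)
open import Data.Rational.Base as ℚ using (ℚ; 0ℚ; 1ℚ; ½; ∣_∣)
import Data.Rational.Properties as ℚₚ
open import Data.Rational.Solver using (module +-*-Solver)
open import Data.Vec.Base as Vec using (Vec; []; _∷_; zipWith; replicate; last; foldr′)
open import Function.Bundles using (_↔_; Inverse)
open import Function.Properties.Inverse using (↔-sym; ↔⇒↣)
open import Level using (Level; 0ℓ; _⊔_) renaming (suc to lsuc)
open import Relation.Binary.Bundles using (Setoid)
open import Relation.Binary.Definitions using (DecidableEquality)
open import Relation.Binary.PropositionalEquality
  using (_≡_; _≢_; refl; sym; trans; cong; cong₂; subst)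
open import Relation.Nullary.Decidable using (yes; no; via-injection)
open import Relation.Nullary.Negation using (contradiction)
open import Relation.Unary using (Pred; Decidable; Satisfiable; _≐_; _∈_)
open import Relation.Unary.Relation.Binary.Equality using (≐-setoid)
import Relation.Binary.Construct.On as On

------------------------------------------------------------------------
-- Real numbers: Cauchy sequences of rationals.  Arithmetic is termwise;
-- the order relations do not depend on finitely many terms, and equality
-- of reals is `x ≤ℝ y × y ≤ℝ x`.

Eventually : Pred ℕ 0ℓ → Set
Eventually P = ∃ λ M → ∀ n → M ℕ.≤ n → P n

IsCauchy : (ℕ → ℚ) → Set
IsCauchy s = ∀ ε → 0ℚ ℚ.< ε →
  ∃ λ M → ∀ m n → M ℕ.≤ m → M ℕ.≤ n → ∣ s m ℚ.- s n ∣ ℚ.≤ ε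

record ℝ : Set where
  constructor mkℝ
  field
    seq    : ℕ → ℚ
    cauchy : IsCauchy seq

open ℝ public

infix 4 _≤ℝ_ _<ℝ_

_≤ℝ_ : ℝ → ℝ → Set
x ≤ℝ y = ∀ ε → 0ℚ ℚ.< ε → Eventually λ n → seq x n ℚ.≤ seq y n ℚ.+ ε

_<ℝ_ : ℝ → ℝ → Set
x <ℝ y = ∃ λ ε → 0ℚ ℚ.< ε × Eventually λ n → seq x n ℚ.+ ε ℚ.≤ seq y n

private
  half+half : ∀ ε → ε ℚ.* ½ ℚ.+ ε ℚ.* ½ ≡ ε
  half+half ε = trans (sym (ℚₚ.*-distribˡ-+ ε ½ ½)) (ℚₚ.*-identityʳ ε)

  *-pos : ∀ {p q} → 0ℚ ℚ.< p → 0ℚ ℚ.< q → 0ℚ ℚ.< p ℚ.* q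
  *-pos {p} {q} p>0 q>0 = ℚₚ.positive⁻¹ (p ℚ.* q)
    {{ℚₚ.pos*pos⇒pos p {{ℚ.positive p>0}} q {{ℚ.positive q>0}}}}

  *-mono-nonNeg : ∀ {p q r s} → 0ℚ ℚ.≤ r → 0ℚ ℚ.≤ q → p ℚ.≤ q → r ℚ.≤ s → p ℚ.* r ℚ.≤ q ℚ.* s
  *-mono-nonNeg {p} {q} {r} {s} r≥0 q≥0 p≤q r≤s = ℚₚ.≤-trans
    (ℚₚ.*-monoʳ-≤-nonNeg r {{ℚ.nonNegative r≥0}} p≤q)
    (ℚₚ.*-monoˡ-≤-nonNeg q {{ℚ.nonNegative q≥0}} r≤s)

  ∣a-b∣≡∣b-a∣ : ∀ a b → ∣ a ℚ.- b ∣ ≡ ∣ b ℚ.- a ∣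
  ∣a-b∣≡∣b-a∣ a b = trans (sym (ℚₚ.∣-p∣≡∣p∣ (a ℚ.- b)))
    (cong ∣_∣ (solve 2 (λ x y → :- (x :- y) := y :- x) refl a b))
    where open +-*-Solver

  eventuallyBounded : ∀ {s} → IsCauchy s →
    ∃ λ B → 0ℚ ℚ.< B × Eventually λ n → ∣ s n ∣ ℚ.≤ B
  eventuallyBounded {s} c with c 1ℚ (ℚₚ.positive⁻¹ 1ℚ)
  ... | M , h = 1ℚ ℚ.+ ∣ s M ∣
              , ℚₚ.+-mono-<-≤ (ℚₚ.positive⁻¹ 1ℚ) (ℚₚ.0≤∣p∣ (s M))
              , M , λ n M≤n → begin
      ∣ s n ∣                         ≡⟨ cong ∣_∣ (solve 2 (λ x y → x := (x :- y) :+ y) refl (s n) (s M)) ⟩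
      ∣ (s n ℚ.- s M) ℚ.+ s M ∣       ≤⟨ ℚₚ.∣p+q∣≤∣p∣+∣q∣ (s n ℚ.- s M) (s M) ⟩
      ∣ s n ℚ.- s M ∣ ℚ.+ ∣ s M ∣     ≤⟨ ℚₚ.+-monoˡ-≤ ∣ s M ∣ (h n M M≤n ℕₚ.≤-refl) ⟩
      1ℚ ℚ.+ ∣ s M ∣                  ∎
    where open ℚₚ.≤-Reasoning
          open +-*-Solver

recip : ℚ → ℚ
recip p with p ℚₚ.≟ 0ℚ
... | yes _   = 0ℚ
... | no p≢0 = ℚ.1/_ p {{ℚ.≢-nonZero p≢0}}

recip-inverse : ∀ {p} → 0ℚ ℚ.< p → p ℚ.* recip p ≡ 1ℚ
recip-inverse {p} p>0 with p ℚₚ.≟ 0ℚ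
... | yes p≡0 = contradiction (sym p≡0) (ℚₚ.<⇒≢ p>0)
... | no p≢0 = ℚₚ.*-inverseʳ p {{ℚ.≢-nonZero p≢0}}

recip-pos : ∀ {p} → 0ℚ ℚ.< p → 0ℚ ℚ.< recip p
recip-pos {p} p>0 = ℚₚ.*-cancelˡ-<-nonNeg p {{ℚ.nonNegative (ℚₚ.<⇒≤ p>0)}}
  (ℚₚ.≤-<-trans (ℚₚ.≤-reflexive (ℚₚ.*-zeroʳ p))
    (ℚₚ.<-≤-trans (ℚₚ.positive⁻¹ 1ℚ) (ℚₚ.≤-reflexive (sym (recip-inverse p>0)))))

recip-anti : ∀ {e a} → 0ℚ ℚ.< e → e ℚ.≤ a → recip a ℚ.≤ recip e
recip-anti {e} {a} e>0 e≤a = begin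
  recip a                          ≡⟨ sym (ℚₚ.*-identityʳ _) ⟩
  recip a ℚ.* 1ℚ                   ≡⟨ cong (recip a ℚ.*_) (sym (recip-inverse e>0)) ⟩
  recip a ℚ.* (e ℚ.* recip e)      ≤⟨ ℚₚ.*-monoˡ-≤-nonNeg (recip a) {{ℚ.nonNegative (ℚₚ.<⇒≤ (recip-pos a>0))}}
                                        (ℚₚ.*-monoʳ-≤-nonNeg (recip e) {{ℚ.nonNegative (ℚₚ.<⇒≤ (recip-pos e>0))}} e≤a) ⟩
  recip a ℚ.* (a ℚ.* recip e)      ≡⟨ solve 3 (λ x y z → x :* (y :* z) := (y :* x) :* z) refl (recip a) a (recip e) ⟩
  (a ℚ.* recip a) ℚ.* recip e      ≡⟨ cong (ℚ._* recip e) (recip-inverse a>0) ⟩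
  1ℚ ℚ.* recip e                   ≡⟨ ℚₚ.*-identityˡ _ ⟩
  recip e                          ∎
  where open ℚₚ.≤-Reasoning
        open +-*-Solver
        a>0 = ℚₚ.<-≤-trans e>0 e≤a

fromℚ : ℚ → ℝ
fromℚ p = mkℝ (λ _ → p) λ ε ε>0 → 0 , λ _ _ _ _ → ℚₚ.≤-trans
  (ℚₚ.≤-reflexive (cong ∣_∣ (ℚₚ.+-inverseʳ p))) (ℚₚ.<⇒≤ ε>0)

fromℕ : ℕ → ℝ
fromℕ n = fromℚ (ℤ.+ n ℚ./ 1)

0ℝ : ℝ
0ℝ = fromℕ 0

infixl 6 _+ℝ_ _-ℝ_
infixl 7 _*ℝ_

_+ℝ_ : ℝ → ℝ → ℝ
seq    (x +ℝ y) n = seq x n ℚ.+ seq y n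
cauchy (x +ℝ y) ε ε>0
  with cauchy x (ε ℚ.* ½) (*-pos ε>0 (ℚₚ.positive⁻¹ ½)) | cauchy y (ε ℚ.* ½) (*-pos ε>0 (ℚₚ.positive⁻¹ ½))
... | M , h | M′ , h′ = M ℕ.⊔ M′ , λ m n m≥ n≥ → let
      open ℚₚ.≤-Reasoning
      open +-*-Solver
    in begin
      ∣ (seq x m ℚ.+ seq y m) ℚ.- (seq x n ℚ.+ seq y n) ∣
        ≡⟨ cong ∣_∣ (solve 4 (λ a b c d → (a :+ b) :- (c :+ d) := (a :- c) :+ (b :- d)) refl
             (seq x m) (seq y m) (seq x n) (seq y n)) ⟩
      ∣ (seq x m ℚ.- seq x n) ℚ.+ (seq y m ℚ.- seq y n) ∣
        ≤⟨ ℚₚ.∣p+q∣≤∣p∣+∣q∣ (seq x m ℚ.- seq x n) (seq y m ℚ.- seq y n) ⟩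
      ∣ seq x m ℚ.- seq x n ∣ ℚ.+ ∣ seq y m ℚ.- seq y n ∣
        ≤⟨ ℚₚ.+-mono-≤ (h m n (ℕₚ.m⊔n≤o⇒m≤o M M′ m≥) (ℕₚ.m⊔n≤o⇒m≤o M M′ n≥))
                       (h′ m n (ℕₚ.m⊔n≤o⇒n≤o M M′ m≥) (ℕₚ.m⊔n≤o⇒n≤o M M′ n≥)) ⟩
      ε ℚ.* ½ ℚ.+ ε ℚ.* ½
        ≡⟨ half+half ε ⟩
      ε ∎

-ℝ_ : ℝ → ℝ
seq    (-ℝ x) n = ℚ.- seq x n
cauchy (-ℝ x) ε ε>0 with cauchy x ε ε>0
... | M , h = M , λ m n m≥ n≥ → ℚₚ.≤-trans
  (ℚₚ.≤-reflexive (cong ∣_∣ (solve 2 (λ a b → (:- a) :- (:- b) := b :- a) refl (seq x m) (seq x n))))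
  (h n m n≥ m≥)
  where open +-*-Solver

_-ℝ_ : ℝ → ℝ → ℝ
x -ℝ y = x +ℝ (-ℝ y)

private
  product-close : ∀ a b c d {B C δ} → ∣ a ∣ ℚ.≤ B → ∣ d ∣ ℚ.≤ C →
    ∣ a ℚ.- c ∣ ℚ.≤ δ → ∣ b ℚ.- d ∣ ℚ.≤ δ →
    ∣ a ℚ.* b ℚ.- c ℚ.* d ∣ ℚ.≤ δ ℚ.* (C ℚ.+ B)
  product-close a b c d {B} {C} {δ} a≤B d≤C ac≤δ bd≤δ = begin
    ∣ a ℚ.* b ℚ.- c ℚ.* d ∣
      ≡⟨ cong ∣_∣ (solve 4 (λ a b c d → (a :* b) :- (c :* d) := ((a :- c) :* d) :+ (a :* (b :- d))) refl a b c d) ⟩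
    ∣ (a ℚ.- c) ℚ.* d ℚ.+ a ℚ.* (b ℚ.- d) ∣
      ≤⟨ ℚₚ.∣p+q∣≤∣p∣+∣q∣ ((a ℚ.- c) ℚ.* d) (a ℚ.* (b ℚ.- d)) ⟩
    ∣ (a ℚ.- c) ℚ.* d ∣ ℚ.+ ∣ a ℚ.* (b ℚ.- d) ∣
      ≡⟨ cong₂ ℚ._+_ (ℚₚ.∣p*q∣≡∣p∣*∣q∣ (a ℚ.- c) d) (ℚₚ.∣p*q∣≡∣p∣*∣q∣ a (b ℚ.- d)) ⟩
    ∣ a ℚ.- c ∣ ℚ.* ∣ d ∣ ℚ.+ ∣ a ∣ ℚ.* ∣ b ℚ.- d ∣
      ≤⟨ ℚₚ.+-mono-≤
           (*-mono-nonNeg (ℚₚ.0≤∣p∣ d) (ℚₚ.≤-trans (ℚₚ.0≤∣p∣ (a ℚ.- c)) ac≤δ) ac≤δ d≤C)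
           (*-mono-nonNeg (ℚₚ.0≤∣p∣ (b ℚ.- d)) (ℚₚ.≤-trans (ℚₚ.0≤∣p∣ a) a≤B) a≤B bd≤δ) ⟩
    δ ℚ.* C ℚ.+ B ℚ.* δ
      ≡⟨ cong (δ ℚ.* C ℚ.+_) (ℚₚ.*-comm B δ) ⟩
    δ ℚ.* C ℚ.+ δ ℚ.* B
      ≡⟨ sym (ℚₚ.*-distribˡ-+ δ C B) ⟩
    δ ℚ.* (C ℚ.+ B) ∎
    where open ℚₚ.≤-Reasoning
          open +-*-Solver

  shrink : ∀ {ε K} → 0ℚ ℚ.< ε → 0ℚ ℚ.< K → ∃ λ δ → 0ℚ ℚ.< δ × δ ℚ.* K ≡ ε
  shrink {ε} {K} ε>0 K>0 = ε ℚ.* recip K , *-pos ε>0 (recip-pos K>0) ,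
    trans (ℚₚ.*-assoc ε (recip K) K)
      (trans (cong (ε ℚ.*_) (trans (ℚₚ.*-comm (recip K) K) (recip-inverse K>0)))
        (ℚₚ.*-identityʳ ε))

  recip-close : ∀ a b {e δ} → 0ℚ ℚ.< e → e ℚ.≤ a → e ℚ.≤ b → ∣ a ℚ.- b ∣ ℚ.≤ δ →
    ∣ recip a ℚ.- recip b ∣ ℚ.≤ δ ℚ.* (recip e ℚ.* recip e)
  recip-close a b {e} {δ} e>0 e≤a e≤b ab≤δ = begin
    ∣ recip a ℚ.- recip b ∣
      ≡⟨ cong ∣_∣ (cong₂ ℚ._-_ (trans (sym (ℚₚ.*-identityʳ (recip a))) (cong (recip a ℚ.*_) (sym (recip-inverse b>0))))
                               (trans (sym (ℚₚ.*-identityʳ (recip b))) (cong (recip b ℚ.*_) (sym (recip-inverse a>0))))) ⟩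
    ∣ recip a ℚ.* (b ℚ.* recip b) ℚ.- recip b ℚ.* (a ℚ.* recip a) ∣
      ≡⟨ cong ∣_∣ (solve 4 (λ a b i j → i :* (b :* j) :- j :* (a :* i) := (b :- a) :* (i :* j)) refl a b (recip a) (recip b)) ⟩
    ∣ (b ℚ.- a) ℚ.* (recip a ℚ.* recip b) ∣
      ≡⟨ ℚₚ.∣p*q∣≡∣p∣*∣q∣ (b ℚ.- a) (recip a ℚ.* recip b) ⟩
    ∣ b ℚ.- a ∣ ℚ.* ∣ recip a ℚ.* recip b ∣
      ≡⟨ cong₂ ℚ._*_ (∣a-b∣≡∣b-a∣ b a) (ℚₚ.0≤p⇒∣p∣≡p ij≥0) ⟩
    ∣ a ℚ.- b ∣ ℚ.* (recip a ℚ.* recip b)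
      ≤⟨ *-mono-nonNeg ij≥0 (ℚₚ.≤-trans (ℚₚ.0≤∣p∣ (a ℚ.- b)) ab≤δ) ab≤δ
           (*-mono-nonNeg (ℚₚ.<⇒≤ (recip-pos b>0)) (ℚₚ.<⇒≤ (recip-pos e>0))
             (recip-anti e>0 e≤a) (recip-anti e>0 e≤b)) ⟩
    δ ℚ.* (recip e ℚ.* recip e) ∎
    where open ℚₚ.≤-Reasoning
          open +-*-Solver
          a>0  = ℚₚ.<-≤-trans e>0 e≤a
          b>0  = ℚₚ.<-≤-trans e>0 e≤b
          ij≥0 = ℚₚ.<⇒≤ (*-pos (recip-pos a>0) (recip-pos b>0))

  *-cauchy : ∀ {s t} → IsCauchy s → IsCauchy t → IsCauchy λ n → s n ℚ.* t n
  *-cauchy {s} {t} s-cauchy t-cauchy ε ε>0 =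
    let B , B>0 , M₁ , b₁ = eventuallyBounded s-cauchy
        C , C>0 , M₂ , b₂ = eventuallyBounded t-cauchy
        δ , δ>0 , δK≡ε    = shrink ε>0 (ℚₚ.+-mono-< C>0 B>0)
        M₃ , h            = s-cauchy δ δ>0
        M₄ , h′           = t-cauchy δ δ>0
        l : ∀ {k} → (M₁ ℕ.⊔ M₂) ℕ.⊔ (M₃ ℕ.⊔ M₄) ℕ.≤ k → M₁ ℕ.⊔ M₂ ℕ.≤ k
        l = ℕₚ.m⊔n≤o⇒m≤o (M₁ ℕ.⊔ M₂) (M₃ ℕ.⊔ M₄)
        r : ∀ {k} → (M₁ ℕ.⊔ M₂) ℕ.⊔ (M₃ ℕ.⊔ M₄) ℕ.≤ k → M₃ ℕ.⊔ M₄ ℕ.≤ k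
        r = ℕₚ.m⊔n≤o⇒n≤o (M₁ ℕ.⊔ M₂) (M₃ ℕ.⊔ M₄)
    in (M₁ ℕ.⊔ M₂) ℕ.⊔ (M₃ ℕ.⊔ M₄) , λ m n m≥ n≥ →
      subst (∣ s m ℚ.* t m ℚ.- s n ℚ.* t n ∣ ℚ.≤_) δK≡ε
        (product-close (s m) (t m) (s n) (t n)
          (b₁ m (ℕₚ.m⊔n≤o⇒m≤o M₁ M₂ (l m≥)))
          (b₂ n (ℕₚ.m⊔n≤o⇒n≤o M₁ M₂ (l n≥)))
          (h  m n (ℕₚ.m⊔n≤o⇒m≤o M₃ M₄ (r m≥)) (ℕₚ.m⊔n≤o⇒m≤o M₃ M₄ (r n≥)))
          (h′ m n (ℕₚ.m⊔n≤o⇒n≤o M₃ M₄ (r m≥)) (ℕₚ.m⊔n≤o⇒n≤o M₃ M₄ (r n≥))))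

  recip-cauchy : ∀ {s} → IsCauchy s → ∀ {e} → 0ℚ ℚ.< e →
    Eventually (λ n → 0ℚ ℚ.+ e ℚ.≤ s n) → IsCauchy λ n → recip (s n)
  recip-cauchy {s} s-cauchy {e} e>0 (M , e≤) ε ε>0 =
    let δ , δ>0 , δK≡ε = shrink ε>0 (*-pos (recip-pos e>0) (recip-pos e>0))
        M′ , h         = s-cauchy δ δ>0
    in M ℕ.⊔ M′ , λ m n m≥ n≥ →
      subst (∣ recip (s m) ℚ.- recip (s n) ∣ ℚ.≤_) δK≡ε
        (recip-close (s m) (s n) e>0
          (e≤s m (ℕₚ.m⊔n≤o⇒m≤o M M′ m≥)) (e≤s n (ℕₚ.m⊔n≤o⇒m≤o M M′ n≥))
          (h m n (ℕₚ.m⊔n≤o⇒n≤o M M′ m≥) (ℕₚ.m⊔n≤o⇒n≤o M M′ n≥)))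
    where
      e≤s : ∀ n → M ℕ.≤ n → e ℚ.≤ s n
      e≤s n n≥ = subst (ℚ._≤ s n) (ℚₚ.+-identityˡ e) (e≤ n n≥)

_*ℝ_ : ℝ → ℝ → ℝ
x *ℝ y = mkℝ (λ n → seq x n ℚ.* seq y n) (*-cauchy {seq x} {seq y} (cauchy x) (cauchy y))

-- The junk value `recip 0ℚ` occurs at only finitely many terms of a
-- sequence representing a positive real.
recipℝ : (y : ℝ) → 0ℝ <ℝ y → ℝ
recipℝ y (e , e>0 , e≤) = mkℝ (λ n → recip (seq y n)) (recip-cauchy {seq y} (cauchy y) e>0 e≤)

infixl 7 _/ℝ_[_]

_/ℝ_[_] : ℝ → (y : ℝ) → 0ℝ <ℝ y → ℝ
x /ℝ y [ y>0 ] = x *ℝ recipℝ y y>0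

x<y⇒0<y-x : ∀ {x y} → x <ℝ y → 0ℝ <ℝ y -ℝ x
x<y⇒0<y-x {x} {y} (ε , ε>0 , M , h) = ε , ε>0 , M , λ n n≥ → begin
  0ℚ ℚ.+ ε                            ≡⟨ solve 2 (λ a e → con 0ℚ :+ e := (a :+ e) :- a) refl (seq x n) ε ⟩
  (seq x n ℚ.+ ε) ℚ.- seq x n         ≤⟨ ℚₚ.+-monoˡ-≤ (ℚ.- seq x n) (h n n≥) ⟩
  seq y n ℚ.- seq x n                 ∎
  where open ℚₚ.≤-Reasoning
        open +-*-Solver

*ℝ-pos : ∀ {x y} → 0ℝ <ℝ x → 0ℝ <ℝ y → 0ℝ <ℝ x *ℝ y
*ℝ-pos {x} {y} (ε , ε>0 , M , h) (δ , δ>0 , M′ , h′) =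
  ε ℚ.* δ , *-pos ε>0 δ>0 , M ℕ.⊔ M′ , λ n n≥ → let
      ε≤x = ℚₚ.≤-trans (ℚₚ.≤-reflexive (sym (ℚₚ.+-identityˡ ε))) (h n (ℕₚ.m⊔n≤o⇒m≤o M M′ n≥))
      δ≤y = ℚₚ.≤-trans (ℚₚ.≤-reflexive (sym (ℚₚ.+-identityˡ δ))) (h′ n (ℕₚ.m⊔n≤o⇒n≤o M M′ n≥))
    in ℚₚ.≤-trans (ℚₚ.≤-reflexive (ℚₚ.+-identityˡ (ε ℚ.* δ)))
         (*-mono-nonNeg (ℚₚ.<⇒≤ δ>0) (ℚₚ.≤-trans (ℚₚ.<⇒≤ ε>0) ε≤x) ε≤x δ≤y)

fromℕ-pos : ∀ {n} → 0 ℕ.< n → 0ℝ <ℝ fromℕ n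
fromℕ-pos {suc n} _ = p , p>0 , 0 , λ _ _ → ℚₚ.≤-reflexive (ℚₚ.+-identityˡ p)
  where
    p   = ℤ.+ suc n ℚ./ 1
    p>0 = ℚₚ.positive⁻¹ p {{ℚₚ.normalize-pos (suc n) 1}}

------------------------------------------------------------------------
-- The cardinality of P, counting elements up to the equality of S, is at
-- most r.  Said of duplicate-free lists, so that neither membership in P
-- nor comparison with the real number r has to be decidable.

AtMost : ∀ {a ℓ p : Level} (S : Setoid a ℓ) → Pred (Setoid.Carrier S) p → ℝ → Set (a ⊔ ℓ ⊔ p)
AtMost S P r = ∀ xs → Unique xs → All P xs → fromℕ (length xs) ≤ℝ r
  where open UniqueSetoid S using (Unique)

------------------------------------------------------------------------
-- Finite fields and their vector spaces

IsPrimePower : ℕ → Set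
IsPrimePower q = ∃₂ λ p k → Prime p × 1 ℕ.≤ k × q ≡ p ℕ.^ k

record FiniteField (q : ℕ) : Set₁ where
  infix  8 -_
  infixl 7 _*_
  infixl 6 _+_
  field
    F                 : Set
    _+_ _*_           : F → F → F
    -_                : F → F
    0# 1#             : F
    isCommutativeRing : IsCommutativeRing _≡_ _+_ _*_ -_ 0# 1#
    0≢1               : 0# ≢ 1#
    inverse           : ∀ x → x ≢ 0# → ∃ λ y → x * y ≡ 1#
    enumeration       : Fin q ↔ F

  commutativeRing : CommutativeRing 0ℓ 0ℓ
  commutativeRing = record { isCommutativeRing = isCommutativeRing }

  open CommutativeRing commutativeRing public using (_-_)
  open RawSemiringDefs (Semiring.rawSemiring (CommutativeRing.semiring commutativeRing)) public using (_^_)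

  infix 4 _≟_

  _≟_ : DecidableEquality F
  _≟_ = inj⇒≟ (↔⇒↣ (↔-sym enumeration))

  element : Fin q → F
  element = Inverse.to enumeration

  η : F → ℤ
  η t with t ≟ 0#
  ... | yes _ = 0ℤ
  ... | no  _ with any? (λ i → element i * element i ≟ t)
  ...   | yes _ = 1ℤ
  ...   | no  _ = -1ℤ

  private variable
    d : ℕ

  infix  7 _·_
  infixr 7 _∙ᵛ_
  infixl 6 _+ᵛ_

  sumᵛ : Vec F d → F
  sumᵛ = foldr′ _+_ 0#

  ‖_‖ : Vec F d → F
  ‖ x ‖ = sumᵛ (Vec.map (λ a → a ^ 2) x)

  _·_ : Vec F d → Vec F d → F
  x · y = sumᵛ (zipWith _*_ x y)

  _+ᵛ_ : Vec F d → Vec F d → Vec F d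
  _+ᵛ_ = zipWith _+_

  _∙ᵛ_ : F → Vec F d → Vec F d
  c ∙ᵛ x = Vec.map (c *_) x

  0ᵛ : Vec F d
  0ᵛ = replicate _ 0#

  elements : List F
  elements = List.map element (allFin q)

  vectors : ∀ d → List (Vec F d)
  vectors zero    = [] ∷ []
  vectors (suc d) = cartesianProductWith _∷_ elements (vectors d)

  card : {E : Pred (Vec F d) 0ℓ} → Decidable E → ℕ
  card {d = d} E? = length (filter E? (vectors d))

  ∈-elements : ∀ a → a ∈ˡ elements
  ∈-elements a = subst (_∈ˡ elements) (Inverse.strictlyInverseˡ enumeration a)
    (∈-map⁺ element (∈-allFin (Inverse.from enumeration a)))

  ∈-vectors : (x : Vec F d) → x ∈ˡ vectors d
  ∈-vectors []      = here refl
  ∈-vectors (a ∷ x) = ∈-cartesianProductWith⁺ _∷_ (∈-elements a) (∈-vectors x)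

  card-pos : {E : Pred (Vec F d) 0ℓ} (E? : Decidable E) → Satisfiable E → 0 ℕ.< card E?
  card-pos E? (x , x∈E) = nonempty (∈-filter⁺ E? (∈-vectors x) x∈E)
    where
      nonempty : ∀ {A : Set} {y : A} {ys} → y ∈ˡ ys → 0 ℕ.< length ys
      nonempty {ys = _ ∷ _} _ = ℕ.z<s

  record Subspace (d : ℕ) : Set₁ where
    field
      ⟦_⟧        : Pred (Vec F d) 0ℓ
      0ᵛ-closed  : 0ᵛ ∈ ⟦_⟧
      +ᵛ-closed  : ∀ {x y} → x ∈ ⟦_⟧ → y ∈ ⟦_⟧ → x +ᵛ y ∈ ⟦_⟧
      ∙ᵛ-closed  : ∀ {x} c → x ∈ ⟦_⟧ → c ∙ᵛ x ∈ ⟦_⟧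

  open Subspace public

  subspaceSetoid : ℕ → Setoid (lsuc 0ℓ) 0ℓ
  subspaceSetoid d = On.setoid (≐-setoid (Vec F d) 0ℓ) (⟦_⟧ {d})

  IsLine : Pred (Subspace d) 0ℓ
  IsLine V = ∃ λ v → v ≢ 0ᵛ × ⟦ V ⟧ ≐ λ x → ∃ λ c → x ≡ c ∙ᵛ v

  _⊥ᵛ : Subspace d → Pred (Vec F d) 0ℓ
  (V ⊥ᵛ) x = ∀ y → y ∈ ⟦ V ⟧ → x · y ≡ 0#

  _+ᶜ_ : Vec F d → Pred (Vec F d) 0ℓ → Pred (Vec F d) 0ℓ
  (x +ᶜ W) z = ∃ λ w → w ∈ W × z ≡ x +ᵛ w

  sphere : Pred (Vec F d) 0ℓ
  sphere x = ‖ x ‖ ≡ 1#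

  -- The hyperplane on which the last coordinate is λ₀; F⁰ has no coordinates.
  hyperplane : F → Pred (Vec F d) 0ℓ
  hyperplane {zero}  λ₀ x = ⊥
  hyperplane {suc d} λ₀ x = last x ≡ λ₀

  X[_] : Pred (Vec F d) 0ℓ → Pred (Subspace d) 0ℓ
  X[ π ] V = IsLine V × ∃ λ x → x ≢ 0ᵛ × x ∈ ⟦ V ⟧ × x ∈ π × x ∈ sphere

  -- A set of cosets, each coset being itself a predicate on vectors.
  π[_] : Subspace d → Pred (Vec F d) 0ℓ → Pred (Pred (Vec F d) 0ℓ) 0ℓ
  π[ V ] E C = ∃ λ x → C ≐ (x +ᶜ (V ⊥ᵛ)) × ∃ λ z → z ∈ x +ᶜ (V ⊥ᵛ) × z ∈ E

  T₁ : Pred (Subspace d) 0ℓ → Pred (Vec F d) 0ℓ → ℝ → Pred (Subspace d) (lsuc 0ℓ)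
  T₁ {d} X E N V = X V × AtMost (≐-setoid (Vec F d) 0ℓ) (π[ V ] E) N

{-# OPTIONS --safe #-}
module Submission where

open import Defs
open import Data.Integer.Base using (1ℤ; -1ℤ)
open import Data.Nat.Base as ℕ using (ℕ; _∸_)
open import Data.Nat.Divisibility using (_∣_; _∤_)
open import Data.Nat.DivMod using (_/_)
open import Data.Product.Base using (_×_)
open import Data.Vec.Base using (Vec)
open import Level using (0ℓ)
open import Relation.Binary.PropositionalEquality using (_≡_; _≢_)
open import Relation.Unary using (Pred; Decidable; Satisfiable)

open import Algebra.Bundles using (CommutativeRing)
import Algebra.Properties.CommutativeMonoid.Sum as CommutativeMonoidSum
import Algebra.Properties.Ring as RingProperties
import Algebra.Solver.Ring.NaturalCoefficients.Default as SemiringSolver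
open import Data.Fin.Base using (Fin)
open import Data.Fin.Permutation using (permutation)
open import Data.Fin.Properties using (any?)
import Data.Integer.Base as ℤ
open import Data.Integer.Base using (ℤ; 0ℤ)
import Data.Integer.Properties as ℤₚ
import Data.Integer.Tactic.RingSolver as ℤSolver
open import Data.List.Base as List using (List; []; _∷_; _++_; length; filter; cartesianProductWith; allFin)
open import Data.List.Membership.Propositional using (lose) renaming (_∈_ to _∈ˡ_)
import Data.List.Properties as Listₚ
open import Data.List.Relation.Unary.All as All using (All; []; _∷_)
import Data.List.Relation.Unary.All.Properties as Allₚ
open import Data.List.Relation.Unary.AllPairs using ([]; _∷_)
open import Data.List.Relation.Unary.Any as Any using (here; there)
open import Data.List.Relation.Unary.Unique.Propositional using (Unique)
import Data.List.Relation.Unary.Unique.Propositional.Properties as Uniqueₚ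
import Data.List.Relation.Unary.Unique.Setoid as UniqueSetoid
open import Data.Nat.Base using (zero; suc)
open import Data.Nat.Divisibility using (divides)
import Data.Nat.DivMod as DivMod
import Data.Nat.Properties as ℕₚ
open import Data.Product.Base using (∃; _,_; proj₁; proj₂)
import Data.Rational.Base as ℚ
open import Data.Rational.Base using (ℚ; 0ℚ; 1ℚ)
import Data.Rational.Properties as ℚₚ
open import Data.Rational.Solver using (module +-*-Solver)
import Data.Rational.Unnormalised.Base as ℚᵘ
import Data.Rational.Unnormalised.Properties as ℚᵘₚ
open import Data.Sum.Base using (_⊎_; inj₁; inj₂)
open import Data.Vec.Base as Vec using ([]; _∷_; zipWith; last)
import Data.Vec.Properties as Vecₚ
open import Data.Vec.Relation.Binary.Pointwise.Inductive using (Pointwise; []; _∷_)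
open import Function.Base using (_∘_; id)
open import Function.Bundles using (Inverse; Injection)
open import Function.Properties.Inverse using (↔⇒↣)
open import Relation.Binary.Definitions using (DecidableEquality)
open import Relation.Binary.PropositionalEquality
  using (refl; sym; trans; cong; cong₂; subst; subst₂; module ≡-Reasoning)
open import Relation.Nullary.Decidable using (Dec; yes; no; _×-dec_)
open import Relation.Nullary.Negation using (¬_; contradiction)
open import Relation.Unary using (_≐_; _∈_)
open import Relation.Unary.Relation.Binary.Equality using (≐-setoid)

-- Each line of X_π meets π in exactly one point w, because λ ≠ 0, and |π_V(E)| is the number n(w) of
-- values of x · w on E.  Put J(w) = #{(x , y) ∈ E² : x · w = y · w} and H(w) = q J(w) - |E|².
-- By Cauchy-Schwarz |E|² ≤ n(w) J(w), so n(w) ≤ N forces (q - N) |E|² ≤ N H(w), while H ≥ 0 everywhere.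
-- With c = (λ² - 1) / λ² the points w lie on the cone C of the form x₁² + … + x_{d-1}² + c x_d²; as H
-- is invariant under scaling, (q - 1) ∑_w H(w) ≤ ∑_{ξ ∈ C} H(ξ), a sum over pairs x , y ∈ E of
-- q #(C ∩ (x - y)^⊥) - #C.  For x ≠ y this is (q - 1) (r(u) - q^{d-1}), where r(u) counts the vectors
-- at which the form takes the value u and u is the value of the dual form at x - y.  Adding two squares
-- to a form multiplies r - q^{d-1} by η(-1) q, which leaves only forms in one and two variables.

-- The constant c is forced: on π ∩ S the first d - 1 squares add up to 1 - λ², and c is the
-- coefficient with 1 - λ² + c λ² = 0. As λ is neither 1 nor -1, c ≠ 0, so the form is nondegenerate
-- and has a dual. Working on the homogeneous cone instead of the quadric π ∩ S avoids Gauss sums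
-- and complex characters: homogeneity turns the Fourier transform of the cone into a difference of
-- integer counts, found by completing a square. Pairs carry nonnegative weights, so only an upper
-- bound B on r(u) - q^{d-1} enters, and here the three cases separate. In odd dimension B =
-- q^{(d-1)/2}. In even dimension the difference is σ (q^{d/2} [u = 0] - q^{(d-2)/2}) with a sign σ,
-- so the maximum sits at u ≠ 0 or at u = 0 according to σ. This σ is η((-1)^{d/2} c), the value in
-- the hypotheses of (b) and (c), since c and λ² - 1 differ by a nonzero square factor. Since N is
-- real, the integer part of the argument works with the largest n(w) over the given list of lines,
-- which inherits the bound by N.

module Sums where

  open import Data.Integer.Base using (_+_; _*_; -_; _-_; _≤_)

  private variable
    A B C P Q : Set

  -- Indicators, integer inequalities and finite sums.

  𝟙 : Dec P → ℤ
  𝟙 (yes _) = 1ℤ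
  𝟙 (no _)  = 0ℤ

  𝟙-cong : (P? : Dec P) (Q? : Dec Q) → (P → Q) → (Q → P) → 𝟙 P? ≡ 𝟙 Q?
  𝟙-cong (yes _) (yes _) _ _ = refl
  𝟙-cong (yes p) (no ¬q) f _ = contradiction (f p) ¬q
  𝟙-cong (no ¬p) (yes q) _ g = contradiction (g q) ¬p
  𝟙-cong (no _)  (no _)  _ _ = refl

  𝟙-yes : (P? : Dec P) → P → 𝟙 P? ≡ 1ℤ
  𝟙-yes (yes _) _ = refl
  𝟙-yes (no ¬p) p = contradiction p ¬p

  𝟙-no : (P? : Dec P) → ¬ P → 𝟙 P? ≡ 0ℤ
  𝟙-no (yes p) ¬p = contradiction p ¬p
  𝟙-no (no _)  _  = refl

  𝟙-nonneg : (P? : Dec P) → 0ℤ ≤ 𝟙 P?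
  𝟙-nonneg (yes _) = ℤ.+≤+ ℕ.z≤n
  𝟙-nonneg (no _)  = ℤₚ.≤-refl

  𝟙-idem : (P? : Dec P) → 𝟙 P? * 𝟙 P? ≡ 𝟙 P?
  𝟙-idem (yes _) = refl
  𝟙-idem (no _)  = refl

  𝟙-× : (P? : Dec P) (Q? : Dec Q) (R? : Dec (P × Q)) → 𝟙 P? * 𝟙 Q? ≡ 𝟙 R?
  𝟙-× (yes p) (yes q) R? = sym (𝟙-yes R? (p , q))
  𝟙-× (yes _) (no ¬q) R? = sym (𝟙-no R? (¬q ∘ proj₂))
  𝟙-× (no ¬p) (yes _) R? = sym (𝟙-no R? (¬p ∘ proj₁))
  𝟙-× (no ¬p) (no _)  R? = sym (𝟙-no R? (¬p ∘ proj₁))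

  𝟙-*-cong : (P? : Dec P) {a b : ℤ} → (P → a ≡ b) → 𝟙 P? * a ≡ 𝟙 P? * b
  𝟙-*-cong (yes p) eq = cong (1ℤ *_) (eq p)
  𝟙-*-cong (no _)  _  = refl

  ℤ-+-cancelˡ : ∀ a {b c} → a + b ≡ a + c → b ≡ c
  ℤ-+-cancelˡ a {b} {c} eq = trans (sym (cancel a b)) (trans (cong (_- a) eq) (cancel a c))
    where
      cancel : ∀ a b → a + b - a ≡ b
      cancel = ℤSolver.solve-∀

  *-nonneg : ∀ {a b} → 0ℤ ≤ a → 0ℤ ≤ b → 0ℤ ≤ a * b
  *-nonneg {ℤ.+ m} {ℤ.+ n} _ _ = subst (0ℤ ≤_) (ℤₚ.pos-* m n) (ℤ.+≤+ ℕ.z≤n)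

  square-nonneg : ∀ a → 0ℤ ≤ a * a
  square-nonneg (ℤ.+ m)      = *-nonneg {ℤ.+ m} {ℤ.+ m} (ℤ.+≤+ ℕ.z≤n) (ℤ.+≤+ ℕ.z≤n)
  square-nonneg (ℤ.-[1+ m ]) = ℤ.+≤+ ℕ.z≤n

  *-monoˡ : ∀ {c a b} → 0ℤ ≤ c → a ≤ b → c * a ≤ c * b
  *-monoˡ {c} 0≤c = ℤₚ.*-monoˡ-≤-nonNeg c {{ℤ.nonNegative 0≤c}}

  *-monoʳ : ∀ {c a b} → 0ℤ ≤ c → a ≤ b → a * c ≤ b * c
  *-monoʳ {c} 0≤c = ℤₚ.*-monoʳ-≤-nonNeg c {{ℤ.nonNegative 0≤c}}

  infixr 8 ∑
  syntax ∑ xs (λ x → e) = ∑[ x ← xs ] e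

  ∑ : List A → (A → ℤ) → ℤ
  ∑ []       f = 0ℤ
  ∑ (x ∷ xs) f = f x + ∑ xs f

  ∑-cong : ∀ {f g : A → ℤ} (xs : List A) → (∀ x → f x ≡ g x) → ∑ xs f ≡ ∑ xs g
  ∑-cong []       eq = refl
  ∑-cong (x ∷ xs) eq = cong₂ _+_ (eq x) (∑-cong xs eq)

  ∑-mono : ∀ {f g : A → ℤ} {xs : List A} → All (λ x → f x ≤ g x) xs → ∑ xs f ≤ ∑ xs g
  ∑-mono []       = ℤₚ.≤-refl
  ∑-mono (p ∷ ps) = ℤₚ.+-mono-≤ p (∑-mono ps)

  ∑-mono′ : ∀ {f g : A → ℤ} (xs : List A) → (∀ x → f x ≤ g x) → ∑ xs f ≤ ∑ xs g
  ∑-mono′ xs le = ∑-mono (All.universal le xs)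

  ∑-zero : (xs : List A) → ∑[ x ← xs ] 0ℤ ≡ 0ℤ
  ∑-zero []       = refl
  ∑-zero (_ ∷ xs) = trans (ℤₚ.+-identityˡ _) (∑-zero xs)

  ∑-nonneg : ∀ {f : A → ℤ} (xs : List A) → (∀ x → 0ℤ ≤ f x) → 0ℤ ≤ ∑ xs f
  ∑-nonneg {f = f} xs f≥0 = subst (_≤ ∑ xs f) (∑-zero xs) (∑-mono′ xs f≥0)

  ∑-+ : ∀ (xs : List A) (f g : A → ℤ) → ∑[ x ← xs ] (f x + g x) ≡ ∑ xs f + ∑ xs g
  ∑-+ []       f g = refl
  ∑-+ (x ∷ xs) f g = trans (cong (f x + g x +_) (∑-+ xs f g)) (interchange (f x) (g x) (∑ xs f) (∑ xs g))
    where
      interchange : ∀ a b c d → a + b + (c + d) ≡ a + c + (b + d)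
      interchange = ℤSolver.solve-∀

  ∑-*ˡ : ∀ (xs : List A) c (f : A → ℤ) → ∑[ x ← xs ] (c * f x) ≡ c * ∑ xs f
  ∑-*ˡ []       c f = sym (ℤₚ.*-zeroʳ c)
  ∑-*ˡ (x ∷ xs) c f = trans (cong (c * f x +_) (∑-*ˡ xs c f)) (sym (ℤₚ.*-distribˡ-+ c (f x) (∑ xs f)))

  ∑-*ʳ : ∀ (xs : List A) (f : A → ℤ) c → ∑[ x ← xs ] (f x * c) ≡ ∑ xs f * c
  ∑-*ʳ xs f c = trans (∑-cong xs λ x → ℤₚ.*-comm (f x) c) (trans (∑-*ˡ xs c f) (ℤₚ.*-comm c (∑ xs f)))

  ∑-neg : ∀ (xs : List A) (f : A → ℤ) → ∑[ x ← xs ] (- f x) ≡ - ∑ xs f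
  ∑-neg []       f = refl
  ∑-neg (x ∷ xs) f = trans (cong (- f x +_) (∑-neg xs f)) (sym (ℤₚ.neg-distrib-+ (f x) (∑ xs f)))

  ∑-- : ∀ (xs : List A) (f g : A → ℤ) → ∑[ x ← xs ] (f x - g x) ≡ ∑ xs f - ∑ xs g
  ∑-- xs f g = trans (∑-+ xs f (λ x → - g x)) (cong (∑ xs f +_) (∑-neg xs g))

  ∑-const : ∀ (xs : List A) c → ∑[ x ← xs ] c ≡ ℤ.+ length xs * c
  ∑-const []       c = refl
  ∑-const (x ∷ xs) c = trans (cong (c +_) (∑-const xs c)) (sym (ℤₚ.suc-* (ℤ.+ length xs) c))

  ∑-swap : ∀ (xs : List A) (ys : List B) (f : A → B → ℤ) →
    ∑[ x ← xs ] ∑[ y ← ys ] f x y ≡ ∑[ y ← ys ] ∑[ x ← xs ] f x y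
  ∑-swap []       ys f = sym (∑-zero ys)
  ∑-swap (x ∷ xs) ys f = trans (cong (∑ ys (f x) +_) (∑-swap xs ys f)) (sym (∑-+ ys (f x) _))

  ∑-* : ∀ (xs : List A) (ys : List B) (f : A → ℤ) (g : B → ℤ) →
    ∑ xs f * ∑ ys g ≡ ∑[ x ← xs ] ∑[ y ← ys ] (f x * g y)
  ∑-* xs ys f g = trans (sym (∑-*ʳ xs f (∑ ys g))) (∑-cong xs λ x → sym (∑-*ˡ ys (f x) g))

  ∑-++ : ∀ (xs ys : List A) (f : A → ℤ) → ∑ (xs ++ ys) f ≡ ∑ xs f + ∑ ys f
  ∑-++ []       ys f = sym (ℤₚ.+-identityˡ _)
  ∑-++ (x ∷ xs) ys f = trans (cong (f x +_) (∑-++ xs ys f)) (sym (ℤₚ.+-assoc (f x) _ _))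

  ∑-map : ∀ (h : A → B) xs (f : B → ℤ) → ∑ (List.map h xs) f ≡ ∑ xs (f ∘ h)
  ∑-map h []       f = refl
  ∑-map h (x ∷ xs) f = cong (f (h x) +_) (∑-map h xs f)

  ∑-cartesianProductWith : ∀ (h : A → B → C) xs ys (f : C → ℤ) →
    ∑ (cartesianProductWith h xs ys) f ≡ ∑[ x ← xs ] ∑[ y ← ys ] f (h x y)
  ∑-cartesianProductWith h []       ys f = refl
  ∑-cartesianProductWith h (x ∷ xs) ys f = trans
    (∑-++ (List.map (h x) ys) _ f)
    (cong₂ _+_ (∑-map (h x) ys f) (∑-cartesianProductWith h xs ys f))

  length-filter≡∑ : ∀ {P : Pred A 0ℓ} (P? : Decidable P) xs →
    ℤ.+ length (filter P? xs) ≡ ∑[ x ← xs ] 𝟙 (P? x)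
  length-filter≡∑ P? []       = refl
  length-filter≡∑ P? (x ∷ xs) with P? x
  ... | yes _ = cong (ℤ.suc) (length-filter≡∑ P? xs)
  ... | no _  = trans (length-filter≡∑ P? xs) (sym (ℤₚ.+-identityˡ _))

  ≤-∑ : ∀ {f : A → ℤ} {xs : List A} → (∀ x → 0ℤ ≤ f x) → ∀ {a} → a ∈ˡ xs → f a ≤ ∑ xs f
  ≤-∑ {f = f} {x ∷ xs} f≥0 (here refl) =
    subst (_≤ ∑ (x ∷ xs) f) (ℤₚ.+-identityʳ (f x)) (ℤₚ.+-monoʳ-≤ (f x) (∑-nonneg xs f≥0))
  ≤-∑ {f = f} {x ∷ xs} f≥0 {a} (there a∈xs) =
    subst (_≤ ∑ (x ∷ xs) f) (ℤₚ.+-identityˡ (f a)) (ℤₚ.+-mono-≤ (f≥0 x) (≤-∑ {f = f} f≥0 a∈xs))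

  -- Each nonnegative difference g a - f a is at most the sum of all of them, which is 0. This turns
  -- one-sided estimates into equalities, once for the multiplicativity of η and once for binary
  -- forms.
  ∑-tight : ∀ {f g : A → ℤ} {xs : List A} → (∀ x → f x ≤ g x) → ∑ xs f ≡ ∑ xs g →
    ∀ {a} → a ∈ˡ xs → f a ≡ g a
  ∑-tight {f = f} {g} {xs} f≤g eq {a} a∈xs = ℤₚ.≤-antisym (f≤g a)
    (ℤₚ.i-j≤0⇒i≤j (subst (g a - f a ≤_)
      (trans (∑-- xs g f) (ℤₚ.i≡j⇒i-j≡0 (sym eq)))
      (≤-∑ {f = λ x → g x - f x} (λ x → ℤₚ.i≤j⇒0≤j-i (f≤g x)) a∈xs)))

  -- Lagrange's identity: the squares (u x f y - u y f x)², summed over all ordered pairs, give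
  -- twice the difference of the two sides.
  cauchy-schwarz : ∀ (xs : List A) (u f : A → ℤ) →
    ∑[ x ← xs ] (u x * f x) * ∑[ x ← xs ] (u x * f x) ≤
    ∑[ x ← xs ] (u x * u x) * ∑[ x ← xs ] (f x * f x)
  cauchy-schwarz xs u f = ℤₚ.*-cancelˡ-≤-pos (S * S) (U * W) (ℤ.+ 2) (ℤₚ.0≤i-j⇒j≤i (begin
    0ℤ
      ≤⟨ ∑-nonneg xs (λ x → ∑-nonneg xs λ y → square-nonneg (u x * f y - u y * f x)) ⟩
    ∑[ x ← xs ] ∑[ y ← xs ] ((u x * f y - u y * f x) * (u x * f y - u y * f x))
      ≡⟨ ∑-cong xs (λ x → ∑-cong xs λ y → expand (u x) (u y) (f x) (f y)) ⟩
    ∑[ x ← xs ] ∑[ y ← xs ] ((u x * u x) * (f y * f y) + (f x * f x) * (u y * u y) - (ℤ.+ 2) * ((u x * f x) * (u y * f y)))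
      ≡⟨ ∑-cong xs (λ x → trans (∑-- xs _ _) (cong₂ _-_ (∑-+ xs _ _) (∑-*ˡ xs (ℤ.+ 2) (λ y → (u x * f x) * (u y * f y))))) ⟩
    ∑[ x ← xs ] (∑[ y ← xs ] ((u x * u x) * (f y * f y)) + ∑[ y ← xs ] ((f x * f x) * (u y * u y))
      - (ℤ.+ 2) * ∑[ y ← xs ] ((u x * f x) * (u y * f y)))
      ≡⟨ trans (∑-- xs _ _) (cong₂ _-_ (∑-+ xs _ _) (∑-*ˡ xs (ℤ.+ 2) (λ x → ∑[ y ← xs ] ((u x * f x) * (u y * f y))))) ⟩
    ∑[ x ← xs ] ∑[ y ← xs ] ((u x * u x) * (f y * f y)) + ∑[ x ← xs ] ∑[ y ← xs ] ((f x * f x) * (u y * u y))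
      - (ℤ.+ 2) * ∑[ x ← xs ] ∑[ y ← xs ] ((u x * f x) * (u y * f y))
      ≡⟨ sym (cong₂ _-_ (cong₂ _+_ (∑-* xs xs uu ff) (∑-* xs xs ff uu)) (cong ((ℤ.+ 2) *_) (∑-* xs xs uf uf))) ⟩
    U * W + W * U - (ℤ.+ 2) * (S * S)
      ≡⟨ cong (_- (ℤ.+ 2) * (S * S)) (double U W) ⟩
    (ℤ.+ 2) * (U * W) - (ℤ.+ 2) * (S * S) ∎))
    where
      open ℤₚ.≤-Reasoning
      uu = λ x → u x * u x
      ff = λ x → f x * f x
      uf = λ x → u x * f x
      U = ∑ xs uu
      W = ∑ xs ff
      S = ∑ xs uf
      expand : ∀ a b c d → (a * d - b * c) * (a * d - b * c) ≡ (a * a) * (d * d) + (c * c) * (b * b) - (ℤ.+ 2) * ((a * c) * (b * d))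
      expand = ℤSolver.solve-∀
      double : ∀ a b → a * b + b * a ≡ (ℤ.+ 2) * (a * b)
      double = ℤSolver.solve-∀

  -- Sums over a complete list without repetitions.

  module Enumeration (_≟_ : DecidableEquality A) (xs : List A)
    (unique : Unique xs) (complete : ∀ a → a ∈ˡ xs) where

    private
      ∑-𝟙-absent : ∀ {a} {ys : List A} → All (_≢_ a) ys → ∑[ y ← ys ] 𝟙 (a ≟ y) ≡ 0ℤ
      ∑-𝟙-absent []           = refl
      ∑-𝟙-absent {a} {y ∷ _} (a≢y ∷ ps) = cong₂ _+_ (𝟙-no (a ≟ y) a≢y) (∑-𝟙-absent ps)

    ∑-𝟙-unique : ∀ a {ys : List A} → Unique ys → ∑[ y ← ys ] 𝟙 (a ≟ y) ≤ 1ℤ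
    ∑-𝟙-unique a []           = ℤ.+≤+ ℕ.z≤n
    ∑-𝟙-unique a {y ∷ ys} (ps ∷ u) with a ≟ y
    ... | yes refl = ℤₚ.≤-reflexive (cong (1ℤ +_) (∑-𝟙-absent ps))
    ... | no _     = subst (_≤ 1ℤ) (sym (ℤₚ.+-identityˡ _)) (∑-𝟙-unique a u)

    ∑-𝟙 : ∀ a → ∑[ x ← xs ] 𝟙 (a ≟ x) ≡ 1ℤ
    ∑-𝟙 a = ℤₚ.≤-antisym (∑-𝟙-unique a unique)
      (subst (_≤ ∑[ x ← xs ] 𝟙 (a ≟ x)) (𝟙-yes (a ≟ a) refl)
        (≤-∑ {f = λ x → 𝟙 (a ≟ x)} (λ x → 𝟙-nonneg (a ≟ x)) (complete a)))

    ∑-pick : ∀ a (g : A → ℤ) → ∑[ x ← xs ] (𝟙 (a ≟ x) * g x) ≡ g a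
    ∑-pick a g = begin
      ∑[ x ← xs ] (𝟙 (a ≟ x) * g x)  ≡⟨ ∑-cong xs (λ x → 𝟙-*-cong (a ≟ x) λ { refl → refl }) ⟩
      ∑[ x ← xs ] (𝟙 (a ≟ x) * g a)  ≡⟨ ∑-*ʳ xs (λ x → 𝟙 (a ≟ x)) (g a) ⟩
      ∑[ x ← xs ] 𝟙 (a ≟ x) * g a    ≡⟨ cong (_* g a) (∑-𝟙 a) ⟩
      1ℤ * g a                       ≡⟨ ℤₚ.*-identityˡ (g a) ⟩
      g a                            ∎
      where open ≡-Reasoning

    -- A double count of the pairs (x , y) with `to x` = y: summing over y first gives one side, and
    -- reading the condition as `from y` = x gives the other.
    ∑-reindex : ∀ (to from : A → A) → (∀ x → from (to x) ≡ x) → (∀ x → to (from x) ≡ x) →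
      ∀ (g : A → ℤ) → ∑[ x ← xs ] g (to x) ≡ ∑ xs g
    ∑-reindex to from from∘to to∘from g = begin
      ∑[ x ← xs ] g (to x)
        ≡⟨ ∑-cong xs (λ x → sym (∑-pick (to x) g)) ⟩
      ∑[ x ← xs ] ∑[ y ← xs ] (𝟙 (to x ≟ y) * g y)
        ≡⟨ ∑-swap xs xs _ ⟩
      ∑[ y ← xs ] ∑[ x ← xs ] (𝟙 (to x ≟ y) * g y)
        ≡⟨ ∑-cong xs (λ y → ∑-cong xs λ x → cong (_* g y) (𝟙-cong (to x ≟ y) (from y ≟ x)
             (λ eq → trans (cong from (sym eq)) (from∘to x))
             (λ eq → trans (cong to (sym eq)) (to∘from y)))) ⟩
      ∑[ y ← xs ] ∑[ x ← xs ] (𝟙 (from y ≟ x) * g y)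
        ≡⟨ ∑-cong xs (λ y → ∑-pick (from y) (λ _ → g y)) ⟩
      ∑ xs g ∎
      where open ≡-Reasoning

    -- After inserting the indicator of y = x and exchanging the sums, every x is counted at most
    -- once because ys has no repetitions; elements of P outside ys only add nonnegative terms.
    ∑-unique≤ : ∀ {P : Pred A 0ℓ} (P? : Decidable P) {g : A → ℤ} → (∀ x → 0ℤ ≤ g x) →
      ∀ {ys} → Unique ys → All P ys → ∑ ys g ≤ ∑[ x ← xs ] (𝟙 (P? x) * g x)
    ∑-unique≤ {P} P? {g} g≥0 {ys} u ps = begin
      ∑ ys g
        ≤⟨ ∑-mono (All.map (λ {y} p → ℤₚ.≤-reflexive (sym (trans (cong (_* g y) (𝟙-yes (P? y) p)) (ℤₚ.*-identityˡ (g y))))) ps) ⟩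
      ∑[ y ← ys ] (𝟙 (P? y) * g y)
        ≡⟨ ∑-cong ys (λ y → sym (∑-pick y Pg)) ⟩
      ∑[ y ← ys ] ∑[ x ← xs ] (𝟙 (y ≟ x) * (𝟙 (P? x) * g x))
        ≡⟨ ∑-swap ys xs _ ⟩
      ∑[ x ← xs ] ∑[ y ← ys ] (𝟙 (y ≟ x) * (𝟙 (P? x) * g x))
        ≡⟨ ∑-cong xs (λ x → trans (∑-*ʳ ys (λ y → 𝟙 (y ≟ x)) (Pg x)) (cong (_* Pg x) (∑-cong ys λ y → 𝟙-cong (y ≟ x) (x ≟ y) sym sym))) ⟩
      ∑[ x ← xs ] (∑[ y ← ys ] 𝟙 (x ≟ y) * (𝟙 (P? x) * g x))
        ≤⟨ ∑-mono′ xs (λ x → ℤₚ.≤-trans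
             (*-monoʳ (*-nonneg (𝟙-nonneg (P? x)) (g≥0 x)) (∑-𝟙-unique x u))
             (ℤₚ.≤-reflexive (ℤₚ.*-identityˡ (Pg x)))) ⟩
      ∑[ x ← xs ] (𝟙 (P? x) * g x) ∎
      where
        open ℤₚ.≤-Reasoning
        Pg = λ x → 𝟙 (P? x) * g x

open Sums

-- Arithmetic and counting in a finite field.

module FieldCounting {q : ℕ} (𝔽 : FiniteField q) where
  open FiniteField 𝔽
  open CommutativeRing commutativeRing public
    using (+-assoc; +-comm; +-identityˡ; +-identityʳ; -‿inverseˡ; -‿inverseʳ
          ; *-assoc; *-comm; *-identityˡ; *-identityʳ; zeroˡ; zeroʳ; distribʳ)
  open RingProperties (CommutativeRing.ring commutativeRing) public
    using (-‿distribˡ-*; -‿distribʳ-*; -‿involutive)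
    renaming (+-cancelˡ to +-cancelˡ′; +-cancelʳ to +-cancelʳ′)
  open SemiringSolver (CommutativeRing.commutativeSemiring commutativeRing) public
    using (solve; _:+_; _:*_; _:=_; con)

  +-cancelˡ : ∀ x {y z} → x + y ≡ x + z → y ≡ z
  +-cancelˡ x = +-cancelˡ′ x _ _

  +-cancelʳ : ∀ x {y z} → y + x ≡ z + x → y ≡ z
  +-cancelʳ x = +-cancelʳ′ x _ _

  x*y≡0⇒y≡0 : ∀ {x y} → x ≢ 0# → x * y ≡ 0# → y ≡ 0#
  x*y≡0⇒y≡0 {x} {y} x≢0 xy≡0 with inverse x x≢0
  ... | x⁻¹ , xx⁻¹≡1 = begin
    y              ≡⟨ sym (*-identityˡ y) ⟩
    1# * y         ≡⟨ cong (_* y) (sym xx⁻¹≡1) ⟩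
    x * x⁻¹ * y    ≡⟨ solve 3 (λ x i y → x :* i :* y := i :* (x :* y)) refl x x⁻¹ y ⟩
    x⁻¹ * (x * y)  ≡⟨ cong (x⁻¹ *_) xy≡0 ⟩
    x⁻¹ * 0#       ≡⟨ zeroʳ x⁻¹ ⟩
    0#             ∎
    where open ≡-Reasoning

  *-≢0 : ∀ {x y} → x ≢ 0# → y ≢ 0# → x * y ≢ 0#
  *-≢0 x≢0 y≢0 = y≢0 ∘ x*y≡0⇒y≡0 x≢0

  square≡0 : ∀ {x} → x * x ≡ 0# → x ≡ 0#
  square≡0 {x} xx≡0 with x ≟ 0#
  ... | yes x≡0 = x≡0
  ... | no x≢0  = x*y≡0⇒y≡0 x≢0 xx≡0

  *-cancelˡ : ∀ {x y z} → x ≢ 0# → x * y ≡ x * z → y ≡ z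
  *-cancelˡ {x} {y} {z} x≢0 eq with inverse x x≢0
  ... | x⁻¹ , xx⁻¹≡1 = trans (sym (back y)) (trans (cong (x⁻¹ *_) eq) (back z))
    where
      back : ∀ t → x⁻¹ * (x * t) ≡ t
      back t = trans (solve 3 (λ x i t → i :* (x :* t) := x :* i :* t) refl x x⁻¹ t)
        (trans (cong (_* t) xx⁻¹≡1) (*-identityˡ t))

  x+y≡0⇒x≡-y : ∀ {x y} → x + y ≡ 0# → x ≡ - y
  x+y≡0⇒x≡-y {x} {y} eq = +-cancelʳ y (trans eq (sym (-‿inverseˡ y)))

  square≡square : ∀ {x y} → x * x ≡ y * y → x ≡ y ⊎ x ≡ - y
  square≡square {x} {y} eq with (x + - y) ≟ 0#
  ... | yes d≡0 = inj₁ (trans (x+y≡0⇒x≡-y d≡0) (-‿involutive y))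
  -- This is (x - y)(x + y) = 0. The element `- y` enters the identity as an independent variable m,
  -- with y² added to both sides, and m + y = 0 is applied afterwards.
  ... | no d≢0  = inj₂ (x+y≡0⇒x≡-y (x*y≡0⇒y≡0 d≢0 (+-cancelʳ (y * y) (begin
    (x + - y) * (x + y) + y * y
      ≡⟨ solve 3 (λ x y m → (x :+ m) :* (x :+ y) :+ y :* y := x :* x :+ (m :+ y) :* (x :+ y)) refl x y (- y) ⟩
    x * x + (- y + y) * (x + y)   ≡⟨ cong₂ _+_ eq (trans (cong (_* (x + y)) (-‿inverseˡ y)) (zeroˡ (x + y))) ⟩
    y * y + 0#                    ≡⟨ +-comm (y * y) 0# ⟩
    0# + y * y                    ∎))))
    where open ≡-Reasoning

  elements-unique : Unique elements
  elements-unique = Uniqueₚ.map⁺ (Injection.injective (↔⇒↣ enumeration)) (Uniqueₚ.allFin⁺ q)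

  vectors-unique : ∀ d → Unique (vectors d)
  vectors-unique zero    = [] ∷ []
  vectors-unique (suc d) = Uniqueₚ.cartesianProductWith⁺ _∷_ Vecₚ.∷-injective elements-unique (vectors-unique d)

  infix 4 _≟ᵛ_
  _≟ᵛ_ : ∀ {d} → DecidableEquality (Vec F d)
  _≟ᵛ_ = Vecₚ.≡-dec _≟_

  open Enumeration _≟_ elements elements-unique ∈-elements public
  module Vectors {d : ℕ} where
    open Enumeration (_≟ᵛ_ {d}) (vectors d) (vectors-unique d) ∈-vectors public

  Q : ℤ
  Q = ℤ.+ q

  length-elements : length elements ≡ q
  length-elements = trans (Listₚ.length-map element (allFin q)) (Listₚ.length-tabulate id)

  ∑-const-elements : ∀ c → ∑[ x ← elements ] c ≡ Q ℤ.* c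
  ∑-const-elements c = trans (∑-const elements c) (cong (λ n → ℤ.+ n ℤ.* c) length-elements)

  ∑-vectors : ∀ {d} (f : Vec F (suc d) → ℤ) →
    ∑ (vectors (suc d)) f ≡ ∑[ x ← elements ] ∑[ ξ ← vectors d ] f (x ∷ ξ)
  ∑-vectors {d} f = ∑-cartesianProductWith _∷_ elements (vectors d) f

  ∑-const-vectors : ∀ d c → ∑[ ξ ← vectors d ] c ≡ Q ℤ.^ d ℤ.* c
  ∑-const-vectors zero    c = trans (ℤₚ.+-identityʳ c) (sym (ℤₚ.*-identityˡ c))
  ∑-const-vectors (suc d) c = begin
    ∑[ ξ ← vectors (suc d) ] c                   ≡⟨ ∑-vectors {d} (λ _ → c) ⟩
    ∑[ x ← elements ] ∑[ ξ ← vectors d ] c       ≡⟨ ∑-cong elements (λ _ → ∑-const-vectors d c) ⟩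
    ∑[ x ← elements ] (Q ℤ.^ d ℤ.* c)            ≡⟨ ∑-const-elements (Q ℤ.^ d ℤ.* c) ⟩
    Q ℤ.* (Q ℤ.^ d ℤ.* c)                        ≡⟨ sym (ℤₚ.*-assoc Q (Q ℤ.^ d) c) ⟩
    Q ℤ.* Q ℤ.^ d ℤ.* c                          ∎
    where open ≡-Reasoning

  private module ∑F = CommutativeMonoidSum (CommutativeRing.+-commutativeMonoid commutativeRing)

  -- Translation by 1 permutes F, so it preserves the sum of all elements, whence q · 1 = 0.
  q×1≡0 : ∑F.sum {q} (λ _ → 1#) ≡ 0#
  q×1≡0 = +-cancelˡ (∑F.sum element) (begin
    ∑F.sum element + ∑F.sum {q} (λ _ → 1#)  ≡⟨ sym (∑F.∑-distrib-+ element (λ _ → 1#)) ⟩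
    ∑F.sum (λ i → element i + 1#)           ≡⟨ ∑F.sum-cong-≗ (λ i → sym (to∘from (element i + 1#))) ⟩
    ∑F.sum (λ i → element (shift 1# i))     ≡⟨ sym (∑F.sum-permute element π) ⟩
    ∑F.sum element                          ≡⟨ sym (+-identityʳ _) ⟩
    ∑F.sum element + 0#                     ∎)
    where
      open ≡-Reasoning
      to∘from = Inverse.strictlyInverseˡ enumeration
      shift : F → Fin q → Fin q
      shift a i = Inverse.from enumeration (element i + a)
      shift-shift : ∀ a b → b + a ≡ 0# → ∀ i → shift a (shift b i) ≡ i
      shift-shift a b b+a≡0 i = trans
        (cong (Inverse.from enumeration) (begin
          element (shift b i) + a   ≡⟨ cong (_+ a) (to∘from (element i + b)) ⟩
          element i + b + a         ≡⟨ +-assoc (element i) b a ⟩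
          element i + (b + a)       ≡⟨ cong (element i +_) b+a≡0 ⟩
          element i + 0#            ≡⟨ +-identityʳ (element i) ⟩
          element i                 ∎))
        (Inverse.strictlyInverseʳ enumeration i)
      π = permutation (shift 1#) (shift (- 1#))
        (shift-shift 1# (- 1#) (-‿inverseˡ 1#)) (shift-shift (- 1#) 1# (-‿inverseʳ 1#))

  -- The quadratic character in odd characteristic.

  module OddOrder (q-odd : 2 ∤ q) where

    -- If 2 were 0, a sum of n ones would be 1 for every odd n, in particular for n = q, where
    -- `q×1≡0` makes it 0.
    1+1≢0 : 1# + 1# ≢ 0#
    1+1≢0 2≡0 with parity q
      where
        parity : ∀ n → 2 ∣ n ⊎ ∑F.sum {n} (λ _ → 1#) ≡ 1#
        parity zero          = inj₁ (divides 0 refl)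
        parity (suc zero)    = inj₂ (+-identityʳ 1#)
        parity (suc (suc n)) with parity n
        ... | inj₁ (divides k eq) = inj₁ (divides (suc k) (cong (suc ∘ suc) eq))
        ... | inj₂ eq             = inj₂ (trans (sym (+-assoc 1# 1# _)) (trans (cong₂ _+_ 2≡0 eq) (+-identityˡ 1#)))
    ... | inj₁ 2∣q   = q-odd 2∣q
    ... | inj₂ sum≡1 = 0≢1 (trans (sym q×1≡0) sum≡1)

    x≢-x : ∀ {x} → x ≢ 0# → x ≢ - x
    x≢-x {x} x≢0 x≡-x = *-≢0 x≢0 1+1≢0 (begin
      x * (1# + 1#)    ≡⟨ solve 1 (λ x → x :* (con 1 :+ con 1) := x :+ x) refl x ⟩
      x + x            ≡⟨ cong (x +_) x≡-x ⟩
      x + - x          ≡⟨ -‿inverseʳ x ⟩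
      0#               ∎)
      where open ≡-Reasoning

    roots : F → ℤ
    roots t = ∑[ x ← elements ] 𝟙 (x * x ≟ t)

    roots-square : ∀ {y} → y ≢ 0# → roots (y * y) ≡ ℤ.+ 2
    roots-square {y} y≢0 = begin
      ∑[ x ← elements ] 𝟙 (x * x ≟ y * y)             ≡⟨ ∑-cong elements step ⟩
      ∑[ x ← elements ] (𝟙 (y ≟ x) ℤ.+ 𝟙 (- y ≟ x))  ≡⟨ ∑-+ elements (λ x → 𝟙 (y ≟ x)) (λ x → 𝟙 (- y ≟ x)) ⟩
      ∑[ x ← elements ] 𝟙 (y ≟ x) ℤ.+ ∑[ x ← elements ] 𝟙 (- y ≟ x)  ≡⟨ cong₂ ℤ._+_ (∑-𝟙 y) (∑-𝟙 (- y)) ⟩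
      ℤ.+ 2                                           ∎
      where
        open ≡-Reasoning
        -y-y : - y * - y ≡ y * y
        -y-y = trans (sym (-‿distribˡ-* y (- y))) (trans (cong -_ (sym (-‿distribʳ-* y y))) (-‿involutive (y * y)))
        step : ∀ x → 𝟙 (x * x ≟ y * y) ≡ 𝟙 (y ≟ x) ℤ.+ 𝟙 (- y ≟ x)
        step x with y ≟ x | (- y) ≟ x
        ... | yes refl | yes -y≡y = contradiction (sym -y≡y) (x≢-x y≢0)
        ... | yes refl | no _     = 𝟙-yes (y * y ≟ y * y) refl
        ... | no _     | yes refl = 𝟙-yes (- y * - y ≟ y * y) -y-y
        ... | no y≢x   | no -y≢x  = 𝟙-no (x * x ≟ y * y) λ eq → case (square≡square eq)
          where
            case : ¬ (x ≡ y ⊎ x ≡ - y)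
            case (inj₁ x≡y)  = y≢x (sym x≡y)
            case (inj₂ x≡-y) = -y≢x (sym x≡-y)

    -- Indexed by the value of η, so that matching on `quadratic t` fixes `η t` in the goal and at
    -- the same time supplies a square root or the absence of one.
    data Quadratic (t : F) : ℤ → Set where
      null      : t ≡ 0# → Quadratic t 0ℤ
      square    : ∀ y → y ≢ 0# → y * y ≡ t → Quadratic t 1ℤ
      nonsquare : t ≢ 0# → (∀ y → y * y ≢ t) → Quadratic t -1ℤ

    quadratic : ∀ t → Quadratic t (η t)
    quadratic t with t ≟ 0#
    ... | yes t≡0 = null t≡0
    ... | no t≢0 with any? (λ i → element i * element i ≟ t)
    ...   | yes (i , eq) = square (element i) (λ y≡0 → t≢0 (trans (sym eq) (trans (cong (_* element i) y≡0) (zeroˡ _)))) eq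
    ...   | no ¬sq = nonsquare t≢0 λ y eq → ¬sq
      (Inverse.from enumeration y , trans (cong (λ z → z * z) (Inverse.strictlyInverseˡ enumeration y)) eq)

    roots≡1+η : ∀ t → roots t ≡ 1ℤ ℤ.+ η t
    roots≡1+η t with η t | quadratic t
    ... | _ | null refl = trans
      (∑-cong elements λ x → 𝟙-cong (x * x ≟ 0#) (0# ≟ x) (sym ∘ square≡0) λ { refl → zeroˡ 0# })
      (∑-𝟙 0#)
    ... | _ | square y y≢0 refl = roots-square y≢0
    ... | _ | nonsquare _ ¬sq = trans (∑-cong elements λ x → 𝟙-no (x * x ≟ t) (¬sq x)) (∑-zero elements)

    η-zero : η 0# ≡ 0ℤ
    η-zero with η 0# | quadratic 0#
    ... | _ | null _           = refl
    ... | _ | square y y≢0 eq  = contradiction (square≡0 eq) y≢0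
    ... | _ | nonsquare 0≢0 _  = contradiction refl 0≢0

    ∑-roots : ∑[ t ← elements ] roots t ≡ Q
    ∑-roots = begin
      ∑[ t ← elements ] ∑[ x ← elements ] 𝟙 (x * x ≟ t)  ≡⟨ ∑-swap elements elements _ ⟩
      ∑[ x ← elements ] ∑[ t ← elements ] 𝟙 (x * x ≟ t)  ≡⟨ ∑-cong elements (λ x → ∑-𝟙 (x * x)) ⟩
      ∑[ x ← elements ] 1ℤ                               ≡⟨ ∑-const-elements 1ℤ ⟩
      Q ℤ.* 1ℤ                                           ≡⟨ ℤₚ.*-identityʳ Q ⟩
      Q                                                  ∎
      where open ≡-Reasoning

    -- Each x is a root of exactly one t, so the sum of 1 + η t over all t is q, and the ones alone
    -- already account for q.
    ∑-η : ∑ elements η ≡ 0ℤ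
    ∑-η = ℤ-+-cancelˡ Q (begin
      Q ℤ.+ ∑ elements η                              ≡⟨ cong (ℤ._+ ∑ elements η) (sym (trans (∑-const-elements 1ℤ) (ℤₚ.*-identityʳ Q))) ⟩
      ∑[ t ← elements ] 1ℤ ℤ.+ ∑ elements η           ≡⟨ sym (∑-+ elements (λ _ → 1ℤ) η) ⟩
      ∑[ t ← elements ] (1ℤ ℤ.+ η t)                  ≡⟨ ∑-cong elements (λ t → sym (roots≡1+η t)) ⟩
      ∑[ t ← elements ] roots t                       ≡⟨ ∑-roots ⟩
      Q                                               ≡⟨ sym (ℤₚ.+-identityʳ Q) ⟩
      Q ℤ.+ 0ℤ                                        ∎)
      where open ≡-Reasoning

    ∑-reindex-* : ∀ {a} → a ≢ 0# → (g : F → ℤ) → ∑[ x ← elements ] g (a * x) ≡ ∑ elements g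
    ∑-reindex-* {a} a≢0 g with inverse a a≢0
    ... | a⁻¹ , aa⁻¹≡1 = ∑-reindex (a *_) (a⁻¹ *_)
      (λ x → *-cancelˡ a≢0 (cancel (a * x))) cancel g
      where
        cancel : ∀ x → a * (a⁻¹ * x) ≡ x
        cancel x = trans (sym (*-assoc a a⁻¹ x)) (trans (cong (_* x) aa⁻¹≡1) (*-identityˡ x))

    -- Multiplication by y matches the square roots of b with those of y² b, and the number of roots
    -- determines η.
    η-square-* : ∀ {y} → y ≢ 0# → ∀ b → η (y * y * b) ≡ η b
    η-square-* {y} y≢0 b = ℤ-+-cancelˡ 1ℤ (begin
      1ℤ ℤ.+ η (y * y * b)                                       ≡⟨ sym (roots≡1+η (y * y * b)) ⟩
      ∑[ x ← elements ] 𝟙 (x * x ≟ y * y * b)                   ≡⟨ sym (∑-reindex-* y≢0 (λ x → 𝟙 (x * x ≟ y * y * b))) ⟩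
      ∑[ x ← elements ] 𝟙 (y * x * (y * x) ≟ y * y * b)         ≡⟨ ∑-cong elements (λ x → 𝟙-cong (y * x * (y * x) ≟ y * y * b) (x * x ≟ b)
                                                                     (λ eq → *-cancelˡ (*-≢0 y≢0 y≢0) (trans (sym (interchange x)) eq))
                                                                     (λ eq → trans (interchange x) (cong (y * y *_) eq))) ⟩
      roots b                                                    ≡⟨ roots≡1+η b ⟩
      1ℤ ℤ.+ η b                                                 ∎)
      where
        open ≡-Reasoning
        interchange : ∀ x → y * x * (y * x) ≡ y * y * (x * x)
        interchange x = solve 2 (λ y x → y :* x :* (y :* x) := y :* y :* (x :* x)) refl y x

    -- t and a t are never both nonzero squares, so η t + η (a t) ≤ 0; these sums add up to 0, so each of them vanishes.
    η-nonsquare-* : ∀ {a} → a ≢ 0# → (∀ y → y * y ≢ a) → ∀ b → η (a * b) ≡ ℤ.- η b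
    η-nonsquare-* {a} a≢0 ¬sq b = ℤ-+-cancelˡ (η b)
      (trans (∑-tight {g = λ _ → 0ℤ} bound total (∈-elements b)) (sym (ℤₚ.+-inverseʳ (η b))))
      where
        total : ∑[ t ← elements ] (η t ℤ.+ η (a * t)) ≡ ∑[ t ← elements ] 0ℤ
        total = trans (∑-+ elements η (λ t → η (a * t)))
          (trans (cong₂ ℤ._+_ ∑-η (trans (∑-reindex-* a≢0 η) ∑-η)) (sym (∑-zero elements)))
        bound : ∀ t → η t ℤ.+ η (a * t) ℤ.≤ 0ℤ
        bound t with η t | quadratic t | η (a * t) | quadratic (a * t)
        ... | _ | null refl     | _ | null _          = ℤₚ.≤-refl
        ... | _ | null refl     | _ | square y y≢0 eq = contradiction (square≡0 (trans eq (zeroʳ a))) y≢0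
        ... | _ | null refl     | _ | nonsquare _ _   = ℤ.-≤+
        ... | _ | square _ y≢0 refl | _ | null at≡0   = contradiction at≡0 (*-≢0 a≢0 (*-≢0 y≢0 y≢0))
        ... | _ | square y y≢0 refl | _ | square z _ eq with inverse y y≢0
        -- With t = y² and a t = z², the quotient z i of the two roots is a square root of a.
        ...   | i , yi≡1 = contradiction (begin
          z * i * (z * i)            ≡⟨ solve 2 (λ z i → z :* i :* (z :* i) := z :* z :* (i :* i)) refl z i ⟩
          z * z * (i * i)            ≡⟨ cong (_* (i * i)) eq ⟩
          a * (y * y) * (i * i)      ≡⟨ solve 3 (λ a y i → a :* (y :* y) :* (i :* i) := a :* ((y :* i) :* (y :* i))) refl a y i ⟩
          a * ((y * i) * (y * i))    ≡⟨ cong (λ u → a * (u * u)) yi≡1 ⟩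
          a * (1# * 1#)              ≡⟨ solve 1 (λ a → a :* (con 1 :* con 1) := a) refl a ⟩
          a                          ∎) (¬sq (z * i))
          where open ≡-Reasoning
        bound t | _ | square _ _ _  | _ | nonsquare _ _ = ℤₚ.≤-refl
        bound t | _ | nonsquare _ _ | _ | null _        = ℤ.-≤+
        bound t | _ | nonsquare _ _ | _ | square _ _ _  = ℤₚ.≤-refl
        bound t | _ | nonsquare _ _ | _ | nonsquare _ _ = ℤ.-≤+

    η-* : ∀ a b → η (a * b) ≡ η a ℤ.* η b
    η-* a b with η a | quadratic a
    ... | _ | null refl           = trans (cong η (zeroˡ b)) η-zero
    ... | _ | square y y≢0 refl   = trans (η-square-* y≢0 b) (sym (ℤₚ.*-identityˡ (η b)))
    ... | _ | nonsquare a≢0 ¬sq   = trans (η-nonsquare-* a≢0 ¬sq b) (sym (ℤₚ.-1*i≡-i (η b)))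

-- Diagonal quadratic forms and the duality of their isotropic cones.

module Forms {q : ℕ} (𝔽 : FiniteField q) (q-odd : 2 ∤ q) where
  open FiniteField 𝔽
  open FieldCounting 𝔽
  open OddOrder q-odd

  2≤Q : ℤ.+ 2 ℤ.≤ Q
  2≤Q = begin
    ℤ.+ 2
      ≡⟨ sym (cong₂ ℤ._+_ (∑-𝟙 0#) (∑-𝟙 1#)) ⟩
    ∑[ x ← elements ] 𝟙 (0# ≟ x) ℤ.+ ∑[ x ← elements ] 𝟙 (1# ≟ x)
      ≡⟨ sym (∑-+ elements (λ x → 𝟙 (0# ≟ x)) (λ x → 𝟙 (1# ≟ x))) ⟩
    ∑[ x ← elements ] (𝟙 (0# ≟ x) ℤ.+ 𝟙 (1# ≟ x))
      ≤⟨ ∑-mono′ elements disjoint ⟩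
    ∑[ x ← elements ] 1ℤ
      ≡⟨ trans (∑-const-elements 1ℤ) (ℤₚ.*-identityʳ Q) ⟩
    Q ∎
    where
      open ℤₚ.≤-Reasoning
      disjoint : ∀ x → 𝟙 (0# ≟ x) ℤ.+ 𝟙 (1# ≟ x) ℤ.≤ 1ℤ
      disjoint x with 0# ≟ x | 1# ≟ x
      ... | yes 0≡x | yes 1≡x = contradiction (trans 0≡x (sym 1≡x)) 0≢1
      ... | yes _   | no _    = ℤₚ.≤-refl
      ... | no _    | yes _   = ℤₚ.≤-refl
      ... | no _    | no _    = ℤ.+≤+ ℕ.z≤n

  Q-1>0 : 0ℤ ℤ.< Q ℤ.- 1ℤ
  Q-1>0 = ℤₚ.<-≤-trans (ℤ.+<+ ℕ.z<s) (ℤₚ.+-monoˡ-≤ -1ℤ 2≤Q)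

  instance
    Q-1-positive : ℤ.Positive (Q ℤ.- 1ℤ)
    Q-1-positive = ℤ.positive Q-1>0

    Q-1-nonZero : ℤ.NonZero (Q ℤ.- 1ℤ)
    Q-1-nonZero = ℤ.>-nonZero Q-1>0

  ∑-𝟙-linear : ∀ {a} → a ≢ 0# → ∀ u b → ∑[ x ← elements ] 𝟙 (a * x + u ≟ b) ≡ 1ℤ
  ∑-𝟙-linear {a} a≢0 u b with inverse a a≢0
  ... | i , ai≡1 = trans
    (∑-cong elements λ x → 𝟙-cong (a * x + u ≟ b) (x₀ ≟ x)
      (λ eq → *-cancelˡ a≢0 (+-cancelʳ u (trans solution (sym eq))))
      (λ { refl → solution }))
    (∑-𝟙 x₀)
    where
      x₀ = i * (b + - u)
      solution : a * x₀ + u ≡ b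
      solution = begin
        a * (i * (b + - u)) + u    ≡⟨ solve 5 (λ a i b m u → a :* (i :* (b :+ m)) :+ u := a :* i :* (b :+ m) :+ u) refl a i b (- u) u ⟩
        a * i * (b + - u) + u      ≡⟨ cong (λ t → t * (b + - u) + u) ai≡1 ⟩
        1# * (b + - u) + u         ≡⟨ solve 3 (λ b m u → con 1 :* (b :+ m) :+ u := b :+ (m :+ u)) refl b (- u) u ⟩
        b + (- u + u)              ≡⟨ cong (b +_) (-‿inverseˡ u) ⟩
        b + 0#                     ≡⟨ +-identityʳ b ⟩
        b                          ∎
        where open ≡-Reasoning

  -- At the first nonzero entry of m the equation determines that coordinate of ξ from the later
  -- ones; all other coordinates are free.
  ∑-𝟙-hyperplane : ∀ {n} {m : Vec F (suc n)} → m ≢ 0ᵛ → ∀ b →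
    ∑[ ξ ← vectors (suc n) ] 𝟙 (m · ξ ≟ b) ≡ Q ℤ.^ n
  ∑-𝟙-hyperplane {n} {a ∷ m} m≢0 b with a ≟ 0#
  ... | no a≢0 = begin
    ∑[ ξ ← vectors (suc n) ] 𝟙 ((a ∷ m) · ξ ≟ b)
      ≡⟨ ∑-vectors (λ ξ → 𝟙 ((a ∷ m) · ξ ≟ b)) ⟩
    ∑[ x ← elements ] ∑[ ξ ← vectors n ] 𝟙 (a * x + m · ξ ≟ b)
      ≡⟨ ∑-swap elements (vectors n) _ ⟩
    ∑[ ξ ← vectors n ] ∑[ x ← elements ] 𝟙 (a * x + m · ξ ≟ b)
      ≡⟨ ∑-cong (vectors n) (λ ξ → ∑-𝟙-linear a≢0 (m · ξ) b) ⟩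
    ∑[ ξ ← vectors n ] 1ℤ
      ≡⟨ trans (∑-const-vectors n 1ℤ) (ℤₚ.*-identityʳ _) ⟩
    Q ℤ.^ n ∎
    where open ≡-Reasoning
  ∑-𝟙-hyperplane {zero}  {_ ∷ []} m≢0 b | yes refl = contradiction refl m≢0
  ∑-𝟙-hyperplane {suc n} {_ ∷ m}  m≢0 b | yes refl = begin
    ∑[ ξ ← vectors (suc (suc n)) ] 𝟙 ((0# ∷ m) · ξ ≟ b)
      ≡⟨ ∑-vectors (λ ξ → 𝟙 ((0# ∷ m) · ξ ≟ b)) ⟩
    ∑[ x ← elements ] ∑[ ξ ← vectors (suc n) ] 𝟙 (0# * x + m · ξ ≟ b)
      ≡⟨ ∑-cong elements (λ x → ∑-cong (vectors (suc n)) λ ξ →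
           cong (λ t → 𝟙 (t ≟ b)) (trans (cong (_+ m · ξ) (zeroˡ x)) (+-identityˡ (m · ξ)))) ⟩
    ∑[ x ← elements ] ∑[ ξ ← vectors (suc n) ] 𝟙 (m · ξ ≟ b)
      ≡⟨ ∑-cong elements (λ _ → ∑-𝟙-hyperplane (m≢0 ∘ cong (0# ∷_)) b) ⟩
    ∑[ x ← elements ] (Q ℤ.^ n)
      ≡⟨ ∑-const-elements (Q ℤ.^ n) ⟩
    Q ℤ.* Q ℤ.^ n ∎
    where open ≡-Reasoning

  private variable
    d : ℕ

  form : Vec F d → Vec F d → F
  form []       []       = 0#
  form (c ∷ cs) (x ∷ xs) = c * (x * x) + form cs xs

  -- The form with coefficients es is the dual of the form with coefficients cs.
  Inverses : Vec F d → Vec F d → Set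
  Inverses = Pointwise (λ c e → c * e ≡ 1#)

  infixr 7 _⊛_
  _⊛_ : Vec F d → Vec F d → Vec F d
  _⊛_ = zipWith _*_

  form-0ᵛ : (cs : Vec F d) → form cs 0ᵛ ≡ 0#
  form-0ᵛ []       = refl
  form-0ᵛ (c ∷ cs) = trans (cong (c * (0# * 0#) +_) (form-0ᵛ cs)) (solve 1 (λ c → c :* (con 0 :* con 0) :+ con 0 := con 0) refl c)

  form-∙ᵛ : ∀ τ (cs ξ : Vec F d) → form cs (τ ∙ᵛ ξ) ≡ τ * τ * form cs ξ
  form-∙ᵛ τ []       []      = sym (zeroʳ (τ * τ))
  form-∙ᵛ τ (c ∷ cs) (x ∷ ξ) = trans (cong (c * (τ * x * (τ * x)) +_) (form-∙ᵛ τ cs ξ))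
    (solve 4 (λ τ c x f → c :* (τ :* x :* (τ :* x)) :+ τ :* τ :* f := τ :* τ :* (c :* (x :* x) :+ f)) refl τ c x (form cs ξ))

  -- `cs ⊛ ξ` is half the gradient of the form at ξ, and e (c x)² = c x² in each coordinate. It
  -- exhibits a vector at which the dual form takes any given value of the form.
  form-dual : {cs es : Vec F d} → Inverses cs es → ∀ ξ → form es (cs ⊛ ξ) ≡ form cs ξ
  form-dual []         []      = refl
  form-dual {cs = c ∷ cs} {e ∷ es} (ce≡1 ∷ inv) (x ∷ ξ) = cong₂ _+_
    (trans (solve 3 (λ c e x → e :* (c :* x :* (c :* x)) := c :* e :* (c :* (x :* x))) refl c e x)
      (trans (cong (_* (c * (x * x))) ce≡1) (*-identityˡ _)))
    (form-dual inv ξ)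

  -- The entries of `es` in the shift cancel the coefficients in the cross term, leaving 2 τ (m ·
  -- ξ). A linear perturbation of the form is thus a translation together with a change of the
  -- target value by τ² `form es m`.
  complete-square : {cs es : Vec F d} → Inverses cs es → ∀ τ m ξ →
    form cs (ξ +ᵛ τ ∙ᵛ es ⊛ m) ≡ (form cs ξ + (1# + 1#) * (m · ξ) * τ) + τ * τ * form es m
  complete-square [] τ [] [] = solve 1 (λ τ → con 0 := (con 0 :+ (con 1 :+ con 1) :* con 0 :* τ) :+ τ :* τ :* con 0) refl τ
  complete-square {cs = c ∷ cs} {e ∷ es} (ce≡1 ∷ inv) τ (y ∷ m) (x ∷ ξ) = begin
    c * ((x + τ * (e * y)) * (x + τ * (e * y))) + form cs (ξ +ᵛ τ ∙ᵛ es ⊛ m)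
      ≡⟨ cong₂ _+_
           (solve 5 (λ c e x y τ → c :* ((x :+ τ :* (e :* y)) :* (x :+ τ :* (e :* y))) :=
             c :* (x :* x) :+ c :* e :* ((con 1 :+ con 1) :* (y :* x) :* τ :+ τ :* τ :* (e :* (y :* y)))) refl c e x y τ)
           (complete-square inv τ m ξ) ⟩
    c * (x * x) + c * e * ((1# + 1#) * (y * x) * τ + τ * τ * (e * (y * y)))
      + ((form cs ξ + (1# + 1#) * (m · ξ) * τ) + τ * τ * form es m)
      ≡⟨ cong (λ t → c * (x * x) + t * ((1# + 1#) * (y * x) * τ + τ * τ * (e * (y * y)))
           + ((form cs ξ + (1# + 1#) * (m · ξ) * τ) + τ * τ * form es m)) ce≡1 ⟩
    c * (x * x) + 1# * ((1# + 1#) * (y * x) * τ + τ * τ * (e * (y * y)))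
      + ((form cs ξ + (1# + 1#) * (m · ξ) * τ) + τ * τ * form es m)
      ≡⟨ solve 7 (λ a b u f g h τ → a :+ con 1 :* ((con 1 :+ con 1) :* b :* τ :+ τ :* τ :* u)
             :+ ((f :+ (con 1 :+ con 1) :* g :* τ) :+ τ :* τ :* h)
           := ((a :+ f) :+ (con 1 :+ con 1) :* (b :+ g) :* τ) :+ τ :* τ :* (u :+ h)) refl
           (c * (x * x)) (y * x) (e * (y * y)) (form cs ξ) (m · ξ) (form es m) τ ⟩
    ((c * (x * x) + form cs ξ) + (1# + 1#) * (y * x + m · ξ) * τ) + τ * τ * (e * (y * y) + form es m) ∎
    where open ≡-Reasoning

  +ᵛ-cancel : (v w ξ : Vec F d) → w +ᵛ v ≡ 0ᵛ → ξ +ᵛ w +ᵛ v ≡ ξ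
  +ᵛ-cancel []      []      []      _  = refl
  +ᵛ-cancel (a ∷ v) (b ∷ w) (x ∷ ξ) eq = cong₂ _∷_
    (trans (+-assoc x b a) (trans (cong (x +_) (Vecₚ.∷-injectiveˡ eq)) (+-identityʳ x)))
    (+ᵛ-cancel v w ξ (Vecₚ.∷-injectiveʳ eq))

  -ᵛ_ : Vec F d → Vec F d
  -ᵛ_ = Vec.map (λ a → - a)

  +ᵛ-inverseʳ : (v : Vec F d) → v +ᵛ -ᵛ v ≡ 0ᵛ
  +ᵛ-inverseʳ []      = refl
  +ᵛ-inverseʳ (a ∷ v) = cong₂ _∷_ (-‿inverseʳ a) (+ᵛ-inverseʳ v)

  +ᵛ-inverseˡ : (v : Vec F d) → -ᵛ v +ᵛ v ≡ 0ᵛ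
  +ᵛ-inverseˡ []      = refl
  +ᵛ-inverseˡ (a ∷ v) = cong₂ _∷_ (-‿inverseˡ a) (+ᵛ-inverseˡ v)

  ∙ᵛ-cancel : ∀ {i τ} → i * τ ≡ 1# → (ξ : Vec F d) → i ∙ᵛ τ ∙ᵛ ξ ≡ ξ
  ∙ᵛ-cancel         _    []      = refl
  ∙ᵛ-cancel {i = i} {τ} iτ≡1 (x ∷ ξ) = cong₂ _∷_
    (trans (sym (*-assoc i τ x)) (trans (cong (_* x) iτ≡1) (*-identityˡ x))) (∙ᵛ-cancel iτ≡1 ξ)

  ∑-reindex-+ᵛ : (v : Vec F d) (g : Vec F d → ℤ) → ∑[ ξ ← vectors d ] g (ξ +ᵛ v) ≡ ∑ (vectors d) g
  ∑-reindex-+ᵛ v = Vectors.∑-reindex (_+ᵛ v) (_+ᵛ -ᵛ v)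
    (λ ξ → +ᵛ-cancel (-ᵛ v) v ξ (+ᵛ-inverseʳ v)) (λ ξ → +ᵛ-cancel v (-ᵛ v) ξ (+ᵛ-inverseˡ v))

  ∑-reindex-∙ᵛ : ∀ {τ} → τ ≢ 0# → (g : Vec F d → ℤ) → ∑[ ξ ← vectors d ] g (τ ∙ᵛ ξ) ≡ ∑ (vectors d) g
  ∑-reindex-∙ᵛ {τ = τ} τ≢0 with inverse τ τ≢0
  ... | i , τi≡1 = Vectors.∑-reindex (τ ∙ᵛ_) (i ∙ᵛ_) (∙ᵛ-cancel (trans (*-comm i τ) τi≡1)) (∙ᵛ-cancel τi≡1)

  represent : Vec F d → F → ℤ
  represent {d} cs w = ∑[ ξ ← vectors d ] 𝟙 (form cs ξ ≟ w)

  isotropic⊥ : Vec F d → Vec F d → ℤ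
  isotropic⊥ {d} cs m = ∑[ ξ ← vectors d ] (𝟙 (form cs ξ ≟ 0#) ℤ.* 𝟙 (m · ξ ≟ 0#))

  represent-scale : ∀ {τ} → τ ≢ 0# → (cs : Vec F d) (w : F) → represent cs (τ * τ * w) ≡ represent cs w
  represent-scale {d} {τ} τ≢0 cs w = trans
    (sym (∑-reindex-∙ᵛ τ≢0 (λ ξ → 𝟙 (form cs ξ ≟ τ * τ * w))))
    (∑-cong (vectors d) λ ξ → 𝟙-cong (form cs (τ ∙ᵛ ξ) ≟ τ * τ * w) (form cs ξ ≟ w)
      (λ eq → *-cancelˡ (*-≢0 τ≢0 τ≢0) (trans (sym (form-∙ᵛ τ cs ξ)) eq))
      (λ eq → trans (form-∙ᵛ τ cs ξ) (cong (τ * τ *_) eq)))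

  ∑-represent-scale : ∀ (cs : Vec F d) w →
    ∑[ τ ← elements ] represent cs (τ * τ * w) ≡ represent cs 0# ℤ.+ (Q ℤ.- 1ℤ) ℤ.* represent cs w
  ∑-represent-scale cs w = begin
    ∑[ τ ← elements ] represent cs (τ * τ * w)
      ≡⟨ ∑-cong elements step ⟩
    -- Every τ ≠ 0 contributes n by scaling; the correction n₀ - n is made at τ = 0 alone.
    ∑[ τ ← elements ] (n ℤ.+ 𝟙 (0# ≟ τ) ℤ.* (n₀ ℤ.- n))
      ≡⟨ ∑-+ elements (λ _ → n) (λ τ → 𝟙 (0# ≟ τ) ℤ.* (n₀ ℤ.- n)) ⟩
    ∑[ τ ← elements ] n ℤ.+ ∑[ τ ← elements ] (𝟙 (0# ≟ τ) ℤ.* (n₀ ℤ.- n))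
      ≡⟨ cong₂ ℤ._+_ (∑-const-elements n) (∑-pick 0# (λ _ → n₀ ℤ.- n)) ⟩
    Q ℤ.* n ℤ.+ (n₀ ℤ.- n)
      ≡⟨ rearrange Q n n₀ ⟩
    n₀ ℤ.+ (Q ℤ.- 1ℤ) ℤ.* n ∎
    where
      open ≡-Reasoning
      n  = represent cs w
      n₀ = represent cs 0#
      rearrange : ∀ a b c → a ℤ.* b ℤ.+ (c ℤ.- b) ≡ c ℤ.+ (a ℤ.- 1ℤ) ℤ.* b
      rearrange = ℤSolver.solve-∀
      subtract : ∀ a b → a ≡ b ℤ.+ 1ℤ ℤ.* (a ℤ.- b)
      subtract = ℤSolver.solve-∀
      step : ∀ τ → represent cs (τ * τ * w) ≡ n ℤ.+ 𝟙 (0# ≟ τ) ℤ.* (n₀ ℤ.- n)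
      step τ with 0# ≟ τ
      ... | yes refl = trans (cong (represent cs) (trans (cong (_* w) (zeroˡ 0#)) (zeroˡ w))) (subtract n₀ n)
      ... | no 0≢τ   = trans (represent-scale (0≢τ ∘ sym) cs w) (sym (ℤₚ.+-identityʳ n))

  -- For b ≠ 0 the equation in τ has one solution; for b = 0 it has q solutions or none, according
  -- to whether a is 0. The right-hand side merges these cases into indicators that can be summed
  -- over ξ.
  ∑-𝟙-affine : ∀ {k} → k ≢ 0# → ∀ a b →
    ∑[ τ ← elements ] 𝟙 (a + k * b * τ ≟ 0#) ≡ 1ℤ ℤ.- 𝟙 (b ≟ 0#) ℤ.+ Q ℤ.* (𝟙 (a ≟ 0#) ℤ.* 𝟙 (b ≟ 0#))
  ∑-𝟙-affine {k} k≢0 a b with b ≟ 0#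
  ... | no b≢0 = begin
    ∑[ τ ← elements ] 𝟙 (a + k * b * τ ≟ 0#)   ≡⟨ ∑-cong elements (λ τ → cong (λ t → 𝟙 (t ≟ 0#)) (+-comm a (k * b * τ))) ⟩
    ∑[ τ ← elements ] 𝟙 (k * b * τ + a ≟ 0#)   ≡⟨ ∑-𝟙-linear (*-≢0 k≢0 b≢0) a 0# ⟩
    1ℤ                                         ≡⟨ simplify Q (𝟙 (a ≟ 0#)) ⟩
    1ℤ ℤ.- 0ℤ ℤ.+ Q ℤ.* (𝟙 (a ≟ 0#) ℤ.* 0ℤ)    ∎
    where
      open ≡-Reasoning
      simplify : ∀ x y → 1ℤ ≡ 1ℤ ℤ.- 0ℤ ℤ.+ x ℤ.* (y ℤ.* 0ℤ)
      simplify = ℤSolver.solve-∀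
  ... | yes refl = begin
    ∑[ τ ← elements ] 𝟙 (a + k * 0# * τ ≟ 0#)  ≡⟨ ∑-cong elements (λ τ → cong (λ t → 𝟙 (t ≟ 0#))
                                                    (solve 3 (λ a k τ → a :+ k :* con 0 :* τ := a) refl a k τ)) ⟩
    ∑[ τ ← elements ] 𝟙 (a ≟ 0#)               ≡⟨ ∑-const-elements (𝟙 (a ≟ 0#)) ⟩
    Q ℤ.* 𝟙 (a ≟ 0#)                           ≡⟨ simplify Q (𝟙 (a ≟ 0#)) ⟩
    1ℤ ℤ.- 1ℤ ℤ.+ Q ℤ.* (𝟙 (a ≟ 0#) ℤ.* 1ℤ)    ∎
    where
      open ≡-Reasoning
      simplify : ∀ x y → x ℤ.* y ≡ 1ℤ ℤ.- 1ℤ ℤ.+ x ℤ.* (y ℤ.* 1ℤ)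
      simplify = ℤSolver.solve-∀

  -- Fourier self-duality of the isotropic cone.  Both sides come from counting the pairs (τ , ξ) with
  -- form cs ξ + 2 τ (m · ξ) = 0: completing the square for fixed τ, and solving for τ for fixed ξ.
  duality : ∀ {n} {cs es : Vec F (suc n)} → Inverses cs es → ∀ {m} → m ≢ 0ᵛ →
    Q ℤ.* isotropic⊥ cs m ℤ.- represent cs 0# ≡ (Q ℤ.- 1ℤ) ℤ.* (represent cs (form es m) ℤ.- Q ℤ.^ n)
  duality {n} {cs} {es} inv {m} m≢0 = rearrange Q (Q ℤ.^ n) (isotropic⊥ cs m) (represent cs 0#) (represent cs w) (begin
    represent cs 0# ℤ.+ (Q ℤ.- 1ℤ) ℤ.* represent cs w
      ≡⟨ sym (∑-represent-scale cs w) ⟩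
    ∑[ τ ← elements ] represent cs (τ * τ * w)
      ≡⟨ ∑-cong elements (λ τ → trans
           (sym (∑-reindex-+ᵛ (τ ∙ᵛ es ⊛ m) (λ ξ → 𝟙 (form cs ξ ≟ τ * τ * w))))
           (∑-cong V λ ξ → 𝟙-cong (form cs (ξ +ᵛ τ ∙ᵛ es ⊛ m) ≟ τ * τ * w) (form cs ξ + (1# + 1#) * (m · ξ) * τ ≟ 0#)
             (λ eq → +-cancelʳ (τ * τ * w) (trans (sym (complete-square inv τ m ξ)) (trans eq (sym (+-identityˡ _)))))
             (λ eq → trans (complete-square inv τ m ξ) (trans (cong (_+ τ * τ * w) eq) (+-identityˡ _))))) ⟩
    ∑[ τ ← elements ] ∑[ ξ ← V ] 𝟙 (form cs ξ + (1# + 1#) * (m · ξ) * τ ≟ 0#)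
      ≡⟨ ∑-swap elements V _ ⟩
    ∑[ ξ ← V ] ∑[ τ ← elements ] 𝟙 (form cs ξ + (1# + 1#) * (m · ξ) * τ ≟ 0#)
      ≡⟨ ∑-cong V (λ ξ → ∑-𝟙-affine 1+1≢0 (form cs ξ) (m · ξ)) ⟩
    ∑[ ξ ← V ] (1ℤ ℤ.- 𝟙 (m · ξ ≟ 0#) ℤ.+ Q ℤ.* (𝟙 (form cs ξ ≟ 0#) ℤ.* 𝟙 (m · ξ ≟ 0#)))
      ≡⟨ trans (∑-+ V _ (λ ξ → Q ℤ.* (𝟙 (form cs ξ ≟ 0#) ℤ.* 𝟙 (m · ξ ≟ 0#))))
           (cong₂ ℤ._+_ (∑-- V (λ _ → 1ℤ) (λ ξ → 𝟙 (m · ξ ≟ 0#)))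
             (∑-*ˡ V Q (λ ξ → 𝟙 (form cs ξ ≟ 0#) ℤ.* 𝟙 (m · ξ ≟ 0#)))) ⟩
    ∑[ ξ ← V ] 1ℤ ℤ.- ∑[ ξ ← V ] 𝟙 (m · ξ ≟ 0#) ℤ.+ Q ℤ.* isotropic⊥ cs m
      ≡⟨ cong₂ (λ a b → a ℤ.- b ℤ.+ Q ℤ.* isotropic⊥ cs m)
           (trans (∑-const-vectors (suc n) 1ℤ) (ℤₚ.*-identityʳ (Q ℤ.^ suc n))) (∑-𝟙-hyperplane m≢0 0#) ⟩
    Q ℤ.* Q ℤ.^ n ℤ.- Q ℤ.^ n ℤ.+ Q ℤ.* isotropic⊥ cs m ∎)
    where
      open ≡-Reasoning
      V = vectors (suc n)
      w = form es m
      left : ∀ a p z n₀ → a ℤ.* z ℤ.- n₀ ≡ (a ℤ.* p ℤ.- p ℤ.+ a ℤ.* z) ℤ.- (n₀ ℤ.+ (a ℤ.- 1ℤ) ℤ.* p)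
      left = ℤSolver.solve-∀
      right : ∀ a p n₀ nw → (n₀ ℤ.+ (a ℤ.- 1ℤ) ℤ.* nw) ℤ.- (n₀ ℤ.+ (a ℤ.- 1ℤ) ℤ.* p) ≡ (a ℤ.- 1ℤ) ℤ.* (nw ℤ.- p)
      right = ℤSolver.solve-∀
      rearrange : ∀ a p z n₀ nw → n₀ ℤ.+ (a ℤ.- 1ℤ) ℤ.* nw ≡ a ℤ.* p ℤ.- p ℤ.+ a ℤ.* z →
        a ℤ.* z ℤ.- n₀ ≡ (a ℤ.- 1ℤ) ℤ.* (nw ℤ.- p)
      -- Subtracting n₀ + (a - 1) p from both counts leaves the cone's deviation on one side and the
      -- deviation of nw from its mean p on the other.
      rearrange a p z n₀ nw eq = trans (left a p z n₀)
        (trans (cong (ℤ._- (n₀ ℤ.+ (a ℤ.- 1ℤ) ℤ.* p)) (sym eq)) (right a p n₀ nw))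

-- Numbers of representations by diagonal forms.

module Counts {q : ℕ} (𝔽 : FiniteField q) (q-odd : 2 ∤ q) where
  open FiniteField 𝔽
  open FieldCounting 𝔽
  open OddOrder q-odd
  open Forms 𝔽 q-odd

  ∑-vectors₁ : (f : Vec F 1 → ℤ) → ∑ (vectors 1) f ≡ ∑[ x ← elements ] f (x ∷ [])
  ∑-vectors₁ f = trans (∑-vectors f) (∑-cong elements λ x → ℤₚ.+-identityʳ (f (x ∷ [])))

  ∑-vectors₂ : (f : Vec F 2 → ℤ) → ∑ (vectors 2) f ≡ ∑[ x ← elements ] ∑[ z ← elements ] f (x ∷ z ∷ [])
  ∑-vectors₂ f = trans (∑-vectors f) (∑-cong elements λ x → ∑-vectors₁ (λ ξ → f (x ∷ ξ)))

  ∑-represent : ∀ {d} (cs : Vec F d) → ∑ elements (represent cs) ≡ Q ℤ.^ d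
  ∑-represent {d} cs = begin
    ∑[ w ← elements ] ∑[ ξ ← vectors d ] 𝟙 (form cs ξ ≟ w)  ≡⟨ ∑-swap elements (vectors d) _ ⟩
    ∑[ ξ ← vectors d ] ∑[ w ← elements ] 𝟙 (form cs ξ ≟ w)  ≡⟨ ∑-cong (vectors d) (λ ξ → ∑-𝟙 (form cs ξ)) ⟩
    ∑[ ξ ← vectors d ] 1ℤ                                   ≡⟨ ∑-const-vectors d 1ℤ ⟩
    Q ℤ.^ d ℤ.* 1ℤ                                          ≡⟨ ℤₚ.*-identityʳ (Q ℤ.^ d) ⟩
    Q ℤ.^ d                                                 ∎
    where open ≡-Reasoning

  module Binary {c e : F} (ce≡1 : c * e ≡ 1#) where

    private
      cs es : Vec F 2
      cs = 1# ∷ c ∷ []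
      es = 1# ∷ e ∷ []

      -- The type of the form x² + c z²: κ is 1 when it splits into linear factors and -1 when it is
      -- anisotropic.
      κ : ℤ
      κ = η (- c)

      inv : Inverses cs es
      inv = *-identityˡ 1# ∷ ce≡1 ∷ []

    c≢0 : c ≢ 0#
    c≢0 refl = 0≢1 (trans (sym (zeroˡ e)) ce≡1)

    cancel-c : ∀ t → - c * t + c * t ≡ 0#
    cancel-c t = trans (sym (distribʳ t (- c) c)) (trans (cong (_* t) (-‿inverseˡ c)) (zeroˡ t))

    η-scaled : ∀ z → η (- c * (z * z)) ≡ κ ℤ.- 𝟙 (0# ≟ z) ℤ.* κ
    η-scaled z with 0# ≟ z
    ... | yes refl = trans (cong η (trans (cong (- c *_) (zeroˡ 0#)) (zeroʳ (- c))))
      (trans η-zero (sym (trans (cong (λ t → κ ℤ.- t) (ℤₚ.*-identityˡ κ)) (ℤₚ.+-inverseʳ κ))))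
    ... | no 0≢z = trans (cong η (*-comm (- c) (z * z)))
      (trans (η-square-* (0≢z ∘ sym) (- c)) (sym (ℤₚ.+-identityʳ κ)))

    represent-null : represent cs 0# ≡ Q ℤ.+ κ ℤ.* (Q ℤ.- 1ℤ)
    represent-null = begin
      represent cs 0#
        ≡⟨ ∑-vectors₂ (λ ξ → 𝟙 (form cs ξ ≟ 0#)) ⟩
      ∑[ x ← elements ] ∑[ z ← elements ] 𝟙 (1# * (x * x) + (c * (z * z) + 0#) ≟ 0#)
        ≡⟨ ∑-swap elements elements _ ⟩
      ∑[ z ← elements ] ∑[ x ← elements ] 𝟙 (1# * (x * x) + (c * (z * z) + 0#) ≟ 0#)
        ≡⟨ ∑-cong elements (λ z → ∑-cong elements λ x →
             𝟙-cong (1# * (x * x) + (c * (z * z) + 0#) ≟ 0#) (x * x ≟ - c * (z * z))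
               (λ eq → +-cancelʳ (c * (z * z)) (trans (sym (tidy x z)) (trans eq (sym (cancel-c (z * z))))))
               (λ eq → trans (tidy x z) (trans (cong (_+ c * (z * z)) eq) (cancel-c (z * z))))) ⟩
      ∑[ z ← elements ] roots (- c * (z * z))
        ≡⟨ ∑-cong elements (λ z → trans (roots≡1+η (- c * (z * z))) (cong (λ t → 1ℤ ℤ.+ t) (η-scaled z))) ⟩
      ∑[ z ← elements ] (1ℤ ℤ.+ (κ ℤ.- 𝟙 (0# ≟ z) ℤ.* κ))
        ≡⟨ trans (∑-+ elements (λ _ → 1ℤ) (λ z → κ ℤ.- 𝟙 (0# ≟ z) ℤ.* κ))
             (cong₂ ℤ._+_ (∑-const-elements 1ℤ)
               (trans (∑-- elements (λ _ → κ) (λ z → 𝟙 (0# ≟ z) ℤ.* κ))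
                 (cong₂ ℤ._-_ (∑-const-elements κ) (∑-pick 0# (λ _ → κ))))) ⟩
      Q ℤ.* 1ℤ ℤ.+ (Q ℤ.* κ ℤ.- κ)
        ≡⟨ rearrange Q κ ⟩
      Q ℤ.+ κ ℤ.* (Q ℤ.- 1ℤ) ∎
      where
        open ≡-Reasoning
        tidy : ∀ x z → 1# * (x * x) + (c * (z * z) + 0#) ≡ x * x + c * (z * z)
        tidy x z = solve 3 (λ x c z → con 1 :* (x :* x) :+ (c :* (z :* z) :+ con 0) := x :* x :+ c :* (z :* z)) refl x c z
        rearrange : ∀ a b → a ℤ.* 1ℤ ℤ.+ (a ℤ.* b ℤ.- b) ≡ a ℤ.+ b ℤ.* (a ℤ.- 1ℤ)
        rearrange = ℤSolver.solve-∀

    -- Squaring a x = - b z and using x² = - c z² gives `form es m` times x² = 0, so x = 0, and then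
    -- c z² = 0 gives z = 0.
    isotropic-line : ∀ m → form es m ≢ 0# → ∀ ξ → form cs ξ ≡ 0# → m · ξ ≡ 0# → 0ᵛ ≡ ξ
    isotropic-line (a ∷ b ∷ []) w≢0 (x ∷ z ∷ []) iso orth = sym (cong₂ (λ s t → s ∷ t ∷ []) x≡0 z≡0)
      where
        open ≡-Reasoning
        axax≡bzbz : a * a * (x * x) ≡ b * b * (z * z)
        -- With the cross term added, both sides are multiples of a x + b z, which is 0.
        axax≡bzbz = +-cancelʳ (a * x * (b * z)) (begin
          a * a * (x * x) + a * x * (b * z)
            ≡⟨ solve 4 (λ a b x z → a :* a :* (x :* x) :+ a :* x :* (b :* z) := a :* x :* (a :* x :+ (b :* z :+ con 0))) refl a b x z ⟩
          a * x * (a * x + (b * z + 0#))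
            ≡⟨ trans (cong (a * x *_) orth) (trans (zeroʳ (a * x)) (sym (trans (cong (b * z *_) orth) (zeroʳ (b * z))))) ⟩
          b * z * (a * x + (b * z + 0#))
            ≡⟨ solve 4 (λ a b x z → b :* z :* (a :* x :+ (b :* z :+ con 0)) := b :* b :* (z :* z) :+ a :* x :* (b :* z)) refl a b x z ⟩
          b * b * (z * z) + a * x * (b * z) ∎)
        wxx≡0 : form es (a ∷ b ∷ []) * (x * x) ≡ 0#
        wxx≡0 = begin
          (1# * (a * a) + (e * (b * b) + 0#)) * (x * x)
            ≡⟨ solve 4 (λ a b e x → (con 1 :* (a :* a) :+ (e :* (b :* b) :+ con 0)) :* (x :* x)
                 := a :* a :* (x :* x) :+ e :* (b :* b) :* (x :* x)) refl a b e x ⟩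
          a * a * (x * x) + e * (b * b) * (x * x)
            ≡⟨ cong (_+ e * (b * b) * (x * x)) (trans axax≡bzbz (trans (sym (*-identityˡ _)) (cong (_* (b * b * (z * z))) (sym ce≡1)))) ⟩
          c * e * (b * b * (z * z)) + e * (b * b) * (x * x)
            ≡⟨ solve 5 (λ b c e x z → c :* e :* (b :* b :* (z :* z)) :+ e :* (b :* b) :* (x :* x)
                 := e :* (b :* b) :* (con 1 :* (x :* x) :+ (c :* (z :* z) :+ con 0))) refl b c e x z ⟩
          e * (b * b) * (1# * (x * x) + (c * (z * z) + 0#))
            ≡⟨ trans (cong (e * (b * b) *_) iso) (zeroʳ _) ⟩
          0# ∎
        x≡0 : x ≡ 0#
        x≡0 = square≡0 (x*y≡0⇒y≡0 w≢0 wxx≡0)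
        z≡0 : z ≡ 0#
        z≡0 = square≡0 (x*y≡0⇒y≡0 c≢0 (begin
          c * (z * z)
            ≡⟨ solve 2 (λ c z → c :* (z :* z) := con 1 :* (con 0 :* con 0) :+ (c :* (z :* z) :+ con 0)) refl c z ⟩
          1# * (0# * 0#) + (c * (z * z) + 0#)   ≡⟨ cong (λ t → 1# * (t * t) + (c * (z * z) + 0#)) (sym x≡0) ⟩
          1# * (x * x) + (c * (z * z) + 0#)     ≡⟨ iso ⟩
          0#                                    ∎))

    isotropic⊥≡1 : ∀ m → form es m ≢ 0# → isotropic⊥ cs m ≡ 1ℤ
    isotropic⊥≡1 m w≢0 = trans (∑-cong (vectors 2) step) (Vectors.∑-𝟙 {2} 0ᵛ)
      where
        step : ∀ ξ → 𝟙 (form cs ξ ≟ 0#) ℤ.* 𝟙 (m · ξ ≟ 0#) ≡ 𝟙 (0ᵛ ≟ᵛ ξ)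
        step ξ = trans (𝟙-× (form cs ξ ≟ 0#) (m · ξ ≟ 0#) ((form cs ξ ≟ 0#) ×-dec (m · ξ ≟ 0#)))
          (𝟙-cong ((form cs ξ ≟ 0#) ×-dec (m · ξ ≟ 0#)) (0ᵛ ≟ᵛ ξ)
            (λ (iso , orth) → isotropic-line m w≢0 ξ iso orth)
            (λ { refl → form-0ᵛ cs , ·-0ᵛ m }))
          where
            ·-0ᵛ : ∀ m → m · 0ᵛ {2} ≡ 0#
            ·-0ᵛ (a ∷ b ∷ []) = solve 2 (λ a b → a :* con 0 :+ (b :* con 0 :+ con 0) := con 0) refl a b

    -- `duality` at m = `cs ⊛ ξ`, whose dual value is w = `form cs ξ`, expresses the count at w
    -- through the count at 0. Only 0 is both isotropic and orthogonal to m, so (q - 1)(r(w) - q) =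
    -- q - (q + κ (q - 1)) = - κ (q - 1).
    represent-represented : ∀ ξ → form cs ξ ≢ 0# → represent cs (form cs ξ) ≡ Q ℤ.- κ
    represent-represented ξ w≢0 = ℤₚ.*-cancelˡ-≡ (Q ℤ.- 1ℤ) _ _ (begin
      (Q ℤ.- 1ℤ) ℤ.* n                                   ≡⟨ split Q n ⟩
      (Q ℤ.- 1ℤ) ℤ.* (n ℤ.- Q ℤ.^ 1) ℤ.+ (Q ℤ.- 1ℤ) ℤ.* Q
        ≡⟨ cong (ℤ._+ (Q ℤ.- 1ℤ) ℤ.* Q) (trans
             (cong (λ t → (Q ℤ.- 1ℤ) ℤ.* (represent cs t ℤ.- Q ℤ.^ 1)) (sym (form-dual inv ξ)))
             (sym (duality inv m≢0))) ⟩
      Q ℤ.* isotropic⊥ cs (cs ⊛ ξ) ℤ.- represent cs 0# ℤ.+ (Q ℤ.- 1ℤ) ℤ.* Q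
        ≡⟨ cong₂ (λ a b → Q ℤ.* a ℤ.- b ℤ.+ (Q ℤ.- 1ℤ) ℤ.* Q)
             (isotropic⊥≡1 (cs ⊛ ξ) (w≢0 ∘ trans (sym (form-dual inv ξ)))) represent-null ⟩
      Q ℤ.* 1ℤ ℤ.- (Q ℤ.+ κ ℤ.* (Q ℤ.- 1ℤ)) ℤ.+ (Q ℤ.- 1ℤ) ℤ.* Q
        ≡⟨ simplify Q κ ⟩
      (Q ℤ.- 1ℤ) ℤ.* (Q ℤ.- κ) ∎)
      where
        open ≡-Reasoning
        n = represent cs (form cs ξ)
        m≢0 : cs ⊛ ξ ≢ 0ᵛ
        m≢0 eq = w≢0 (trans (sym (form-dual inv ξ)) (trans (cong (form es) eq) (form-0ᵛ es)))
        split : ∀ a n → (a ℤ.- 1ℤ) ℤ.* n ≡ (a ℤ.- 1ℤ) ℤ.* (n ℤ.- a ℤ.* 1ℤ) ℤ.+ (a ℤ.- 1ℤ) ℤ.* a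
        split = ℤSolver.solve-∀
        simplify : ∀ a k → a ℤ.* 1ℤ ℤ.- (a ℤ.+ k ℤ.* (a ℤ.- 1ℤ)) ℤ.+ (a ℤ.- 1ℤ) ℤ.* a ≡ (a ℤ.- 1ℤ) ℤ.* (a ℤ.- k)
        simplify = ℤSolver.solve-∀

    count : F → ℤ
    count w = Q ℤ.+ κ ℤ.* (Q ℤ.* 𝟙 (0# ≟ w) ℤ.- 1ℤ)

    κ≤Q : κ ℤ.≤ Q
    κ≤Q with κ | quadratic (- c)
    ... | _ | null _        = ℤ.+≤+ ℕ.z≤n
    ... | _ | square _ _ _  = ℤₚ.≤-trans (ℤ.+≤+ (ℕ.s≤s ℕ.z≤n)) 2≤Q
    ... | _ | nonsquare _ _ = ℤ.-≤+

    -- Equality holds at 0 and at every represented w. A value that is not represented has count 0,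
    -- which is at most q - κ; that no nonzero value is missed follows only from comparing totals.
    represent≤count : ∀ w → represent cs w ℤ.≤ count w
    represent≤count w with 0# ≟ w
    ... | yes refl = ℤₚ.≤-reflexive (trans represent-null (cong (λ t → Q ℤ.+ κ ℤ.* (t ℤ.- 1ℤ)) (sym (ℤₚ.*-identityʳ Q))))
    ... | no 0≢w with Any.any? (λ ξ → form cs ξ ≟ w) (vectors 2)
    ...   | yes p with Any.satisfied p
    ...     | ξ , refl = ℤₚ.≤-reflexive (trans (represent-represented ξ (0≢w ∘ sym)) (simplify Q κ))
      where
        simplify : ∀ a k → a ℤ.- k ≡ a ℤ.+ k ℤ.* (a ℤ.* 0ℤ ℤ.- 1ℤ)
        simplify = ℤSolver.solve-∀
    represent≤count w | no 0≢w | no ¬p = subst (ℤ._≤ _)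
      (sym (trans (∑-cong (vectors 2) λ ξ → 𝟙-no (form cs ξ ≟ w) (¬p ∘ lose (∈-vectors ξ))) (∑-zero (vectors 2))))
      (ℤₚ.≤-trans (ℤₚ.i≤j⇒0≤j-i κ≤Q) (ℤₚ.≤-reflexive (simplify Q κ)))
      where
        simplify : ∀ a k → a ℤ.- k ≡ a ℤ.+ k ℤ.* (a ℤ.* 0ℤ ℤ.- 1ℤ)
        simplify = ℤSolver.solve-∀

    -- The upper bound is an equality because both sides have the same sum q² over w.
    represent≡count : ∀ w → represent cs w ≡ count w
    represent≡count w = ∑-tight {g = count} represent≤count (trans (∑-represent cs) (sym total)) (∈-elements w)
      where
        open ≡-Reasoning
        simplify : ∀ a k → a ℤ.* a ℤ.+ k ℤ.* (a ℤ.* 1ℤ ℤ.- a ℤ.* 1ℤ) ≡ a ℤ.* (a ℤ.* 1ℤ)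
        simplify = ℤSolver.solve-∀
        total : ∑ elements count ≡ Q ℤ.^ 2
        total = begin
          ∑ elements count
            ≡⟨ ∑-+ elements (λ _ → Q) (λ w → κ ℤ.* (Q ℤ.* 𝟙 (0# ≟ w) ℤ.- 1ℤ)) ⟩
          ∑[ w ← elements ] Q ℤ.+ ∑[ w ← elements ] (κ ℤ.* (Q ℤ.* 𝟙 (0# ≟ w) ℤ.- 1ℤ))
            ≡⟨ cong₂ ℤ._+_ (∑-const-elements Q) (trans (∑-*ˡ elements κ (λ w → Q ℤ.* 𝟙 (0# ≟ w) ℤ.- 1ℤ))
                 (cong (κ ℤ.*_) (trans (∑-- elements (λ w → Q ℤ.* 𝟙 (0# ≟ w)) (λ _ → 1ℤ))
                   (cong₂ ℤ._-_ (trans (∑-*ˡ elements Q (λ w → 𝟙 (0# ≟ w))) (cong (Q ℤ.*_) (∑-𝟙 0#)))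
                     (∑-const-elements 1ℤ))))) ⟩
          Q ℤ.* Q ℤ.+ κ ℤ.* (Q ℤ.* 1ℤ ℤ.- Q ℤ.* 1ℤ)
            ≡⟨ simplify Q κ ⟩
          Q ℤ.^ 2 ∎

  ε : ℤ
  ε = η (- 1#)

  -- For a fixed tail ξ the first two coordinates must represent w - `form cs ξ` by x² + y², the
  -- binary form with c = 1 and κ = ε. Its count is q - ε, plus ε q exactly when `form cs ξ` = w,
  -- and the latter ξ are counted by `represent cs w`.
  represent-1∷1∷ : ∀ {d} (cs : Vec F d) w →
    represent (1# ∷ 1# ∷ cs) w ≡ (Q ℤ.- ε) ℤ.* Q ℤ.^ d ℤ.+ ε ℤ.* Q ℤ.* represent cs w
  represent-1∷1∷ {d} cs w = begin
    ∑ (vectors (suc (suc d))) (λ ξ → 𝟙 (form (1# ∷ 1# ∷ cs) ξ ≟ w))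
      ≡⟨ trans (∑-vectors {suc d} (λ ξ → 𝟙 (form (1# ∷ 1# ∷ cs) ξ ≟ w)))
           (∑-cong elements λ x → ∑-vectors {d} (λ ξ → 𝟙 (form (1# ∷ 1# ∷ cs) (x ∷ ξ) ≟ w))) ⟩
    ∑[ x ← elements ] ∑[ y ← elements ] ∑[ ξ ← V ] 𝟙 (1# * (x * x) + (1# * (y * y) + form cs ξ) ≟ w)
      ≡⟨ trans (∑-cong elements λ x → ∑-swap elements V _) (∑-swap elements V _) ⟩
    ∑[ ξ ← V ] ∑[ x ← elements ] ∑[ y ← elements ] 𝟙 (1# * (x * x) + (1# * (y * y) + form cs ξ) ≟ w)
      ≡⟨ ∑-cong V (λ ξ → ∑-cong elements λ x → ∑-cong elements λ y →
           𝟙-cong (1# * (x * x) + (1# * (y * y) + form cs ξ) ≟ w) (form 1∷1 (x ∷ y ∷ []) ≟ w + - form cs ξ)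
             (λ eq → +-cancelʳ (form cs ξ) (trans (assoc x y ξ) (trans eq (sym (minus-plus ξ)))))
             (λ eq → trans (sym (assoc x y ξ)) (trans (cong (_+ form cs ξ) eq) (minus-plus ξ)))) ⟩
    ∑[ ξ ← V ] ∑[ x ← elements ] ∑[ y ← elements ] 𝟙 (form 1∷1 (x ∷ y ∷ []) ≟ w + - form cs ξ)
      ≡⟨ ∑-cong V (λ ξ → trans (sym (∑-vectors₂ (λ ζ → 𝟙 (form 1∷1 ζ ≟ w + - form cs ξ))))
           (Binary.represent≡count (*-identityˡ 1#) (w + - form cs ξ))) ⟩
    ∑[ ξ ← V ] (Q ℤ.+ ε ℤ.* (Q ℤ.* 𝟙 (0# ≟ w + - form cs ξ) ℤ.- 1ℤ))
      ≡⟨ ∑-cong V (λ ξ → trans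
           (cong (λ t → Q ℤ.+ ε ℤ.* (Q ℤ.* t ℤ.- 1ℤ))
             (𝟙-cong (0# ≟ w + - form cs ξ) (form cs ξ ≟ w)
               (λ eq → sym (trans (x+y≡0⇒x≡-y (sym eq)) (-‿involutive _)))
               (λ { refl → sym (-‿inverseʳ _) })))
           (expand Q ε (𝟙 (form cs ξ ≟ w)))) ⟩
    ∑[ ξ ← V ] (Q ℤ.- ε ℤ.+ ε ℤ.* Q ℤ.* 𝟙 (form cs ξ ≟ w))
      ≡⟨ trans (∑-+ V (λ _ → Q ℤ.- ε) (λ ξ → ε ℤ.* Q ℤ.* 𝟙 (form cs ξ ≟ w)))
           (cong₂ ℤ._+_ (trans (∑-const-vectors d (Q ℤ.- ε)) (ℤₚ.*-comm (Q ℤ.^ d) (Q ℤ.- ε)))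
             (∑-*ˡ V (ε ℤ.* Q) (λ ξ → 𝟙 (form cs ξ ≟ w)))) ⟩
    (Q ℤ.- ε) ℤ.* Q ℤ.^ d ℤ.+ ε ℤ.* Q ℤ.* represent cs w ∎
    where
      open ≡-Reasoning
      V = vectors d
      1∷1 : Vec F 2
      1∷1 = 1# ∷ 1# ∷ []
      assoc : ∀ x y ξ → form 1∷1 (x ∷ y ∷ []) + form cs ξ ≡ 1# * (x * x) + (1# * (y * y) + form cs ξ)
      assoc x y ξ = solve 3 (λ x y f → con 1 :* (x :* x) :+ (con 1 :* (y :* y) :+ con 0) :+ f
        := con 1 :* (x :* x) :+ (con 1 :* (y :* y) :+ f)) refl x y (form cs ξ)
      minus-plus : ∀ ξ → w + - form cs ξ + form cs ξ ≡ w
      minus-plus ξ = trans (+-assoc w _ _) (trans (cong (w +_) (-‿inverseˡ (form cs ξ))) (+-identityʳ w))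
      expand : ∀ a b t → a ℤ.+ b ℤ.* (a ℤ.* t ℤ.- 1ℤ) ≡ a ℤ.- b ℤ.+ b ℤ.* a ℤ.* t
      expand = ℤSolver.solve-∀

  coefficients : F → ∀ n → Vec F (suc n)
  coefficients c zero    = c ∷ []
  coefficients c (suc n) = 1# ∷ coefficients c n

  coefficients-inverses : ∀ {c e} → c * e ≡ 1# → ∀ n → Inverses (coefficients c n) (coefficients e n)
  coefficients-inverses ce≡1 zero    = ce≡1 ∷ []
  coefficients-inverses ce≡1 (suc n) = *-identityˡ 1# ∷ coefficients-inverses ce≡1 n

  -- Deviation of the representation numbers from their mean.

  module Excess {c e : F} (ce≡1 : c * e ≡ 1#) where

    -- The form has n + 1 variables, so q^n is the average of its representation numbers over the q
    -- values w.
    excess : ℕ → F → ℤ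
    excess n w = represent (coefficients c n) w ℤ.- Q ℤ.^ n

    excess-zero : ∀ w → excess 0 w ≡ η (e * w)
    excess-zero w = trans (cong (ℤ._- 1ℤ) (begin
      ∑[ ξ ← vectors 1 ] 𝟙 (form (c ∷ []) ξ ≟ w)   ≡⟨ ∑-vectors₁ (λ ξ → 𝟙 (form (c ∷ []) ξ ≟ w)) ⟩
      ∑[ x ← elements ] 𝟙 (c * (x * x) + 0# ≟ w)   ≡⟨ ∑-cong elements (λ x → 𝟙-cong (c * (x * x) + 0# ≟ w) (x * x ≟ e * w)
                                                        (λ { refl → sym (trans (cong (e *_) (+-identityʳ _)) (e*c* (x * x))) })
                                                        (λ eq → trans (+-identityʳ _) (trans (cong (c *_) eq) (c*e* w)))) ⟩
      roots (e * w)                                ≡⟨ roots≡1+η (e * w) ⟩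
      1ℤ ℤ.+ η (e * w)                             ∎)) (cancel (η (e * w)))
      where
        open ≡-Reasoning
        c*e* : ∀ t → c * (e * t) ≡ t
        c*e* t = trans (sym (*-assoc c e t)) (trans (cong (_* t) ce≡1) (*-identityˡ t))
        e*c* : ∀ t → e * (c * t) ≡ t
        e*c* t = trans (sym (*-assoc e c t)) (trans (cong (_* t) (trans (*-comm e c) ce≡1)) (*-identityˡ t))
        cancel : ∀ t → 1ℤ ℤ.+ t ℤ.- 1ℤ ≡ t
        cancel = ℤSolver.solve-∀

    excess-one : ∀ w → excess 1 w ≡ η (- c) ℤ.* (Q ℤ.* 𝟙 (0# ≟ w) ℤ.- 1ℤ)
    excess-one w = trans (cong (ℤ._- Q ℤ.* 1ℤ) (Binary.represent≡count ce≡1 w)) (cancel Q _)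
      where
        cancel : ∀ a t → a ℤ.+ t ℤ.- a ℤ.* 1ℤ ≡ t
        cancel = ℤSolver.solve-∀

    -- The main term (q - ε) q^{n+1} falls short of q^{n+2} by ε q · q^n, which is just what
    -- replaces the representation number by its excess.
    excess-step : ∀ n w → excess (suc (suc n)) w ≡ ε ℤ.* Q ℤ.* excess n w
    excess-step n w = trans (cong (ℤ._- Q ℤ.^ suc (suc n)) (represent-1∷1∷ (coefficients c n) w))
      (simplify Q ε (Q ℤ.^ n) (represent (coefficients c n) w))
      where
        simplify : ∀ a b p r → (a ℤ.- b) ℤ.* (a ℤ.* p) ℤ.+ b ℤ.* a ℤ.* r ℤ.- a ℤ.* (a ℤ.* p) ≡ b ℤ.* a ℤ.* (r ℤ.- p)
        simplify = ℤSolver.solve-∀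

    ∣η∣≤1 : ∀ t → ℤ.∣ η t ∣ ℕ.≤ 1
    ∣η∣≤1 t with η t | quadratic t
    ... | _ | null _        = ℕ.z≤n
    ... | _ | square _ _ _  = ℕₚ.≤-refl
    ... | _ | nonsquare _ _ = ℕₚ.≤-refl

    -- Each pair of squares multiplies the absolute value by at most q, starting from |η| ≤ 1 in one
    -- variable. The form `k * 2` of the index makes it grow by two successors with k, as
    -- `excess-step` requires.
    ∣excess∣≤ : ∀ k w → ℤ.∣ excess (k ℕ.* 2) w ∣ ℕ.≤ q ℕ.^ k
    ∣excess∣≤ zero    w = subst (λ t → ℤ.∣ t ∣ ℕ.≤ 1) (sym (excess-zero w)) (∣η∣≤1 (e * w))
    ∣excess∣≤ (suc k) w = begin
      ℤ.∣ excess (suc k ℕ.* 2) w ∣                     ≡⟨ cong ℤ.∣_∣ (excess-step (k ℕ.* 2) w) ⟩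
      ℤ.∣ ε ℤ.* Q ℤ.* excess (k ℕ.* 2) w ∣             ≡⟨ trans (ℤₚ.abs-* (ε ℤ.* Q) (excess (k ℕ.* 2) w))
                                                            (cong (ℕ._* ℤ.∣ excess (k ℕ.* 2) w ∣) (ℤₚ.abs-* ε Q)) ⟩
      ℤ.∣ ε ∣ ℕ.* q ℕ.* ℤ.∣ excess (k ℕ.* 2) w ∣       ≤⟨ ℕₚ.*-mono-≤ (ℕₚ.*-monoˡ-≤ q (∣η∣≤1 (- 1#))) (∣excess∣≤ k w) ⟩
      1 ℕ.* q ℕ.* q ℕ.^ k                              ≡⟨ cong (ℕ._* q ℕ.^ k) (ℕₚ.*-identityˡ q) ⟩
      q ℕ.* q ℕ.^ k                                    ∎
      where open ℕₚ.≤-Reasoning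

    pos-^ : ∀ k → ℤ.+ (q ℕ.^ k) ≡ Q ℤ.^ k
    pos-^ zero    = refl
    pos-^ (suc k) = trans (ℤₚ.pos-* q (q ℕ.^ k)) (cong (Q ℤ.*_) (pos-^ k))

    excess-odd-dim : ∀ k w → excess (k ℕ.* 2) w ℤ.≤ ℤ.+ (q ℕ.^ k)
    excess-odd-dim k w = ℤₚ.≤-trans (i≤∣i∣ (excess (k ℕ.* 2) w)) (ℤ.+≤+ (∣excess∣≤ k w))
      where
        i≤∣i∣ : ∀ i → i ℤ.≤ ℤ.+ ℤ.∣ i ∣
        i≤∣i∣ (ℤ.+ _)      = ℤₚ.≤-refl
        i≤∣i∣ (ℤ.-[1+ _ ]) = ℤ.-≤+

    excess-even : ∀ k w →
      excess (suc (k ℕ.* 2)) w ≡ ε ℤ.^ k ℤ.* η (- c) ℤ.* (Q ℤ.^ k ℤ.* (Q ℤ.* 𝟙 (0# ≟ w) ℤ.- 1ℤ))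
    excess-even zero    w = trans (excess-one w) (simplify (η (- c)) _)
      where
        simplify : ∀ a b → a ℤ.* b ≡ 1ℤ ℤ.* a ℤ.* (1ℤ ℤ.* b)
        simplify = ℤSolver.solve-∀
    excess-even (suc k) w = trans (excess-step (suc (k ℕ.* 2)) w)
      (trans (cong (ε ℤ.* Q ℤ.*_) (excess-even k w)) (rearrange ε Q (ε ℤ.^ k) (η (- c)) (Q ℤ.^ k) (Q ℤ.* 𝟙 (0# ≟ w) ℤ.- 1ℤ)))
      where
        rearrange : ∀ a b c d e f → a ℤ.* b ℤ.* (c ℤ.* d ℤ.* (e ℤ.* f)) ≡ a ℤ.* c ℤ.* d ℤ.* (b ℤ.* e ℤ.* f)
        rearrange = ℤSolver.solve-∀

    η-^ : ∀ k → η ((- 1#) ^ k) ≡ ε ℤ.^ k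
    η-^ zero    = trans (cong η (sym (*-identityˡ 1#))) (trans (cong η (sym (*-identityʳ (1# * 1#)))) (trans (η-square-* (0≢1 ∘ sym) 1#) η-1))
      where
        η-1 : η 1# ≡ 1ℤ
        η-1 with η 1# | quadratic 1#
        ... | _ | null 1≡0        = contradiction (sym 1≡0) 0≢1
        ... | _ | square _ _ _    = refl
        ... | _ | nonsquare _ ¬sq = contradiction (*-identityˡ 1#) (¬sq 1#)
    η-^ (suc k) = trans (η-* (- 1#) ((- 1#) ^ k)) (cong (ε ℤ.*_) (η-^ k))

    -- One factor -1 is absorbed into - c and l² is a nonzero square. With d = 2 (k + 1) and l² c =
    -- λ² - 1 this identifies the sign in `excess-even` with the character value in the hypotheses
    -- of the theorem.
    sign-discriminant : ∀ k {l} → l ≢ 0# → η ((- 1#) ^ suc k * (l * l * c)) ≡ ε ℤ.^ k ℤ.* η (- c)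
    sign-discriminant k {l} l≢0 = begin
      η ((- 1#) ^ suc k * (l * l * c))             ≡⟨ η-* ((- 1#) ^ suc k) (l * l * c) ⟩
      η ((- 1#) ^ suc k) ℤ.* η (l * l * c)         ≡⟨ cong₂ ℤ._*_ (η-^ (suc k)) (η-square-* l≢0 c) ⟩
      ε ℤ.* ε ℤ.^ k ℤ.* η c                        ≡⟨ rearrange ε (ε ℤ.^ k) (η c) ⟩
      ε ℤ.^ k ℤ.* (ε ℤ.* η c)                      ≡⟨ cong (ε ℤ.^ k ℤ.*_) (sym (trans (cong η (sym -1*c)) (η-* (- 1#) c))) ⟩
      ε ℤ.^ k ℤ.* η (- c)                          ∎
      where
        open ≡-Reasoning
        -1*c : - 1# * c ≡ - c
        -1*c = trans (sym (-‿distribˡ-* 1# c)) (cong -_ (*-identityˡ c))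
        rearrange : ∀ a b c → a ℤ.* b ℤ.* c ≡ b ℤ.* (a ℤ.* c)
        rearrange = ℤSolver.solve-∀

    -- With sign -1 the excess is q^k away from w = 0 and drops by q^{k+1} at w = 0.
    excess-even-dim⁻ : ∀ k → ε ℤ.^ k ℤ.* η (- c) ≡ -1ℤ → ∀ w →
      excess (suc (k ℕ.* 2)) w ℤ.≤ ℤ.+ (q ℕ.^ k)
    excess-even-dim⁻ k σ≡-1 w = begin
      excess (suc (k ℕ.* 2)) w
        ≡⟨ trans (excess-even k w) (cong (ℤ._* (Q ℤ.^ k ℤ.* (Q ℤ.* 𝟙 (0# ≟ w) ℤ.- 1ℤ))) σ≡-1) ⟩
      -1ℤ ℤ.* (Q ℤ.^ k ℤ.* (Q ℤ.* 𝟙 (0# ≟ w) ℤ.- 1ℤ))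
        ≡⟨ simplify (Q ℤ.^ k) (Q ℤ.* 𝟙 (0# ≟ w)) ⟩
      Q ℤ.^ k ℤ.- Q ℤ.^ k ℤ.* (Q ℤ.* 𝟙 (0# ≟ w))
        ≤⟨ ℤₚ.+-monoʳ-≤ (Q ℤ.^ k) (ℤₚ.neg-mono-≤ (*-nonneg (subst (0ℤ ℤ.≤_) (pos-^ k) (ℤ.+≤+ ℕ.z≤n))
             (*-nonneg {Q} (ℤ.+≤+ ℕ.z≤n) (𝟙-nonneg (0# ≟ w))))) ⟩
      Q ℤ.^ k ℤ.+ 0ℤ
        ≡⟨ trans (ℤₚ.+-identityʳ (Q ℤ.^ k)) (sym (pos-^ k)) ⟩
      ℤ.+ (q ℕ.^ k) ∎
      where
        open ℤₚ.≤-Reasoning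
        simplify : ∀ p t → -1ℤ ℤ.* (p ℤ.* (t ℤ.- 1ℤ)) ≡ p ℤ.- p ℤ.* t
        simplify = ℤSolver.solve-∀

    -- With sign 1 the maximum is at w = 0, because the form has too many isotropic vectors; this is
    -- the source of the larger bound in (c).
    excess-even-dim⁺ : ∀ k → ε ℤ.^ k ℤ.* η (- c) ≡ 1ℤ → ∀ w →
      excess (suc (k ℕ.* 2)) w ℤ.≤ ℤ.+ (q ℕ.^ suc k) ℤ.- ℤ.+ (q ℕ.^ k)
    excess-even-dim⁺ k σ≡1 w = begin
      excess (suc (k ℕ.* 2)) w
        ≡⟨ trans (excess-even k w) (cong (ℤ._* (Q ℤ.^ k ℤ.* (Q ℤ.* 𝟙 (0# ≟ w) ℤ.- 1ℤ))) σ≡1) ⟩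
      1ℤ ℤ.* (Q ℤ.^ k ℤ.* (Q ℤ.* 𝟙 (0# ≟ w) ℤ.- 1ℤ))
        ≡⟨ ℤₚ.*-identityˡ _ ⟩
      Q ℤ.^ k ℤ.* (Q ℤ.* 𝟙 (0# ≟ w) ℤ.- 1ℤ)
        ≤⟨ *-monoˡ (subst (0ℤ ℤ.≤_) (pos-^ k) (ℤ.+≤+ ℕ.z≤n)) (ℤₚ.+-monoˡ-≤ -1ℤ (*-monoˡ {Q} (ℤ.+≤+ ℕ.z≤n) (𝟙≤1 (0# ≟ w)))) ⟩
      Q ℤ.^ k ℤ.* (Q ℤ.* 1ℤ ℤ.- 1ℤ)
        ≡⟨ simplify Q (Q ℤ.^ k) ⟩
      Q ℤ.^ suc k ℤ.- Q ℤ.^ k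
        ≡⟨ sym (cong₂ ℤ._-_ (pos-^ (suc k)) (pos-^ k)) ⟩
      ℤ.+ (q ℕ.^ suc k) ℤ.- ℤ.+ (q ℕ.^ k) ∎
      where
        open ℤₚ.≤-Reasoning
        simplify : ∀ a p → p ℤ.* (a ℤ.* 1ℤ ℤ.- 1ℤ) ≡ a ℤ.* p ℤ.- p
        simplify = ℤSolver.solve-∀
        𝟙≤1 : ∀ {P : Set} (P? : Dec P) → 𝟙 P? ℤ.≤ 1ℤ
        𝟙≤1 (yes _) = ℤₚ.≤-refl
        𝟙≤1 (no _)  = ℤ.+≤+ ℕ.z≤n

-- Second moments of the projections of E.

module Energy {q : ℕ} (𝔽 : FiniteField q) (q-odd : 2 ∤ q) {n : ℕ}
  {E : Pred (Vec (FiniteField.F 𝔽) (suc n)) 0ℓ} (E? : Decidable E) where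
  open FiniteField 𝔽
  open FieldCounting 𝔽
  open OddOrder q-odd
  open Forms 𝔽 q-odd
  open Counts 𝔽 q-odd

  private
    V : List (Vec F (suc n))
    V = vectors (suc n)

    𝟙E : Vec F (suc n) → ℤ
    𝟙E x = 𝟙 (E? x)

  M : ℤ
  M = ℤ.+ card E?

  M≡∑ : M ≡ ∑ V 𝟙E
  M≡∑ = length-filter≡∑ E? V

  ∑-pairs-factor : ∀ (r : ℤ) → ∑[ x ← V ] ∑[ y ← V ] (𝟙E x ℤ.* 𝟙E y ℤ.* r) ≡ M ℤ.* M ℤ.* r
  ∑-pairs-factor r = begin
    ∑[ x ← V ] ∑[ y ← V ] (𝟙E x ℤ.* 𝟙E y ℤ.* r)    ≡⟨ ∑-cong V (λ x → ∑-*ʳ V (λ y → 𝟙E x ℤ.* 𝟙E y) r) ⟩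
    ∑[ x ← V ] (∑[ y ← V ] (𝟙E x ℤ.* 𝟙E y) ℤ.* r)  ≡⟨ ∑-*ʳ V (λ x → ∑[ y ← V ] (𝟙E x ℤ.* 𝟙E y)) r ⟩
    ∑[ x ← V ] ∑[ y ← V ] (𝟙E x ℤ.* 𝟙E y) ℤ.* r    ≡⟨ cong (ℤ._* r) (sym (trans (cong₂ ℤ._*_ M≡∑ M≡∑) (∑-* V V 𝟙E 𝟙E))) ⟩
    M ℤ.* M ℤ.* r                                  ∎
    where open ≡-Reasoning

  fibre : Vec F (suc n) → F → ℤ
  fibre ξ t = ∑[ x ← V ] (𝟙 (x · ξ ≟ t) ℤ.* 𝟙E x)

  ∑-fibre : ∀ ξ → ∑ elements (fibre ξ) ≡ M
  ∑-fibre ξ = trans (∑-swap elements V (λ t x → 𝟙 (x · ξ ≟ t) ℤ.* 𝟙E x))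
    (trans (∑-cong V λ x → ∑-pick (x · ξ) (λ _ → 𝟙E x)) (sym M≡∑))

  energy : Vec F (suc n) → ℤ
  energy ξ = ∑[ t ← elements ] (fibre ξ t ℤ.* fibre ξ t)

  energy-pairs : ∀ ξ → energy ξ ≡ ∑[ x ← V ] ∑[ y ← V ] (𝟙E x ℤ.* 𝟙E y ℤ.* 𝟙 (y · ξ ≟ x · ξ))
  energy-pairs ξ = begin
    ∑[ t ← elements ] (fibre ξ t ℤ.* fibre ξ t)
      ≡⟨ ∑-cong elements (λ t → ∑-* V V (g t) (g t)) ⟩
    ∑[ t ← elements ] ∑[ x ← V ] ∑[ y ← V ] (g t x ℤ.* g t y)
      ≡⟨ trans (∑-swap elements V _) (∑-cong V λ x → ∑-swap elements V _) ⟩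
    ∑[ x ← V ] ∑[ y ← V ] ∑[ t ← elements ] (g t x ℤ.* g t y)
      ≡⟨ ∑-cong V (λ x → ∑-cong V λ y → trans
           (∑-cong elements λ t → rearrange (𝟙 (x · ξ ≟ t)) (𝟙E x) (𝟙 (y · ξ ≟ t)) (𝟙E y))
           (∑-pick (x · ξ) (λ t → 𝟙E x ℤ.* 𝟙E y ℤ.* 𝟙 (y · ξ ≟ t)))) ⟩
    ∑[ x ← V ] ∑[ y ← V ] (𝟙E x ℤ.* 𝟙E y ℤ.* 𝟙 (y · ξ ≟ x · ξ)) ∎
    where
      open ≡-Reasoning
      g : F → Vec F (suc n) → ℤ
      g t x = 𝟙 (x · ξ ≟ t) ℤ.* 𝟙E x
      rearrange : ∀ a b c d → a ℤ.* b ℤ.* (c ℤ.* d) ≡ a ℤ.* (b ℤ.* d ℤ.* c)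
      rearrange = ℤSolver.solve-∀

  -- The H of the overview: q times the sum over t of (`fibre ξ t` - |E| / q)², with denominators
  -- cleared.
  deviation : Vec F (suc n) → ℤ
  deviation ξ = Q ℤ.* energy ξ ℤ.- M ℤ.* M

  deviation-nonneg : ∀ ξ → 0ℤ ℤ.≤ deviation ξ
  deviation-nonneg ξ = ℤₚ.i≤j⇒0≤j-i (begin
    M ℤ.* M
      ≡⟨ cong (λ s → s ℤ.* s) (sym (trans (∑-cong elements λ t → ℤₚ.*-identityˡ (fibre ξ t)) (∑-fibre ξ))) ⟩
    ∑[ t ← elements ] (1ℤ ℤ.* fibre ξ t) ℤ.* ∑[ t ← elements ] (1ℤ ℤ.* fibre ξ t)
      ≤⟨ cauchy-schwarz elements (λ _ → 1ℤ) (fibre ξ) ⟩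
    ∑[ t ← elements ] 1ℤ ℤ.* energy ξ
      ≡⟨ cong (ℤ._* energy ξ) (trans (∑-const-elements 1ℤ) (ℤₚ.*-identityʳ Q)) ⟩
    Q ℤ.* energy ξ ∎)
    where open ℤₚ.≤-Reasoning

  -- Spreading |E|² as one unit over each pair in E × E allows the sum over the cone to be carried
  -- out separately for each pair.
  deviation-pairs : ∀ ξ → deviation ξ ≡
    ∑[ x ← V ] ∑[ y ← V ] (𝟙E x ℤ.* 𝟙E y ℤ.* (Q ℤ.* 𝟙 (y · ξ ≟ x · ξ) ℤ.- 1ℤ))
  deviation-pairs ξ = begin
    Q ℤ.* energy ξ ℤ.- M ℤ.* M
      ≡⟨ cong₂ ℤ._-_ (trans (cong (Q ℤ.*_) (energy-pairs ξ)) (trans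
             (sym (∑-*ˡ V Q (λ x → ∑[ y ← V ] (e x y ℤ.* δ x y))))
             (∑-cong V λ x → sym (∑-*ˡ V Q (λ y → e x y ℤ.* δ x y)))))
           (trans (sym (ℤₚ.*-identityʳ (M ℤ.* M))) (sym (∑-pairs-factor 1ℤ))) ⟩
    ∑[ x ← V ] ∑[ y ← V ] (Q ℤ.* (e x y ℤ.* δ x y)) ℤ.- ∑[ x ← V ] ∑[ y ← V ] (e x y ℤ.* 1ℤ)
      ≡⟨ sym (trans (∑-cong V λ x → ∑-- V (λ y → Q ℤ.* (e x y ℤ.* δ x y)) (λ y → e x y ℤ.* 1ℤ))
           (∑-- V (λ x → ∑[ y ← V ] (Q ℤ.* (e x y ℤ.* δ x y))) (λ x → ∑[ y ← V ] (e x y ℤ.* 1ℤ)))) ⟩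
    ∑[ x ← V ] ∑[ y ← V ] (Q ℤ.* (e x y ℤ.* δ x y) ℤ.- e x y ℤ.* 1ℤ)
      ≡⟨ ∑-cong V (λ x → ∑-cong V λ y → factor Q (e x y) (δ x y)) ⟩
    ∑[ x ← V ] ∑[ y ← V ] (e x y ℤ.* (Q ℤ.* δ x y ℤ.- 1ℤ)) ∎
    where
      open ≡-Reasoning
      e δ : Vec F (suc n) → Vec F (suc n) → ℤ
      e x y = 𝟙E x ℤ.* 𝟙E y
      δ x y = 𝟙 (y · ξ ≟ x · ξ)
      factor : ∀ a b c → a ℤ.* (b ℤ.* c) ℤ.- b ℤ.* 1ℤ ≡ b ℤ.* (a ℤ.* c ℤ.- 1ℤ)
      factor = ℤSolver.solve-∀

  ·-∙ᵛ : ∀ {d} (y : Vec F d) s ξ → y · (s ∙ᵛ ξ) ≡ s * (y · ξ)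
  ·-∙ᵛ []      s []      = sym (zeroʳ s)
  ·-∙ᵛ (b ∷ y) s (x ∷ ξ) = trans (cong (b * (s * x) +_) (·-∙ᵛ y s ξ))
    (solve 4 (λ b s x u → b :* (s :* x) :+ s :* u := s :* (b :* x :+ u)) refl b s x (y · ξ))

  deviation-∙ᵛ : ∀ {s} → s ≢ 0# → ∀ ξ → deviation (s ∙ᵛ ξ) ≡ deviation ξ
  deviation-∙ᵛ {s} s≢0 ξ = cong (λ j → Q ℤ.* j ℤ.- M ℤ.* M) (trans (energy-pairs (s ∙ᵛ ξ)) (trans
    (∑-cong V λ x → ∑-cong V λ y → cong (𝟙E x ℤ.* 𝟙E y ℤ.*_)
      (𝟙-cong (y · (s ∙ᵛ ξ) ≟ x · (s ∙ᵛ ξ)) (y · ξ ≟ x · ξ)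
        (λ eq → *-cancelˡ s≢0 (trans (sym (·-∙ᵛ y s ξ)) (trans eq (·-∙ᵛ x s ξ))))
        (λ eq → trans (·-∙ᵛ y s ξ) (trans (cong (s *_) eq) (sym (·-∙ᵛ x s ξ))))))
    (sym (energy-pairs ξ))))

  -- Summation of the deviation over the cone and over its slices.

  module Cone {c e : F} (ce≡1 : c * e ≡ 1#) {B : ℤ} (excess≤B : ∀ w → Excess.excess ce≡1 n w ℤ.≤ B) where

    private
      cs : Vec F (suc n)
      cs = coefficients c n

      𝟙C : Vec F (suc n) → ℤ
      𝟙C ξ = 𝟙 (form cs ξ ≟ 0#)

    orthogonal-cone : Vec F (suc n) → Vec F (suc n) → ℤ
    orthogonal-cone x y = ∑[ ξ ← V ] (𝟙C ξ ℤ.* 𝟙 (y · ξ ≟ x · ξ))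

    ·-difference : ∀ {d} (x y ξ : Vec F d) → (y +ᵛ -ᵛ x) · ξ + x · ξ ≡ y · ξ
    ·-difference []      []      []      = +-identityˡ 0#
    ·-difference (a ∷ x) (b ∷ y) (z ∷ ξ) = begin
      ((b + - a) * z + (y +ᵛ -ᵛ x) · ξ) + (a * z + x · ξ)
        ≡⟨ solve 6 (λ b m a z u v → ((b :+ m) :* z :+ u) :+ (a :* z :+ v) := (b :+ (m :+ a)) :* z :+ (u :+ v))
             refl b (- a) a z ((y +ᵛ -ᵛ x) · ξ) (x · ξ) ⟩
      (b + (- a + a)) * z + ((y +ᵛ -ᵛ x) · ξ + x · ξ)
        ≡⟨ cong₂ _+_ (cong (_* z) (trans (cong (b +_) (-‿inverseˡ a)) (+-identityʳ b))) (·-difference x y ξ) ⟩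
      b * z + y · ξ ∎
      where open ≡-Reasoning

    orthogonal-cone-≢ : ∀ {x y} → x ≢ y → orthogonal-cone x y ≡ isotropic⊥ cs (y +ᵛ -ᵛ x)
    orthogonal-cone-≢ {x} {y} x≢y = ∑-cong V λ ξ → cong (𝟙C ξ ℤ.*_)
      (𝟙-cong (y · ξ ≟ x · ξ) ((y +ᵛ -ᵛ x) · ξ ≟ 0#)
        (λ eq → +-cancelʳ (x · ξ) (trans (·-difference x y ξ) (trans eq (sym (+-identityˡ _)))))
        (λ eq → trans (sym (·-difference x y ξ)) (trans (cong (_+ x · ξ) eq) (+-identityˡ _))))

    orthogonal-cone-refl : ∀ x → orthogonal-cone x x ≡ represent cs 0#
    orthogonal-cone-refl x = ∑-cong V λ ξ →
      trans (cong (𝟙C ξ ℤ.*_) (𝟙-yes (x · ξ ≟ x · ξ) refl)) (ℤₚ.*-identityʳ (𝟙C ξ))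

    difference≢0 : ∀ {x y : Vec F (suc n)} → x ≢ y → y +ᵛ -ᵛ x ≢ 0ᵛ
    difference≢0 {x} {y} x≢y eq = x≢y (sym (trans (sym (+ᵛ-cancel x (-ᵛ x) y (+ᵛ-inverseˡ x)))
      (trans (cong (_+ᵛ x) eq) (0ᵛ+ᵛ x))))
      where
        0ᵛ+ᵛ : ∀ {d} (x : Vec F d) → 0ᵛ +ᵛ x ≡ x
        0ᵛ+ᵛ []      = refl
        0ᵛ+ᵛ (a ∷ x) = cong₂ _∷_ (+-identityˡ a) (0ᵛ+ᵛ x)

    -- For x ≠ y, `duality` at m = y - x gives exactly q - 1 times an excess. For x = y the left
    -- side is (q - 1) r(0) with r(0) = q^n plus the excess at 0, so the same B serves and the
    -- diagonal pays an additional q^n.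
    orthogonal-cone≤ : ∀ x y → Q ℤ.* orthogonal-cone x y ℤ.- represent cs 0# ℤ.≤
      (Q ℤ.- 1ℤ) ℤ.* (Q ℤ.^ n ℤ.* 𝟙 (x ≟ᵛ y) ℤ.+ B)
    orthogonal-cone≤ x y with x ≟ᵛ y
    ... | yes refl = begin
      Q ℤ.* orthogonal-cone x x ℤ.- represent cs 0#
        ≡⟨ cong (λ z → Q ℤ.* z ℤ.- represent cs 0#) (orthogonal-cone-refl x) ⟩
      Q ℤ.* represent cs 0# ℤ.- represent cs 0#
        ≡⟨ split Q (Q ℤ.^ n) (represent cs 0#) ⟩
      (Q ℤ.- 1ℤ) ℤ.* (Q ℤ.^ n ℤ.* 1ℤ ℤ.+ (represent cs 0# ℤ.- Q ℤ.^ n))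
        ≤⟨ *-monoˡ (ℤₚ.<⇒≤ Q-1>0) (ℤₚ.+-monoʳ-≤ (Q ℤ.^ n ℤ.* 1ℤ) (excess≤B 0#)) ⟩
      (Q ℤ.- 1ℤ) ℤ.* (Q ℤ.^ n ℤ.* 1ℤ ℤ.+ B) ∎
      where
        open ℤₚ.≤-Reasoning
        split : ∀ a p r → a ℤ.* r ℤ.- r ≡ (a ℤ.- 1ℤ) ℤ.* (p ℤ.* 1ℤ ℤ.+ (r ℤ.- p))
        split = ℤSolver.solve-∀
    ... | no x≢y = begin
      Q ℤ.* orthogonal-cone x y ℤ.- represent cs 0#
        ≡⟨ cong (λ z → Q ℤ.* z ℤ.- represent cs 0#) (orthogonal-cone-≢ x≢y) ⟩
      Q ℤ.* isotropic⊥ cs (y +ᵛ -ᵛ x) ℤ.- represent cs 0#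
        ≡⟨ duality (coefficients-inverses ce≡1 n) (difference≢0 x≢y) ⟩
      (Q ℤ.- 1ℤ) ℤ.* Excess.excess ce≡1 n (form (coefficients e n) (y +ᵛ -ᵛ x))
        ≤⟨ *-monoˡ (ℤₚ.<⇒≤ Q-1>0) (excess≤B _) ⟩
      (Q ℤ.- 1ℤ) ℤ.* B
        ≡⟨ cong ((Q ℤ.- 1ℤ) ℤ.*_) (sym (trans (cong (ℤ._+ B) (ℤₚ.*-zeroʳ (Q ℤ.^ n))) (ℤₚ.+-identityˡ B))) ⟩
      (Q ℤ.- 1ℤ) ℤ.* (Q ℤ.^ n ℤ.* 0ℤ ℤ.+ B) ∎
      where open ℤₚ.≤-Reasoning

    -- The first term comes from the |E| diagonal pairs and the second from all |E|² pairs; after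
    -- division by |E|² they become the two terms of the theorem.
    bound : ℤ
    bound = Q ℤ.^ n ℤ.* M ℤ.+ B ℤ.* (M ℤ.* M)

    ∑-cone-deviation≤ : ∑[ ξ ← V ] (𝟙C ξ ℤ.* deviation ξ) ℤ.≤ (Q ℤ.- 1ℤ) ℤ.* bound
    ∑-cone-deviation≤ = begin
      ∑[ ξ ← V ] (𝟙C ξ ℤ.* deviation ξ)
        ≡⟨ ∑-cong V (λ ξ → trans (cong (𝟙C ξ ℤ.*_) (deviation-pairs ξ))
             (trans (sym (∑-*ˡ V (𝟙C ξ) (λ x → ∑[ y ← V ] (p x y ℤ.* (Q ℤ.* 𝟙 (y · ξ ≟ x · ξ) ℤ.- 1ℤ)))))
               (∑-cong V λ x → sym (∑-*ˡ V (𝟙C ξ) (λ y → p x y ℤ.* (Q ℤ.* 𝟙 (y · ξ ≟ x · ξ) ℤ.- 1ℤ)))))) ⟩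
      ∑[ ξ ← V ] ∑[ x ← V ] ∑[ y ← V ] (𝟙C ξ ℤ.* (p x y ℤ.* (Q ℤ.* 𝟙 (y · ξ ≟ x · ξ) ℤ.- 1ℤ)))
        ≡⟨ trans (∑-swap V V _) (∑-cong V λ x → ∑-swap V V _) ⟩
      ∑[ x ← V ] ∑[ y ← V ] ∑[ ξ ← V ] (𝟙C ξ ℤ.* (p x y ℤ.* (Q ℤ.* 𝟙 (y · ξ ≟ x · ξ) ℤ.- 1ℤ)))
        ≡⟨ ∑-cong V (λ x → ∑-cong V λ y → inner x y) ⟩
      ∑[ x ← V ] ∑[ y ← V ] (p x y ℤ.* (Q ℤ.* orthogonal-cone x y ℤ.- represent cs 0#))
        ≤⟨ ∑-mono′ V (λ x → ∑-mono′ V λ y →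
             *-monoˡ (*-nonneg (𝟙-nonneg (E? x)) (𝟙-nonneg (E? y))) (orthogonal-cone≤ x y)) ⟩
      ∑[ x ← V ] ∑[ y ← V ] (p x y ℤ.* ((Q ℤ.- 1ℤ) ℤ.* (Q ℤ.^ n ℤ.* 𝟙 (x ≟ᵛ y) ℤ.+ B)))
        ≡⟨ ∑-cong V (λ x → ∑-cong V λ y → expand Q (Q ℤ.^ n) (𝟙E x) (𝟙E y) (𝟙 (x ≟ᵛ y)) B) ⟩
      -- The diagonal part has its indicator in front, so the sum over y collapses to y = x, where
      -- the product of the two indicators of E is a single one.
      ∑[ x ← V ] ∑[ y ← V ] (𝟙 (x ≟ᵛ y) ℤ.* ((Q ℤ.- 1ℤ) ℤ.* Q ℤ.^ n ℤ.* (𝟙E x ℤ.* 𝟙E y)) ℤ.+ p x y ℤ.* ((Q ℤ.- 1ℤ) ℤ.* B))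
        ≡⟨ trans (∑-cong V λ x → trans
               (∑-+ V (λ y → 𝟙 (x ≟ᵛ y) ℤ.* ((Q ℤ.- 1ℤ) ℤ.* Q ℤ.^ n ℤ.* (𝟙E x ℤ.* 𝟙E y))) (λ y → p x y ℤ.* ((Q ℤ.- 1ℤ) ℤ.* B)))
               (cong (ℤ._+ ∑[ y ← V ] (p x y ℤ.* ((Q ℤ.- 1ℤ) ℤ.* B)))
                 (trans (Vectors.∑-pick x (λ y → (Q ℤ.- 1ℤ) ℤ.* Q ℤ.^ n ℤ.* (𝟙E x ℤ.* 𝟙E y)))
                   (cong ((Q ℤ.- 1ℤ) ℤ.* Q ℤ.^ n ℤ.*_) (𝟙-idem (E? x))))))
             (∑-+ V (λ x → (Q ℤ.- 1ℤ) ℤ.* Q ℤ.^ n ℤ.* 𝟙E x) (λ x → ∑[ y ← V ] (p x y ℤ.* ((Q ℤ.- 1ℤ) ℤ.* B)))) ⟩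
      ∑[ x ← V ] ((Q ℤ.- 1ℤ) ℤ.* Q ℤ.^ n ℤ.* 𝟙E x) ℤ.+ ∑[ x ← V ] ∑[ y ← V ] (p x y ℤ.* ((Q ℤ.- 1ℤ) ℤ.* B))
        ≡⟨ cong₂ ℤ._+_
             (trans (∑-*ˡ V ((Q ℤ.- 1ℤ) ℤ.* Q ℤ.^ n) 𝟙E) (cong ((Q ℤ.- 1ℤ) ℤ.* Q ℤ.^ n ℤ.*_) (sym M≡∑)))
             (∑-pairs-factor ((Q ℤ.- 1ℤ) ℤ.* B)) ⟩
      (Q ℤ.- 1ℤ) ℤ.* Q ℤ.^ n ℤ.* M ℤ.+ M ℤ.* M ℤ.* ((Q ℤ.- 1ℤ) ℤ.* B)
        ≡⟨ collect (Q ℤ.- 1ℤ) (Q ℤ.^ n) M B ⟩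
      (Q ℤ.- 1ℤ) ℤ.* bound ∎
      where
        open ℤₚ.≤-Reasoning
        p : Vec F (suc n) → Vec F (suc n) → ℤ
        p x y = 𝟙E x ℤ.* 𝟙E y
        distribute : ∀ a p r t → a ℤ.* (p ℤ.* (r ℤ.* t ℤ.- 1ℤ)) ≡ p ℤ.* (r ℤ.* (a ℤ.* t) ℤ.- a)
        distribute = ℤSolver.solve-∀
        inner : ∀ x y → ∑[ ξ ← V ] (𝟙C ξ ℤ.* (p x y ℤ.* (Q ℤ.* 𝟙 (y · ξ ≟ x · ξ) ℤ.- 1ℤ))) ≡
          p x y ℤ.* (Q ℤ.* orthogonal-cone x y ℤ.- represent cs 0#)
        inner x y = trans
          (∑-cong V λ ξ → distribute (𝟙C ξ) (p x y) Q (𝟙 (y · ξ ≟ x · ξ)))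
          (trans (∑-*ˡ V (p x y) (λ ξ → Q ℤ.* (𝟙C ξ ℤ.* 𝟙 (y · ξ ≟ x · ξ)) ℤ.- 𝟙C ξ))
            (cong (p x y ℤ.*_) (trans (∑-- V (λ ξ → Q ℤ.* (𝟙C ξ ℤ.* 𝟙 (y · ξ ≟ x · ξ))) 𝟙C)
              (cong (ℤ._- represent cs 0#) (∑-*ˡ V Q (λ ξ → 𝟙C ξ ℤ.* 𝟙 (y · ξ ≟ x · ξ)))))))
        expand : ∀ a b x y t B → x ℤ.* y ℤ.* ((a ℤ.- 1ℤ) ℤ.* (b ℤ.* t ℤ.+ B)) ≡
          t ℤ.* ((a ℤ.- 1ℤ) ℤ.* b ℤ.* (x ℤ.* y)) ℤ.+ x ℤ.* y ℤ.* ((a ℤ.- 1ℤ) ℤ.* B)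
        expand = ℤSolver.solve-∀
        collect : ∀ a b m B → a ℤ.* b ℤ.* m ℤ.+ m ℤ.* m ℤ.* (a ℤ.* B) ≡ a ℤ.* (b ℤ.* m ℤ.+ B ℤ.* (m ℤ.* m))
        collect = ℤSolver.solve-∀

    last-∙ᵛ : ∀ {d} s (ξ : Vec F (suc d)) → last (s ∙ᵛ ξ) ≡ s * last ξ
    last-∙ᵛ s (x ∷ [])    = refl
    last-∙ᵛ s (x ∷ y ∷ ξ) = last-∙ᵛ s (y ∷ ξ)

    OnSlice : F → Pred (Vec F (suc n)) 0ℓ
    OnSlice l ξ = last ξ ≡ l × form cs ξ ≡ 0#

    onSlice? : ∀ l → Decidable (OnSlice l)
    onSlice? l ξ = (last ξ ≟ l) ×-dec (form cs ξ ≟ 0#)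

    private
      weight : Vec F (suc n) → ℤ
      weight ξ = 𝟙C ξ ℤ.* deviation ξ

      slice : F → ℤ
      slice l = ∑[ ξ ← V ] (𝟙 (last ξ ≟ l) ℤ.* weight ξ)

      weight-nonneg : ∀ ξ → 0ℤ ℤ.≤ weight ξ
      weight-nonneg ξ = *-nonneg (𝟙-nonneg (form cs ξ ≟ 0#)) (deviation-nonneg ξ)

    slice-scale : ∀ {s} → s ≢ 0# → ∀ l → slice (l * s) ≡ slice l
    slice-scale {s} s≢0 l = trans
      (sym (∑-reindex-∙ᵛ s≢0 (λ ξ → 𝟙 (last ξ ≟ l * s) ℤ.* weight ξ)))
      (∑-cong V λ ξ → cong₂ ℤ._*_
        (𝟙-cong (last (s ∙ᵛ ξ) ≟ l * s) (last ξ ≟ l)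
          (λ eq → *-cancelˡ s≢0 (trans (sym (last-∙ᵛ s ξ)) (trans eq (*-comm l s))))
          (λ eq → trans (last-∙ᵛ s ξ) (trans (cong (s *_) eq) (*-comm s l))))
        (cong₂ ℤ._*_
          (𝟙-cong (form cs (s ∙ᵛ ξ) ≟ 0#) (form cs ξ ≟ 0#)
            (λ eq → x*y≡0⇒y≡0 (*-≢0 s≢0 s≢0) (trans (sym (form-∙ᵛ s cs ξ)) eq))
            (λ eq → trans (form-∙ᵛ s cs ξ) (trans (cong (s * s *_) eq) (zeroʳ (s * s)))))
          (deviation-∙ᵛ s≢0 ξ)))

    -- Scaling permutes the slices of the cone by the q - 1 hyperplanes x_d = l s with s ≠ 0.
    slice≤ : ∀ {l} → l ≢ 0# → (Q ℤ.- 1ℤ) ℤ.* slice l ℤ.≤ ∑ V weight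
    slice≤ {l} l≢0 = begin
      (Q ℤ.- 1ℤ) ℤ.* slice l
        ≡⟨ expand Q (slice l) ⟩
      Q ℤ.* slice l ℤ.- slice l
        ≡⟨ sym (trans (∑-- elements (λ _ → slice l) (λ s → 𝟙 (0# ≟ s) ℤ.* slice l))
             (cong₂ ℤ._-_ (∑-const-elements (slice l)) (∑-pick 0# (λ _ → slice l)))) ⟩
      ∑[ s ← elements ] (slice l ℤ.- 𝟙 (0# ≟ s) ℤ.* slice l)
        ≤⟨ ∑-mono′ elements compare ⟩
      ∑[ s ← elements ] slice (l * s)
        ≡⟨ ∑-swap elements V (λ s ξ → 𝟙 (last ξ ≟ l * s) ℤ.* weight ξ) ⟩
      ∑[ ξ ← V ] ∑[ s ← elements ] (𝟙 (last ξ ≟ l * s) ℤ.* weight ξ)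
        ≡⟨ ∑-cong V (λ ξ → trans (∑-*ʳ elements (λ s → 𝟙 (last ξ ≟ l * s)) (weight ξ))
             (trans (cong (ℤ._* weight ξ) (one (last ξ))) (ℤₚ.*-identityˡ (weight ξ)))) ⟩
      ∑ V weight ∎
      where
        open ℤₚ.≤-Reasoning
        expand : ∀ a b → (a ℤ.- 1ℤ) ℤ.* b ≡ a ℤ.* b ℤ.- b
        expand = ℤSolver.solve-∀
        one : ∀ t → ∑[ s ← elements ] 𝟙 (t ≟ l * s) ≡ 1ℤ
        one t = trans (∑-cong elements λ s → 𝟙-cong (t ≟ l * s) (l * s + 0# ≟ t)
            (λ eq → trans (+-identityʳ (l * s)) (sym eq)) (λ eq → trans (sym eq) (+-identityʳ (l * s))))
          (∑-𝟙-linear l≢0 0# t)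
        compare : ∀ s → slice l ℤ.- 𝟙 (0# ≟ s) ℤ.* slice l ℤ.≤ slice (l * s)
        compare s with 0# ≟ s
        -- For s = 0 the right side is the part of the cone at height 0, which is no scaled copy of
        -- the slice; it is discarded because its weights are nonnegative.
        ... | yes _  = subst (ℤ._≤ slice (l * s))
          (sym (trans (cong (λ t → slice l ℤ.- t) (ℤₚ.*-identityˡ (slice l))) (ℤₚ.+-inverseʳ (slice l))))
          (∑-nonneg V λ ξ → *-nonneg (𝟙-nonneg (last ξ ≟ l * s)) (weight-nonneg ξ))
        ... | no 0≢s = ℤₚ.≤-reflexive (trans (ℤₚ.+-identityʳ (slice l)) (sym (slice-scale (0≢s ∘ sym) l)))

    ∑-slice-deviation≤ : ∀ {l} → l ≢ 0# → ∀ {ws} → Unique ws → All (OnSlice l) ws → ∑ ws deviation ℤ.≤ bound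
    ∑-slice-deviation≤ {l} l≢0 {ws} u ps = ℤₚ.*-cancelˡ-≤-pos _ _ (Q ℤ.- 1ℤ) (begin
      (Q ℤ.- 1ℤ) ℤ.* ∑ ws deviation
        ≤⟨ *-monoˡ (ℤₚ.<⇒≤ Q-1>0) (Vectors.∑-unique≤ (onSlice? l) deviation-nonneg u ps) ⟩
      (Q ℤ.- 1ℤ) ℤ.* ∑[ ξ ← V ] (𝟙 (onSlice? l ξ) ℤ.* deviation ξ)
        ≡⟨ cong ((Q ℤ.- 1ℤ) ℤ.*_) (∑-cong V λ ξ → trans
             (cong (ℤ._* deviation ξ) (sym (𝟙-× (last ξ ≟ l) (form cs ξ ≟ 0#) (onSlice? l ξ))))
             (ℤₚ.*-assoc (𝟙 (last ξ ≟ l)) (𝟙C ξ) (deviation ξ))) ⟩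
      (Q ℤ.- 1ℤ) ℤ.* slice l    ≤⟨ slice≤ l≢0 ⟩
      ∑ V weight                ≤⟨ ∑-cone-deviation≤ ⟩
      (Q ℤ.- 1ℤ) ℤ.* bound      ∎)
      where open ℤₚ.≤-Reasoning

  -- Values of x · w on E and cosets of the orthogonal complement.

  Occurs : Vec F (suc n) → Pred F 0ℓ
  Occurs w t = Any.Any (λ x → E x × x · w ≡ t) V

  occurs? : ∀ w → Decidable (Occurs w)
  occurs? w t = Any.any? (λ x → E? x ×-dec (x · w ≟ t)) V

  values : Vec F (suc n) → List F
  values w = filter (occurs? w) elements

  -- Cauchy-Schwarz against the indicator of the occurring values: fibres vanish off these values,
  -- so the mixed sum is still |E|, while the sum of the squared indicator is the number of values.
  M²≤values*energy : ∀ w → M ℤ.* M ℤ.≤ ℤ.+ length (values w) ℤ.* energy w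
  M²≤values*energy w = begin
    M ℤ.* M
      ≡⟨ cong (λ s → s ℤ.* s) (sym (trans (∑-cong elements supported) (∑-fibre w))) ⟩
    ∑[ t ← elements ] (u t ℤ.* fibre w t) ℤ.* ∑[ t ← elements ] (u t ℤ.* fibre w t)
      ≤⟨ cauchy-schwarz elements u (fibre w) ⟩
    ∑[ t ← elements ] (u t ℤ.* u t) ℤ.* energy w
      ≡⟨ cong (ℤ._* energy w) (trans (∑-cong elements λ t → 𝟙-idem (occurs? w t)) (sym (length-filter≡∑ (occurs? w) elements))) ⟩
    ℤ.+ length (values w) ℤ.* energy w ∎
    where
      open ℤₚ.≤-Reasoning
      u : F → ℤ
      u t = 𝟙 (occurs? w t)
      supported : ∀ t → u t ℤ.* fibre w t ≡ fibre w t
      supported t with occurs? w t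
      ... | yes _ = ℤₚ.*-identityˡ (fibre w t)
      ... | no ¬p = sym (trans (∑-cong V λ x → trans (𝟙-× (x · w ≟ t) (E? x) ((x · w ≟ t) ×-dec E? x))
              (𝟙-no ((x · w ≟ t) ×-dec E? x) λ (eq , Ex) → ¬p (lose (∈-vectors x) (Ex , eq)))) (∑-zero V))

  level : Vec F (suc n) → F → Pred (Vec F (suc n)) 0ℓ
  level w t z = z · w ≡ t

  -- A point of E at level t lies on no other level, so it separates the two level sets.
  levels-unique : ∀ w {ts} → Unique ts → All (Occurs w) ts →
    UniqueSetoid.Unique (≐-setoid (Vec F (suc n)) 0ℓ) (List.map (level w) ts)
  levels-unique w []       []         = []
  levels-unique w (ps ∷ u) (occ ∷ os) with Any.satisfied occ
  ... | z , _ , zw≡t = Allₚ.map⁺ (All.map (λ t≢t′ eq → t≢t′ (trans (sym zw≡t) (proj₁ eq {z} zw≡t))) ps) ∷ levels-unique w u os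

  Generates : Vec F (suc n) → Subspace (suc n) → Set
  Generates w V = ⟦ V ⟧ ≐ λ y → ∃ λ c → y ≡ c ∙ᵛ w

  -- y · w = z · w says that y - z is orthogonal to w, hence to every multiple of w, so the level
  -- set through a point z of E is z + V^⊥.
  level-coset : ∀ {w V t} → Generates w V → Occurs w t → level w t ∈ π[ V ] E
  level-coset {w} {V} {t} gen occ with Any.satisfied occ
  ... | z , Ez , zw≡t = z , (to , from) , z , (0ᵛ , ⊥-0ᵛ , sym (+ᵛ-0ᵛ z)) , Ez
    where
      +ᵛ-0ᵛ : ∀ {d} (z : Vec F d) → z +ᵛ 0ᵛ ≡ z
      +ᵛ-0ᵛ []      = refl
      +ᵛ-0ᵛ (a ∷ z) = cong₂ _∷_ (+-identityʳ a) (+ᵛ-0ᵛ z)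
      0ᵛ-· : ∀ {d} (y : Vec F d) → 0ᵛ · y ≡ 0#
      0ᵛ-· []      = refl
      0ᵛ-· (b ∷ y) = trans (cong (0# * b +_) (0ᵛ-· y)) (trans (+-identityʳ _) (zeroˡ b))
      ⊥-0ᵛ : 0ᵛ ∈ (V ⊥ᵛ)
      ⊥-0ᵛ y _ = 0ᵛ-· y
      +ᵛ-difference : ∀ {d} (z y : Vec F d) → y ≡ z +ᵛ (y +ᵛ -ᵛ z)
      +ᵛ-difference []      []      = refl
      +ᵛ-difference (a ∷ z) (b ∷ y) = cong₂ _∷_
        (sym (trans (solve 3 (λ a b m → a :+ (b :+ m) := b :+ (a :+ m)) refl a b (- a))
          (trans (cong (b +_) (-‿inverseʳ a)) (+-identityʳ b))))
        (+ᵛ-difference z y)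
      ·-+ᵛ : ∀ {d} (z u w : Vec F d) → (z +ᵛ u) · w ≡ z · w + u · w
      ·-+ᵛ []      []      []      = sym (+-identityˡ 0#)
      ·-+ᵛ (a ∷ z) (b ∷ u) (x ∷ w) = trans (cong ((a + b) * x +_) (·-+ᵛ z u w))
        (solve 5 (λ a b x p r → (a :+ b) :* x :+ (p :+ r) := (a :* x :+ p) :+ (b :* x :+ r)) refl a b x (z · w) (u · w))
      1∙ᵛ : ∀ {d} (w : Vec F d) → w ≡ 1# ∙ᵛ w
      1∙ᵛ []      = refl
      1∙ᵛ (x ∷ w) = cong₂ _∷_ (sym (*-identityˡ x)) (1∙ᵛ w)
      to : ∀ {y} → level w t y → (z +ᶜ (V ⊥ᵛ)) y
      to {y} yw≡t = y +ᵛ -ᵛ z , orth , +ᵛ-difference z y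
        where
          orth-w : (y +ᵛ -ᵛ z) · w ≡ 0#
          orth-w = +-cancelˡ (z · w) (begin
            z · w + (y +ᵛ -ᵛ z) · w    ≡⟨ sym (·-+ᵛ z (y +ᵛ -ᵛ z) w) ⟩
            (z +ᵛ (y +ᵛ -ᵛ z)) · w     ≡⟨ cong (_· w) (sym (+ᵛ-difference z y)) ⟩
            y · w                      ≡⟨ trans yw≡t (sym zw≡t) ⟩
            z · w                      ≡⟨ sym (+-identityʳ (z · w)) ⟩
            z · w + 0#                 ∎)
            where open ≡-Reasoning
          orth : y +ᵛ -ᵛ z ∈ (V ⊥ᵛ)
          orth v v∈V with proj₁ gen v∈V
          ... | k , refl = trans (·-∙ᵛ (y +ᵛ -ᵛ z) k w) (trans (cong (k *_) orth-w) (zeroʳ k))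
      from : ∀ {y} → (z +ᶜ (V ⊥ᵛ)) y → level w t y
      from (u , u⊥V , refl) = trans (·-+ᵛ z u w)
        (trans (cong₂ _+_ zw≡t (u⊥V w (proj₂ gen (1# , 1∙ᵛ w)))) (+-identityʳ t))

  -- The bound on π_V(E) is applied to the list of level sets, one for each occurring value.
  values≤ : ∀ {w V N} → Generates w V → AtMost (≐-setoid (Vec F (suc n)) 0ℓ) (π[ V ] E) N →
    fromℕ (length (values w)) ≤ℝ N
  values≤ {w} {V} {N} gen atMost = subst (λ m → fromℕ m ≤ℝ N) (Listₚ.length-map (level w) (values w))
    (atMost (List.map (level w) (values w)) (levels-unique w (Uniqueₚ.filter⁺ (occurs? w) elements-unique) occ)
      (Allₚ.map⁺ (All.map (level-coset {V = V} gen) occ)))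
    where
      occ : All (Occurs w) (values w)
      occ = Allₚ.all-filter (occurs? w) elements

-- From an integer inequality to the real bound.

module RealBound where

  ι : ℤ → ℚ
  ι z = z ℚ./ 1

  toℚᵘ-ι : ∀ z → ℚ.toℚᵘ (ι z) ℚᵘ.≃ ℚᵘ.mkℚᵘ z 0
  toℚᵘ-ι z = ℚₚ.toℚᵘ-fromℚᵘ (ℚᵘ.mkℚᵘ z 0)

  ι-+ : ∀ a b → ι (a ℤ.+ b) ≡ ι a ℚ.+ ι b
  ι-+ a b = ℚₚ.toℚᵘ-injective (begin
    ℚ.toℚᵘ (ι (a ℤ.+ b))                     ≈⟨ toℚᵘ-ι (a ℤ.+ b) ⟩
    ℚᵘ.mkℚᵘ (a ℤ.+ b) 0                      ≈⟨ ℚᵘ.*≡* (cong (ℤ._* 1ℤ) (cong₂ ℤ._+_ (sym (ℤₚ.*-identityʳ a)) (sym (ℤₚ.*-identityʳ b)))) ⟩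
    ℚᵘ.mkℚᵘ a 0 ℚᵘ.+ ℚᵘ.mkℚᵘ b 0             ≈⟨ ℚᵘₚ.+-cong (ℚᵘₚ.≃-sym (toℚᵘ-ι a)) (ℚᵘₚ.≃-sym (toℚᵘ-ι b)) ⟩
    ℚ.toℚᵘ (ι a) ℚᵘ.+ ℚ.toℚᵘ (ι b)           ≈⟨ ℚᵘₚ.≃-sym (ℚₚ.toℚᵘ-homo-+ (ι a) (ι b)) ⟩
    ℚ.toℚᵘ (ι a ℚ.+ ι b)                     ∎)
    where open ℚᵘₚ.≃-Reasoning

  ι-* : ∀ a b → ι (a ℤ.* b) ≡ ι a ℚ.* ι b
  ι-* a b = ℚₚ.toℚᵘ-injective (begin
    ℚ.toℚᵘ (ι (a ℤ.* b))                     ≈⟨ toℚᵘ-ι (a ℤ.* b) ⟩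
    ℚᵘ.mkℚᵘ a 0 ℚᵘ.* ℚᵘ.mkℚᵘ b 0             ≈⟨ ℚᵘₚ.*-cong (ℚᵘₚ.≃-sym (toℚᵘ-ι a)) (ℚᵘₚ.≃-sym (toℚᵘ-ι b)) ⟩
    ℚ.toℚᵘ (ι a) ℚᵘ.* ℚ.toℚᵘ (ι b)           ≈⟨ ℚᵘₚ.≃-sym (ℚₚ.toℚᵘ-homo-* (ι a) (ι b)) ⟩
    ℚ.toℚᵘ (ι a ℚ.* ι b)                     ∎)
    where open ℚᵘₚ.≃-Reasoning

  ι-neg : ∀ a → ι (ℤ.- a) ≡ ℚ.- ι a
  ι-neg a = ℚₚ.toℚᵘ-injective (begin
    ℚ.toℚᵘ (ι (ℤ.- a))        ≈⟨ toℚᵘ-ι (ℤ.- a) ⟩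
    ℚᵘ.- ℚᵘ.mkℚᵘ a 0          ≈⟨ ℚᵘₚ.-‿cong (ℚᵘₚ.≃-sym (toℚᵘ-ι a)) ⟩
    ℚᵘ.- ℚ.toℚᵘ (ι a)         ≈⟨ ℚᵘₚ.≃-sym (ℚₚ.toℚᵘ-homo‿- (ι a)) ⟩
    ℚ.toℚᵘ (ℚ.- ι a)          ∎)
    where open ℚᵘₚ.≃-Reasoning

  ι-mono : ∀ {a b} → a ℤ.≤ b → ι a ℚ.≤ ι b
  ι-mono {a} {b} a≤b = ℚₚ.toℚᵘ-cancel-≤ (ℚᵘₚ.≤-trans
    (ℚᵘₚ.≤-reflexive (toℚᵘ-ι a))
    (ℚᵘₚ.≤-trans (ℚᵘ.*≤* (ℤₚ.*-monoʳ-≤-nonNeg 1ℤ a≤b)) (ℚᵘₚ.≤-reflexive (ℚᵘₚ.≃-sym (toℚᵘ-ι b)))))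

  ι-pos : ∀ {n} → 0 ℕ.< n → 0ℚ ℚ.< ι (ℤ.+ n)
  ι-pos {n} 0<n = ℚₚ.<-≤-trans (ℚₚ.positive⁻¹ 1ℚ) (ι-mono (ℤ.+≤+ 0<n))

  *-pos : ∀ {a b} → 0ℚ ℚ.< a → 0ℚ ℚ.< b → 0ℚ ℚ.< a ℚ.* b
  *-pos {a} {b} 0<a 0<b = ℚₚ.positive⁻¹ (a ℚ.* b)
    {{ℚₚ.pos*pos⇒pos a {{ℚ.positive 0<a}} b {{ℚ.positive 0<b}}}}

  *-mono-≤ʳ : ∀ {c a b} → 0ℚ ℚ.≤ c → a ℚ.≤ b → a ℚ.* c ℚ.≤ b ℚ.* c
  *-mono-≤ʳ {c} 0≤c = ℚₚ.*-monoʳ-≤-nonNeg c {{ℚ.nonNegative 0≤c}}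

  rational-bound : ∀ L P B e Q x m {ε ε′ W} →
    let g = Q ℚ.- x in
    0ℚ ℚ.< g → 0ℚ ℚ.< e → 0ℚ ℚ.≤ W →
    W ≡ P ℚ.* e ℚ.+ B ℚ.* (e ℚ.* e) ℚ.+ L ℚ.* (e ℚ.* e) →
    L ℚ.* (Q ℚ.* (e ℚ.* e)) ℚ.≤ m ℚ.* W →
    m ℚ.≤ x ℚ.+ ε′ → ε′ ℚ.* W ℚ.≤ ε ℚ.* (g ℚ.* (e ℚ.* e)) →
    L ℚ.≤ x ℚ.* P ℚ.* recip (g ℚ.* e) ℚ.+ x ℚ.* B ℚ.* recip g ℚ.+ ε
  rational-bound L P B e Q x m {ε} {ε′} {W} g>0 e>0 W≥0 W≡ key m≤x+ε′ small =
    ℚₚ.*-cancelʳ-≤-pos gee {{ℚ.positive (*-pos g>0 (*-pos e>0 e>0))}} (begin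
      L ℚ.* gee
        ≡⟨ solve 4 (λ L Q x e → L :* ((Q :- x) :* (e :* e)) := L :* (Q :* (e :* e)) :- x :* (L :* (e :* e))) refl L Q x e ⟩
      L ℚ.* (Q ℚ.* (e ℚ.* e)) ℚ.- x ℚ.* (L ℚ.* (e ℚ.* e))
        ≤⟨ ℚₚ.+-monoˡ-≤ (ℚ.- (x ℚ.* (L ℚ.* (e ℚ.* e)))) (ℚₚ.≤-trans key (*-mono-≤ʳ W≥0 m≤x+ε′)) ⟩
      (x ℚ.+ ε′) ℚ.* W ℚ.- x ℚ.* (L ℚ.* (e ℚ.* e))
        ≡⟨ solve 4 (λ x ε′ W t → (x :+ ε′) :* W :- x :* t := x :* W :- x :* t :+ ε′ :* W) refl x ε′ W (L ℚ.* (e ℚ.* e)) ⟩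
      x ℚ.* W ℚ.- x ℚ.* (L ℚ.* (e ℚ.* e)) ℚ.+ ε′ ℚ.* W
        ≤⟨ ℚₚ.+-monoʳ-≤ (x ℚ.* W ℚ.- x ℚ.* (L ℚ.* (e ℚ.* e))) small ⟩
      x ℚ.* W ℚ.- x ℚ.* (L ℚ.* (e ℚ.* e)) ℚ.+ ε ℚ.* gee
        ≡⟨ cong (λ w → x ℚ.* w ℚ.- x ℚ.* (L ℚ.* (e ℚ.* e)) ℚ.+ ε ℚ.* gee) W≡ ⟩
      x ℚ.* (P ℚ.* e ℚ.+ B ℚ.* (e ℚ.* e) ℚ.+ L ℚ.* (e ℚ.* e)) ℚ.- x ℚ.* (L ℚ.* (e ℚ.* e)) ℚ.+ ε ℚ.* gee
        ≡⟨ solve 6 (λ x P B L e t → x :* (P :* e :+ B :* (e :* e) :+ L :* (e :* e)) :- x :* (L :* (e :* e)) :+ t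
             := x :* P :* e :* con 1ℚ :+ x :* B :* (e :* e) :* con 1ℚ :+ t) refl x P B L e (ε ℚ.* gee) ⟩
      -- The two factors 1 are placeholders, about to be replaced by g e and g times their
      -- reciprocals.
      x ℚ.* P ℚ.* e ℚ.* 1ℚ ℚ.+ x ℚ.* B ℚ.* (e ℚ.* e) ℚ.* 1ℚ ℚ.+ ε ℚ.* gee
        ≡⟨ cong₂ (λ s t → x ℚ.* P ℚ.* e ℚ.* s ℚ.+ x ℚ.* B ℚ.* (e ℚ.* e) ℚ.* t ℚ.+ ε ℚ.* gee)
             (sym (recip-inverse (*-pos g>0 e>0))) (sym (recip-inverse g>0)) ⟩
      x ℚ.* P ℚ.* e ℚ.* (g ℚ.* e ℚ.* recip (g ℚ.* e)) ℚ.+ x ℚ.* B ℚ.* (e ℚ.* e) ℚ.* (g ℚ.* recip g) ℚ.+ ε ℚ.* gee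
        ≡⟨ solve 8 (λ x P B e g r s ε → x :* P :* e :* (g :* e :* r) :+ x :* B :* (e :* e) :* (g :* s) :+ ε :* (g :* (e :* e))
             := (x :* P :* r :+ x :* B :* s :+ ε) :* (g :* (e :* e))) refl x P B e g (recip (g ℚ.* e)) (recip g) ε ⟩
      (x ℚ.* P ℚ.* recip (g ℚ.* e) ℚ.+ x ℚ.* B ℚ.* recip g ℚ.+ ε) ℚ.* gee ∎)
    where
      open ℚₚ.≤-Reasoning
      open +-*-Solver
      g   = Q ℚ.- x
      gee = g ℚ.* (e ℚ.* e)

  -- At every late index the rational bound applies with x = `seq N k`. Y is any real whose terms
  -- are the constant B, so that a difference of two powers is covered as well as a single power.
  real-bound : ∀ {N q} (N<q : N <ℝ fromℕ q) {M} (0<M : 0 ℕ.< M) {L P m B} {Y : ℝ} →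
    let gap>0 = x<y⇒0<y-x {N} {fromℕ q} N<q
        den>0 = *ℝ-pos {fromℕ q -ℝ N} {fromℕ M} gap>0 (fromℕ-pos 0<M)
    in
    (∀ k → seq Y k ≡ ι B) → 0ℤ ℤ.≤ B → fromℕ m ≤ℝ N →
    ℤ.+ L ℤ.* (ℤ.+ q ℤ.* (ℤ.+ M ℤ.* ℤ.+ M)) ℤ.≤
      ℤ.+ m ℤ.* (ℤ.+ P ℤ.* ℤ.+ M ℤ.+ B ℤ.* (ℤ.+ M ℤ.* ℤ.+ M) ℤ.+ ℤ.+ L ℤ.* (ℤ.+ M ℤ.* ℤ.+ M)) →
    fromℕ L ≤ℝ (N *ℝ fromℕ P) /ℝ ((fromℕ q -ℝ N) *ℝ fromℕ M) [ den>0 ] +ℝ (N *ℝ Y) /ℝ (fromℕ q -ℝ N) [ gap>0 ]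
  real-bound {N} {q} (δ , δ>0 , K , N+δ≤q) {M} 0<M {L} {P} {m} {B} {Y} Y≡B B≥0 m≤N key ε ε>0 =
    K ℕ.⊔ K′ , λ k k≥ → let
        x     = seq N k
        δ≤gap = ℚₚ.≤-trans (ℚₚ.≤-reflexive (solve 2 (λ d x → d := x :+ d :- x) refl δ x))
                  (ℚₚ.+-monoˡ-≤ (ℚ.- x) (N+δ≤q k (ℕₚ.m⊔n≤o⇒m≤o K K′ k≥)))
      in subst (λ y → l ℚ.≤ x ℚ.* p ℚ.* recip ((ι (ℤ.+ q) ℚ.- x) ℚ.* e) ℚ.+ x ℚ.* y ℚ.* recip (ι (ℤ.+ q) ℚ.- x) ℚ.+ ε)
        (sym (Y≡B k))
        (rational-bound l p b e (ι (ℤ.+ q)) x (ι (ℤ.+ m)) (ℚₚ.<-≤-trans δ>0 δ≤gap) e>0 W≥0 W≡ key′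
          (m≤N+ε′ k (ℕₚ.m⊔n≤o⇒n≤o K K′ k≥))
          (ℚₚ.≤-trans small (ℚₚ.*-monoˡ-≤-nonNeg ε {{ℚ.nonNegative (ℚₚ.<⇒≤ ε>0)}} (*-mono-≤ʳ (ℚₚ.<⇒≤ ee>0) δ≤gap))))
    where
      open +-*-Solver
      l p b e W ε′ : ℚ
      l  = ι (ℤ.+ L)
      p  = ι (ℤ.+ P)
      b  = ι B
      e  = ι (ℤ.+ M)
      Wℤ = ℤ.+ P ℤ.* ℤ.+ M ℤ.+ B ℤ.* (ℤ.+ M ℤ.* ℤ.+ M) ℤ.+ ℤ.+ L ℤ.* (ℤ.+ M ℤ.* ℤ.+ M)
      W  = ι Wℤ
      e>0 : 0ℚ ℚ.< e
      e>0 = ι-pos 0<M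
      ee>0 : 0ℚ ℚ.< e ℚ.* e
      ee>0 = *-pos e>0 e>0
      nonneg : ∀ n → 0ℤ ℤ.≤ ℤ.+ n
      nonneg n = ℤ.+≤+ ℕ.z≤n
      M²≥0 : 0ℤ ℤ.≤ ℤ.+ M ℤ.* ℤ.+ M
      M²≥0 = *-nonneg (nonneg M) (nonneg M)
      W≥0 : 0ℚ ℚ.≤ W
      W≥0 = ι-mono (ℤₚ.+-mono-≤ (ℤₚ.+-mono-≤ (*-nonneg (nonneg P) (nonneg M)) (*-nonneg B≥0 M²≥0))
        (*-nonneg (nonneg L) M²≥0))
      ι-scaled-square : ∀ a → ι (a ℤ.* (ℤ.+ M ℤ.* ℤ.+ M)) ≡ ι a ℚ.* (e ℚ.* e)
      ι-scaled-square a = trans (ι-* a _) (cong (ι a ℚ.*_) (ι-* (ℤ.+ M) (ℤ.+ M)))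
      W≡ : W ≡ p ℚ.* e ℚ.+ b ℚ.* (e ℚ.* e) ℚ.+ l ℚ.* (e ℚ.* e)
      W≡ = trans (ι-+ (ℤ.+ P ℤ.* ℤ.+ M ℤ.+ B ℤ.* (ℤ.+ M ℤ.* ℤ.+ M)) (ℤ.+ L ℤ.* (ℤ.+ M ℤ.* ℤ.+ M)))
        (cong₂ ℚ._+_ (trans (ι-+ (ℤ.+ P ℤ.* ℤ.+ M) (B ℤ.* (ℤ.+ M ℤ.* ℤ.+ M)))
          (cong₂ ℚ._+_ (ι-* (ℤ.+ P) (ℤ.+ M)) (ι-scaled-square B))) (ι-scaled-square (ℤ.+ L)))
      key′ : l ℚ.* (ι (ℤ.+ q) ℚ.* (e ℚ.* e)) ℚ.≤ ι (ℤ.+ m) ℚ.* W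
      key′ = subst (ℚ._≤ ι (ℤ.+ m) ℚ.* W)
        (trans (ι-* (ℤ.+ L) (ℤ.+ q ℤ.* (ℤ.+ M ℤ.* ℤ.+ M))) (cong (l ℚ.*_) (ι-scaled-square (ℤ.+ q))))
        (subst (ι (ℤ.+ L ℤ.* (ℤ.+ q ℤ.* (ℤ.+ M ℤ.* ℤ.+ M))) ℚ.≤_) (ι-* (ℤ.+ m) Wℤ) (ι-mono key))
      W+1>0 : 0ℚ ℚ.< W ℚ.+ 1ℚ
      W+1>0 = ℚₚ.+-mono-≤-< W≥0 (ℚₚ.positive⁻¹ 1ℚ)
      -- Chosen so that ε′ W is at most ε δ e², hence at most ε (q - x) e², uniformly in the index.
      -- W is only known to be nonnegative, so W + 1 serves as divisor.
      ε′ = ε ℚ.* (δ ℚ.* (e ℚ.* e)) ℚ.* recip (W ℚ.+ 1ℚ)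
      ε′>0 : 0ℚ ℚ.< ε′
      ε′>0 = *-pos (*-pos ε>0 (*-pos δ>0 ee>0)) (recip-pos W+1>0)
      W≤W+1 : W ℚ.≤ W ℚ.+ 1ℚ
      W≤W+1 = ℚₚ.≤-trans (ℚₚ.≤-reflexive (sym (ℚₚ.+-identityʳ W))) (ℚₚ.+-monoʳ-≤ W (ℚₚ.<⇒≤ (ℚₚ.positive⁻¹ 1ℚ)))
      small : ε′ ℚ.* W ℚ.≤ ε ℚ.* (δ ℚ.* (e ℚ.* e))
      small = begin
        ε′ ℚ.* W                                          ≤⟨ ℚₚ.*-monoˡ-≤-nonNeg ε′ {{ℚ.nonNegative (ℚₚ.<⇒≤ ε′>0)}}
                                                               W≤W+1 ⟩
        ε′ ℚ.* (W ℚ.+ 1ℚ)                                 ≡⟨ solve 3 (λ a r w → a :* r :* w := a :* (w :* r)) refl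
                                                               (ε ℚ.* (δ ℚ.* (e ℚ.* e))) (recip (W ℚ.+ 1ℚ)) (W ℚ.+ 1ℚ) ⟩
        ε ℚ.* (δ ℚ.* (e ℚ.* e)) ℚ.* ((W ℚ.+ 1ℚ) ℚ.* recip (W ℚ.+ 1ℚ))
                                                          ≡⟨ cong (ε ℚ.* (δ ℚ.* (e ℚ.* e)) ℚ.*_) (recip-inverse W+1>0) ⟩
        ε ℚ.* (δ ℚ.* (e ℚ.* e)) ℚ.* 1ℚ                    ≡⟨ ℚₚ.*-identityʳ _ ⟩
        ε ℚ.* (δ ℚ.* (e ℚ.* e))                           ∎
        where open ℚₚ.≤-Reasoning
      K′ = proj₁ (m≤N ε′ ε′>0)
      m≤N+ε′ = proj₂ (m≤N ε′ ε′>0)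

  0≤ℝ : ∀ {N} → 0ℝ <ℝ N → fromℕ 0 ≤ℝ N
  0≤ℝ {N} (δ , δ>0 , K , h) ε ε>0 = K , λ k k≥ → begin
    0ℚ                ≤⟨ ℚₚ.<⇒≤ δ>0 ⟩
    δ                 ≡⟨ sym (ℚₚ.+-identityˡ δ) ⟩
    0ℚ ℚ.+ δ          ≤⟨ h k k≥ ⟩
    seq N k           ≡⟨ sym (ℚₚ.+-identityʳ (seq N k)) ⟩
    seq N k ℚ.+ 0ℚ    ≤⟨ ℚₚ.+-monoʳ-≤ (seq N k) (ℚₚ.<⇒≤ ε>0) ⟩
    seq N k ℚ.+ ε     ∎
    where open ℚₚ.≤-Reasoning

  -- The maximum is one of the values, so it inherits the bound by N, and for an empty list 0 does.
  -- The result is one natural number that can stand for N for all lines at once.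
  maximum≤ : ∀ {A : Set} (f : A → ℕ) {N} → 0ℝ <ℝ N → ∀ {xs} → All (λ x → fromℕ (f x) ≤ℝ N) xs →
    ∃ λ m → fromℕ m ≤ℝ N × All (λ x → f x ℕ.≤ m) xs
  maximum≤ f {N} N>0 []       = 0 , 0≤ℝ {N} N>0 , []
  maximum≤ f {N} N>0 {x ∷ _} (p ∷ ps) with maximum≤ f {N} N>0 ps
  ... | m , m≤N , bounds with ℕₚ.⊔-sel (f x) m
  ...   | inj₁ eq = f x ℕ.⊔ m , subst (λ k → fromℕ k ≤ℝ N) (sym eq) p ,
    ℕₚ.m≤m⊔n (f x) m ∷ All.map (λ le → ℕₚ.≤-trans le (ℕₚ.m≤n⊔m (f x) m)) bounds
  ...   | inj₂ eq = f x ℕ.⊔ m , subst (λ k → fromℕ k ≤ℝ N) (sym eq) m≤N ,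
    ℕₚ.m≤m⊔n (f x) m ∷ All.map (λ le → ℕₚ.≤-trans le (ℕₚ.m≤n⊔m (f x) m)) bounds

open RealBound

-- From lines to points of the slice, and the count of lines.

module Lines {q : ℕ} (𝔽 : FiniteField q) (q-odd : 2 ∤ q) {n : ℕ}
  {E : Pred (Vec (FiniteField.F 𝔽) (suc n)) 0ℓ} (E? : Decidable E) (l : FiniteField.F 𝔽) (N : ℝ) where
  open FiniteField 𝔽
  open FieldCounting 𝔽
  open OddOrder q-odd
  open Forms 𝔽 q-odd
  open Counts 𝔽 q-odd
  open Energy 𝔽 q-odd E?

  InT₁ : Subspace (suc n) → Set₁
  InT₁ = T₁ X[ hyperplane l ] E N

  generator : ∀ {V} → InT₁ V → Vec F (suc n)
  generator ((_ , x , _) , _) = x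

  ∙ᵛ-assoc : ∀ {d} a b (v : Vec F d) → a ∙ᵛ b ∙ᵛ v ≡ (a * b) ∙ᵛ v
  ∙ᵛ-assoc a b []      = refl
  ∙ᵛ-assoc a b (x ∷ v) = cong₂ _∷_ (sym (*-assoc a b x)) (∙ᵛ-assoc a b v)

  0∙ᵛ : ∀ {d} (v : Vec F d) → 0# ∙ᵛ v ≡ 0ᵛ
  0∙ᵛ []      = refl
  0∙ᵛ (x ∷ v) = cong₂ _∷_ (zeroˡ x) (0∙ᵛ v)

  generates : ∀ {V} (p : InT₁ V) → Generates (generator {V} p) V
  generates {V} (((v , _ , span) , x , x≢0 , x∈V , _) , _) with proj₁ span x∈V
  -- k ≠ 0 because the chosen point is nonzero, so v is in turn a multiple of it and both span V.
  ... | k , refl with inverse k (λ { refl → x≢0 (0∙ᵛ v) })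
  ...   | i , ki≡1 = to , λ { (a , refl) → ∙ᵛ-closed V a x∈V }
    where
      to : ∀ {y} → y ∈ ⟦ V ⟧ → ∃ λ a → y ≡ a ∙ᵛ k ∙ᵛ v
      to y∈V with proj₁ span y∈V
      ... | a , refl = a * i , sym (trans (∙ᵛ-assoc (a * i) k v) (cong (_∙ᵛ v)
        (trans (solve 3 (λ a i k → a :* i :* k := a :* (k :* i)) refl a i k) (trans (cong (a *_) ki≡1) (*-identityʳ a)))))

  -- The recursion follows the membership proofs, because the point of the slice on each line is
  -- part of its proof.
  generators : ∀ {Vs} → All InT₁ Vs → List (Vec F (suc n))
  generators []       = []
  generators (_∷_ {V} p ps) = generator {V} p ∷ generators ps

  length-generators : ∀ {Vs} (ps : All InT₁ Vs) → length (generators ps) ≡ length Vs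
  length-generators []       = refl
  length-generators (_ ∷ ps) = cong suc (length-generators ps)

  generators-All : ∀ {P : Pred (Vec F (suc n)) 0ℓ} → (∀ {V} (p : InT₁ V) → P (generator {V} p)) →
    ∀ {Vs} (ps : All InT₁ Vs) → All P (generators ps)
  generators-All f []             = []
  generators-All f (_∷_ {V} p ps) = f {V} p ∷ generators-All (λ {W} → f {W}) ps

  -- Each point spans its line, so equal points would come from equal subspaces.
  generators-unique : ∀ {Vs} → UniqueSetoid.Unique (subspaceSetoid (suc n)) Vs → (ps : All InT₁ Vs) → Unique (generators ps)
  generators-unique []       []             = []
  generators-unique (V≢ ∷ u) (_∷_ {V} p ps) = fresh V≢ ps ∷ generators-unique u ps
    where
      fresh : ∀ {Ws} → All (λ W → ¬ (⟦ V ⟧ ≐ ⟦ W ⟧)) Ws → (ps : All InT₁ Ws) → All (generator {V} p ≢_) (generators ps)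
      fresh []        []              = []
      fresh (V≢W ∷ r) (_∷_ {W} p′ ps) = (λ eq → V≢W (same eq)) ∷ fresh r ps
        where
          same : generator {V} p ≡ generator {W} p′ → ⟦ V ⟧ ≐ ⟦ W ⟧
          same eq = (λ y∈V → proj₂ (generates {W} p′) (subst Span eq (proj₁ (generates {V} p) y∈V)))
                  , (λ y∈W → proj₂ (generates {V} p) (subst Span (sym eq) (proj₁ (generates {W} p′) y∈W)))
            where
              Span : ∀ {y} → Vec F (suc n) → Set
              Span {y} w = ∃ λ c → y ≡ c ∙ᵛ w

  module Bound {c e : F} (ce≡1 : c * e ≡ 1#) (l≢0 : l ≢ 0#) (l²c+1≡l² : l * l * c + 1# ≡ l * l)
    {B : ℤ} (excess≤B : ∀ w → Excess.excess ce≡1 n w ℤ.≤ B) where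
    open Cone ce≡1 excess≤B

    -- Both sides are x₁² + ... + x_{d-1}² + (1 + c) x_d². On the sphere at height l this makes the
    -- form equal to 1 + l² c - l² = 0.
    form-last : ∀ m (v : Vec F (suc m)) →
      form (coefficients c m) v + last v * last v ≡ ‖ v ‖ + last v * last v * c
    form-last zero (x ∷ []) =
      solve 2 (λ c x → c :* (x :* x) :+ con 0 :+ x :* x := (x :* (x :* con 1) :+ con 0) :+ x :* x :* c) refl c x
    form-last (suc m) (x ∷ y ∷ v) = begin
      (1# * (x * x) + form (coefficients c m) (y ∷ v)) + L * L
        ≡⟨ solve 3 (λ x f t → (con 1 :* (x :* x) :+ f) :+ t := x :* (x :* con 1) :+ (f :+ t)) refl x _ (L * L) ⟩
      x ^ 2 + (form (coefficients c m) (y ∷ v) + L * L)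
        ≡⟨ cong (x ^ 2 +_) (form-last m (y ∷ v)) ⟩
      x ^ 2 + (‖ y ∷ v ‖ + L * L * c)
        ≡⟨ sym (+-assoc (x ^ 2) ‖ y ∷ v ‖ (L * L * c)) ⟩
      x ^ 2 + ‖ y ∷ v ‖ + L * L * c ∎
      where
        open ≡-Reasoning
        L = last (y ∷ v)

    generator-onSlice : ∀ {V} (p : InT₁ V) → OnSlice l (generator {V} p)
    generator-onSlice ((_ , x , _ , _ , refl , unit) , _) = refl , +-cancelʳ (last x * last x) (begin
      form (coefficients c n) x + last x * last x   ≡⟨ form-last n x ⟩
      ‖ x ‖ + last x * last x * c                   ≡⟨ cong (_+ last x * last x * c) unit ⟩
      1# + last x * last x * c                      ≡⟨ +-comm 1# _ ⟩
      last x * last x * c + 1#                      ≡⟨ l²c+1≡l² ⟩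
      last x * last x                               ≡⟨ sym (+-identityˡ _) ⟩
      0# + last x * last x                          ∎)
      where open ≡-Reasoning

    generator-values≤ : ∀ {V} (p : InT₁ V) → fromℕ (length (values (generator {V} p))) ≤ℝ N
    generator-values≤ {V} p@(_ , atMost) = values≤ {V = V} {N} (generates {V} p) atMost

    -- For each point q |E|² ≤ q m J = m (H + |E|²); summing over the list leaves the total of H,
    -- which the slice estimate controls.
    ∑-energy-bound : ∀ {ws} → Unique ws → All (OnSlice l) ws → ∀ {m} → All (λ w → length (values w) ℕ.≤ m) ws →
      ℤ.+ length ws ℤ.* (Q ℤ.* (M ℤ.* M)) ℤ.≤ ℤ.+ m ℤ.* (bound ℤ.+ ℤ.+ length ws ℤ.* (M ℤ.* M))
    ∑-energy-bound {ws} u slice {m} bounds = begin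
      ℤ.+ length ws ℤ.* (Q ℤ.* (M ℤ.* M))
        ≡⟨ sym (∑-const ws (Q ℤ.* (M ℤ.* M))) ⟩
      ∑[ w ← ws ] (Q ℤ.* (M ℤ.* M))
        ≤⟨ ∑-mono (All.map (λ {w} → pointwise w) bounds) ⟩
      ∑[ w ← ws ] (ℤ.+ m ℤ.* (deviation w ℤ.+ M ℤ.* M))
        ≡⟨ trans (∑-*ˡ ws (ℤ.+ m) (λ w → deviation w ℤ.+ M ℤ.* M)) (cong (ℤ.+ m ℤ.*_)
             (trans (∑-+ ws deviation (λ _ → M ℤ.* M)) (cong (λ t → ∑ ws deviation ℤ.+ t) (∑-const ws (M ℤ.* M))))) ⟩
      ℤ.+ m ℤ.* (∑ ws deviation ℤ.+ ℤ.+ length ws ℤ.* (M ℤ.* M))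
        ≤⟨ *-monoˡ {ℤ.+ m} (ℤ.+≤+ ℕ.z≤n) (ℤₚ.+-monoˡ-≤ (ℤ.+ length ws ℤ.* (M ℤ.* M)) (∑-slice-deviation≤ l≢0 u slice)) ⟩
      ℤ.+ m ℤ.* (bound ℤ.+ ℤ.+ length ws ℤ.* (M ℤ.* M)) ∎
      where
        open ℤₚ.≤-Reasoning
        rearrange : ∀ a m j s → a ℤ.* (m ℤ.* j) ≡ m ℤ.* (a ℤ.* j ℤ.- s ℤ.+ s)
        rearrange = ℤSolver.solve-∀
        pointwise : ∀ w → length (values w) ℕ.≤ m → Q ℤ.* (M ℤ.* M) ℤ.≤ ℤ.+ m ℤ.* (deviation w ℤ.+ M ℤ.* M)
        pointwise w le = begin
          Q ℤ.* (M ℤ.* M)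
            ≤⟨ *-monoˡ {Q} (ℤ.+≤+ ℕ.z≤n) (ℤₚ.≤-trans (M²≤values*energy w)
                 (*-monoʳ (∑-nonneg elements λ t → square-nonneg (fibre w t)) (ℤ.+≤+ le))) ⟩
          Q ℤ.* (ℤ.+ m ℤ.* energy w)
            ≡⟨ rearrange Q (ℤ.+ m) (energy w) (M ℤ.* M) ⟩
          ℤ.+ m ℤ.* (deviation w ℤ.+ M ℤ.* M) ∎

    T₁-bound : (E≢∅ : Satisfiable E) (N>0 : 0ℝ <ℝ N) (N<q : N <ℝ fromℕ q) → 0ℤ ℤ.≤ B →
      ∀ {Y} → (∀ k → seq Y k ≡ ι B) →
      let gap>0 = x<y⇒0<y-x {N} {fromℕ q} N<q
          den>0 = *ℝ-pos {fromℕ q -ℝ N} {fromℕ (card E?)} gap>0 (fromℕ-pos (card-pos E? E≢∅))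
      in AtMost (subspaceSetoid (suc n)) InT₁
           ((N *ℝ fromℕ (q ℕ.^ n)) /ℝ ((fromℕ q -ℝ N) *ℝ fromℕ (card E?)) [ den>0 ] +ℝ (N *ℝ Y) /ℝ (fromℕ q -ℝ N) [ gap>0 ])
    T₁-bound E≢∅ N>0 N<q B≥0 {Y} Y≡B Vs u ps
      with maximum≤ (length ∘ values) {N} N>0 (generators-All (λ {V} → generator-values≤ {V}) ps)
    ... | m , m≤N , bounds = real-bound {N} {q} N<q (card-pos E? E≢∅) {length Vs} {q ℕ.^ n} {m} {B} {Y} Y≡B B≥0 m≤N
      (subst₂ (λ L p → ℤ.+ L ℤ.* (Q ℤ.* (M ℤ.* M)) ℤ.≤ ℤ.+ m ℤ.* (p ℤ.* M ℤ.+ B ℤ.* (M ℤ.* M) ℤ.+ ℤ.+ L ℤ.* (M ℤ.* M)))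
        (length-generators ps) (sym (Excess.pos-^ ce≡1 n))
        (∑-energy-bound (generators-unique u ps) (generators-All (λ {V} → generator-onSlice {V}) ps) bounds))

-- The cases by parity of d and by the sign of the discriminant.

theorem1p3 : (q : ℕ) → IsPrimePower q → 2 ∤ q → (𝔽 : FiniteField q) →
    let open FiniteField 𝔽 in
    (d : ℕ) → 3 ℕ.≤ d →
    (E : Pred (Vec F d) 0ℓ) (E? : Decidable E) (E≢∅ : Satisfiable E) →
    (λ₀ : F) → λ₀ ≢ 0# → λ₀ ≢ 1# → λ₀ ≢ - 1# →
    (N : ℝ) → 0ℝ <ℝ N → (N<q : N <ℝ fromℕ q) →
    let Q         = fromℕ q
        ∣E∣       = fromℕ (card E?)
        Q-N>0     = x<y⇒0<y-x {N} {Q} N<q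
        ∣E∣>0     = fromℕ-pos (card-pos E? E≢∅)
        den>0     = *ℝ-pos {Q -ℝ N} {∣E∣} Q-N>0 ∣E∣>0
        main      = (N *ℝ fromℕ (q ℕ.^ (d ∸ 1))) /ℝ ((Q -ℝ N) *ℝ ∣E∣) [ den>0 ]
        ∣T₁∣≤_    = AtMost (subspaceSetoid d) (T₁ X[ hyperplane λ₀ ] E N)
    in
      (2 ∤ d →
        ∣T₁∣≤ (main +ℝ ((N *ℝ fromℕ (q ℕ.^ ((d ∸ 1) / 2))) /ℝ (Q -ℝ N) [ Q-N>0 ])))
      ×
      (4 ℕ.≤ d → 2 ∣ d → η ((- 1#) ^ (d / 2) * (λ₀ ^ 2 - 1#)) ≡ -1ℤ →
        ∣T₁∣≤ (main +ℝ ((N *ℝ fromℕ (q ℕ.^ ((d ∸ 2) / 2))) /ℝ (Q -ℝ N) [ Q-N>0 ])))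
      ×
      (4 ℕ.≤ d → 2 ∣ d → η ((- 1#) ^ (d / 2) * (λ₀ ^ 2 - 1#)) ≡ 1ℤ →
        ∣T₁∣≤ (main +ℝ ((N *ℝ (fromℕ (q ℕ.^ (d / 2)) -ℝ fromℕ (q ℕ.^ ((d ∸ 2) / 2))))
                        /ℝ (Q -ℝ N) [ Q-N>0 ])))
theorem1p3 q _ q-odd 𝔽 (suc n) _ E E? E≢∅ l l≢0 l≢1 l≢-1 N N>0 N<q = odd-dim , even-dim⁻ , even-dim⁺
  where
    open FiniteField 𝔽
    open FieldCounting 𝔽 hiding (Q)
    open OddOrder q-odd

    l⁻¹ : F
    l⁻¹ = proj₁ (inverse l l≢0)

    -- The form x₁² + … + x_{d-1}² + c x_d² vanishes at the points of the sphere with x_d = l.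
    c : F
    c = (l ^ 2 - 1#) * (l⁻¹ * l⁻¹)

    l²c≡l²-1 : l * l * c ≡ l ^ 2 - 1#
    l²c≡l²-1 = begin
      l * l * ((l ^ 2 - 1#) * (l⁻¹ * l⁻¹))     ≡⟨ solve 3 (λ l i t → l :* l :* (t :* (i :* i)) := (l :* i) :* (l :* i) :* t) refl l l⁻¹ (l ^ 2 - 1#) ⟩
      (l * l⁻¹) * (l * l⁻¹) * (l ^ 2 - 1#)     ≡⟨ cong (λ u → u * u * (l ^ 2 - 1#)) (proj₂ (inverse l l≢0)) ⟩
      1# * 1# * (l ^ 2 - 1#)                   ≡⟨ solve 1 (λ t → con 1 :* con 1 :* t := t) refl (l ^ 2 - 1#) ⟩
      l ^ 2 - 1#                               ∎
      where open ≡-Reasoning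

    l²≡l*l : l ^ 2 ≡ l * l
    l²≡l*l = cong (l *_) (*-identityʳ l)

    l²c+1≡l² : l * l * c + 1# ≡ l * l
    l²c+1≡l² = trans (cong (_+ 1#) l²c≡l²-1) (trans (+-assoc (l ^ 2) (- 1#) 1#)
      (trans (cong (l ^ 2 +_) (-‿inverseˡ 1#)) (trans (+-identityʳ (l ^ 2)) l²≡l*l)))

    -- c = 0 would give l² = 1, hence l = 1 or l = -1. An inverse of c is what gives the form its
    -- dual.
    c≢0 : c ≢ 0#
    c≢0 c≡0 with square≡square {l} {1#} (trans (sym l²c+1≡l²)
      (trans (cong (λ t → l * l * t + 1#) c≡0) (solve 1 (λ l → l :* l :* con 0 :+ con 1 := con 1 :* con 1) refl l)))
    ... | inj₁ l≡1  = l≢1 l≡1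
    ... | inj₂ l≡-1 = l≢-1 l≡-1

    ce≡1 = proj₂ (inverse c c≢0)
    open Counts 𝔽 q-odd
    open Excess ce≡1

    bound : ∀ {B} → (∀ w → excess n w ℤ.≤ B) → _
    bound {B} excess≤B = Lines.Bound.T₁-bound 𝔽 q-odd E? l N ce≡1 l≢0 l²c+1≡l² {B} excess≤B E≢∅ N>0 N<q

    even⊎odd : ∀ m → 2 ∣ m ⊎ 2 ∣ suc m
    even⊎odd zero    = inj₁ (divides 0 refl)
    even⊎odd (suc m) with even⊎odd m
    ... | inj₁ (divides k eq) = inj₂ (divides (suc k) (cong (suc ∘ suc) eq))
    ... | inj₂ 2∣suc          = inj₁ 2∣suc

    odd-dim : 2 ∤ suc n → _
    odd-dim 2∤d with even⊎odd n
    ... | inj₂ 2∣d              = contradiction 2∣d 2∤d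
    -- Here n = 2 k: the form has 2 k + 1 variables and the exponent (d - 1) / 2 is k.
    ... | inj₁ (divides k refl) = bound (excess-odd-dim k) (ℤ.+≤+ ℕ.z≤n)
      {fromℕ (q ℕ.^ (n / 2))} (λ _ → cong (λ m → ι (ℤ.+ (q ℕ.^ m))) (DivMod.m*n/n≡m k 2))

    sign : ∀ k → suc n ≡ suc k ℕ.* 2 → η ((- 1#) ^ (suc n / 2) * (l ^ 2 - 1#)) ≡ ε ℤ.^ k ℤ.* η (- c)
    sign k eq = trans
      (cong₂ (λ m t → η ((- 1#) ^ m * t)) (trans (cong (_/ 2) eq) (DivMod.m*n/n≡m (suc k) 2)) (sym l²c≡l²-1))
      (sign-discriminant k l≢0)

    even-dim⁻ : 4 ℕ.≤ suc n → 2 ∣ suc n → η ((- 1#) ^ (suc n / 2) * (l ^ 2 - 1#)) ≡ -1ℤ → _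
    -- d = 2 (k + 1), so n = 2 k + 1 and (d - 2) / 2 = k; the quotient 0 is impossible as d is a
    -- successor.
    even-dim⁻ _ (divides (suc k) refl) σ≡-1 = bound (excess-even-dim⁻ k (trans (sym (sign k refl)) σ≡-1)) (ℤ.+≤+ ℕ.z≤n)
      {fromℕ (q ℕ.^ ((suc n ∸ 2) / 2))} (λ _ → cong (λ m → ι (ℤ.+ (q ℕ.^ m))) (DivMod.m*n/n≡m k 2))

    even-dim⁺ : 4 ℕ.≤ suc n → 2 ∣ suc n → η ((- 1#) ^ (suc n / 2) * (l ^ 2 - 1#)) ≡ 1ℤ → _
    -- The real difference is constant termwise, and `ι` carries the integer difference q^{k+1} -
    -- q^k to it.
    even-dim⁺ _ (divides (suc k) refl) σ≡1 = bound (excess-even-dim⁺ k (trans (sym (sign k refl)) σ≡1)) B≥0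
      {fromℕ (q ℕ.^ (suc n / 2)) -ℝ fromℕ (q ℕ.^ ((suc n ∸ 2) / 2))} (λ _ → trans
        (cong₂ (λ a b → ι (ℤ.+ (q ℕ.^ a)) ℚ.- ι (ℤ.+ (q ℕ.^ b))) (DivMod.m*n/n≡m (suc k) 2) (DivMod.m*n/n≡m k 2))
        (sym (trans (ι-+ (ℤ.+ (q ℕ.^ suc k)) (ℤ.- ℤ.+ (q ℕ.^ k))) (cong (λ t → ι (ℤ.+ (q ℕ.^ suc k)) ℚ.+ t) (ι-neg (ℤ.+ (q ℕ.^ k)))))))
      where
        1≤q : 1 ℕ.≤ q
        1≤q = ℕₚ.≤-trans (ℕ.s≤s ℕ.z≤n) (ℤₚ.drop‿+≤+ (Forms.2≤Q 𝔽 q-odd))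
        B≥0 : 0ℤ ℤ.≤ ℤ.+ (q ℕ.^ suc k) ℤ.- ℤ.+ (q ℕ.^ k)
        B≥0 = ℤₚ.i≤j⇒0≤j-i (ℤ.+≤+ (ℕₚ.≤-trans (ℕₚ.≤-reflexive (sym (ℕₚ.*-identityˡ (q ℕ.^ k)))) (ℕₚ.*-monoˡ-≤ (q ℕ.^ k) 1≤q)))
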